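{- There is an algorithm that, given as input a connected graph $G$ with no star cutset, with $n$ vertices and $m$ edges, runs in time $O(n^3m)$ and outputs a minimally-sided non-path 2-join of $G$, or certifies that $G$ has no non-path 2-join.
   Context: Graphs are finite, simple and undirected. A partition $(X_1,X_2)$ of the vertex set of a graph $G$ is a \emph{2-join} if for $i=1,2$ there exist disjoint non-empty sets $A_i,B_i\subseteq X_i$ such that: every vertex of $A_1$ is adjacent to every vertex of $A_2$, every vertex of $B_1$ is adjacent to every vertex of $B_2$, and there are no other edges between $X_1$ and $X_2$; and $|X_i|\ge 3$ for $i=1,2$. In this case $(X_1,X_2,A_1,B_1,A_2,B_2)$ is called a \emph{split} of the 2-join $(X_1,X_2)$, and $C_i$ denotes $X_i\setminus(A_i\cup B_i)$. A 2-join is a \emph{path 2-join} if it has a split $(X_1,X_2,A_1,B_1,A_2,B_2)$ such that for some $i\in\{1,2\}$, the induced subgraph $G[X_i]$ is a path with one end in $A_i$, one end in $B_i$ and all interior vertices in $C_i$. A \emph{non-path 2-join} is a 2-join that is not a path 2-join. A non-path 2-join $(X_1,X_2)$ of $G$ is \emph{minimally-sided} if for some $i\in\{1,2\}$ the following holds: for every non-path 2-join $(X_1',X_2')$ of $G$, neither $X_1'\subsetneq X_i$ nor $X_2'\subsetneq X_i$. A \emph{star cutset} of $G$ is a set $S\subseteq V(G)$ such that $G\setminus S$ is disconnected and for some $x\in S$, $x$ is adjacent to all vertices of $S\setminus\{x\}$. -}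

module Defs where

open import Data.Bool using (Bool; false; if_then_else_; _∧_; T)
open import Data.Bool.Properties using (T?)
open import Data.Fin using (Fin; zero; toℕ; fromℕ; fromℕ<; remQuot)
import Data.Fin as Fin
open import Data.Fin.Subset
  using (Subset; _∈_; _⊆_; _⊂_; _∪_; _∩_; _─_; ∁; ∣_∣; Nonempty; Empty; ⊤)
open import Data.List using (length; filter; allFin; cartesianProduct)
open import Data.Nat
  using (ℕ; suc; _+_; _*_; _∸_; _^_; _%_; _≤_; _≡ᵇ_; _<ᵇ_; _<?_)
open import Data.Nat.Properties using (m^n≢0)
open import Data.Product using (_×_; _,_; ∃; ∃-syntax; uncurry)
open import Data.Sum using (_⊎_)
open import Data.Vec using (tabulate)
open import Function.Bundles using (_⇔_)
open import Function.Definitions using (Injective)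
open import Relation.Binary.Construct.Closure.ReflexiveTransitive using (Star)
open import Relation.Binary.PropositionalEquality using (_≡_; _≢_)
open import Relation.Nullary using (¬_; yes; no)
open import Relation.Nullary.Decidable using (_×-dec_)

------------------------------------------------------------------------
-- Graphs

record Graph (n : ℕ) : Set where
  field
    adj    : Fin n → Fin n → Bool
    sym    : ∀ u v → adj u v ≡ adj v u
    irrefl : ∀ u → adj u u ≡ false

  Adj : Fin n → Fin n → Set
  Adj u v = T (adj u v)

  numEdges : ℕ
  numEdges = length (filter (λ (u , v) → (u Fin.<? v) ×-dec T? (adj u v))
                            (cartesianProduct (allFin n) (allFin n)))

open Graph public using (Adj; numEdges)

module _ {n : ℕ} (G : Graph n) where

  -- Reachability in the induced subgraph G[X].
  Reachable : Subset n → Fin n → Fin n → Set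
  Reachable X = Star (λ u v → u ∈ X × v ∈ X × Adj G u v)

  ConnectedOn : Subset n → Set
  ConnectedOn X = ∀ u v → u ∈ X → v ∈ X → Reachable X u v

  Connected : Set
  Connected = ConnectedOn ⊤

  IsStarCutset : Subset n → Set
  IsStarCutset S =
    ¬ ConnectedOn (∁ S) ×
    ∃[ x ] (x ∈ S × (∀ y → y ∈ S → y ≢ x → Adj G x y))

  HasStarCutset : Set
  HasStarCutset = ∃[ S ] IsStarCutset S

  ----------------------------------------------------------------------
  -- 2-joins

  record IsSplit (X₁ X₂ A₁ B₁ A₂ B₂ : Subset n) : Set where
    field
      X-cover    : X₁ ∪ X₂ ≡ ⊤
      X-disjoint : Empty (X₁ ∩ X₂)
      A₁⊆X₁      : A₁ ⊆ X₁
      B₁⊆X₁      : B₁ ⊆ X₁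
      A₂⊆X₂      : A₂ ⊆ X₂
      B₂⊆X₂      : B₂ ⊆ X₂
      A₁B₁-disjoint : Empty (A₁ ∩ B₁)
      A₂B₂-disjoint : Empty (A₂ ∩ B₂)
      A₁-nonempty : Nonempty A₁
      B₁-nonempty : Nonempty B₁
      A₂-nonempty : Nonempty A₂
      B₂-nonempty : Nonempty B₂
      A-complete : ∀ u v → u ∈ A₁ → v ∈ A₂ → Adj G u v
      B-complete : ∀ u v → u ∈ B₁ → v ∈ B₂ → Adj G u v
      no-other   : ∀ u v → u ∈ X₁ → v ∈ X₂ → Adj G u v →
                   (u ∈ A₁ × v ∈ A₂) ⊎ (u ∈ B₁ × v ∈ B₂)
      X₁-size    : 3 ≤ ∣ X₁ ∣
      X₂-size    : 3 ≤ ∣ X₂ ∣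

  Is2Join : Subset n → Subset n → Set
  Is2Join X₁ X₂ = ∃[ A₁ ] ∃[ B₁ ] ∃[ A₂ ] ∃[ B₂ ] IsSplit X₁ X₂ A₁ B₁ A₂ B₂

  -- p is an isomorphism from the path 0 – 1 – … – k onto G[X].
  record IsPathOn (X : Subset n) {k : ℕ} (p : Fin (suc k) → Fin n) : Set where
    field
      injective : Injective _≡_ _≡_ p
      image     : ∀ v → v ∈ X ⇔ (∃[ i ] p i ≡ v)
      edges     : ∀ i j → Adj G (p i) (p j) ⇔
                  (toℕ j ≡ suc (toℕ i) ⊎ toℕ i ≡ suc (toℕ j))

  IsPathSide : (X A B : Subset n) → Set
  IsPathSide X A B =
    ∃[ k ] ∃ λ (p : Fin (suc k) → Fin n) →
      IsPathOn X p × p zero ∈ A × p (fromℕ k) ∈ B ×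
      (∀ i → i ≢ zero → i ≢ fromℕ k → p i ∈ X ─ (A ∪ B))

  IsPath2Join : Subset n → Subset n → Set
  IsPath2Join X₁ X₂ =
    ∃[ A₁ ] ∃[ B₁ ] ∃[ A₂ ] ∃[ B₂ ]
      (IsSplit X₁ X₂ A₁ B₁ A₂ B₂ × (IsPathSide X₁ A₁ B₁ ⊎ IsPathSide X₂ A₂ B₂))

  IsNonPath2Join : Subset n → Subset n → Set
  IsNonPath2Join X₁ X₂ = Is2Join X₁ X₂ × ¬ IsPath2Join X₁ X₂

  HasNoSmallerSide : Subset n → Set
  HasNoSmallerSide X =
    ∀ X₁′ X₂′ → IsNonPath2Join X₁′ X₂′ → ¬ (X₁′ ⊂ X) × ¬ (X₂′ ⊂ X)

  IsMinimallySidedNonPath2Join : Subset n → Subset n → Set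
  IsMinimallySidedNonPath2Join X₁ X₂ =
    IsNonPath2Join X₁ X₂ × (HasNoSmallerSide X₁ ⊎ HasNoSmallerSide X₂)

------------------------------------------------------------------------
-- Word RAM
--
-- The model of computation is a structured unit-cost word RAM.  The memory
-- is divided into arrays; a program, being a finite piece of syntax with
-- constant array names, uses only a bounded number of them.  Indices are
-- words computed at run time; a scalar variable is cell 0 of an array.
-- Every computed value is reduced to w bits, so that unit cost per
-- operation cannot be abused by working with long integers.

data Op : Set where
  plus monus times less equal : Op

data Expr : Set where
  lit  : ℕ → Expr
  read : (array : ℕ) (index : Expr) → Expr
  bin  : Op → Expr → Expr → Expr

data Program : Set where
  skip   : Program
  assign : (array : ℕ) (index value : Expr) → Program
  _⨾_    : Program → Program → Program
  ifz    : (test : Expr) (zeroBranch nonzeroBranch : Program) → Program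
  while  : (test : Expr) (body : Program) → Program

infixr 5 _⨾_

Memory : Set
Memory = ℕ → ℕ → ℕ

write : Memory → (array index value : ℕ) → Memory
write s a i x b j = if (b ≡ᵇ a) ∧ (j ≡ᵇ i) then x else s b j

bit : Bool → ℕ
bit b = if b then 1 else 0

wrap : (w : ℕ) → ℕ → ℕ
wrap w x = _%_ x (2 ^ w) {{m^n≢0 2 w}}

evalOp : Op → ℕ → ℕ → ℕ
evalOp plus  x y = x + y
evalOp monus x y = x ∸ y
evalOp times x y = x * y
evalOp less  x y = bit (x <ᵇ y)
evalOp equal x y = bit (x ≡ᵇ y)

eval : (w : ℕ) → Memory → Expr → ℕ
eval w s (lit x)     = wrap w x
eval w s (read a e)  = s a (eval w s e)
eval w s (bin o e f) = wrap w (evalOp o (eval w s e) (eval w s f))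

cost : Expr → ℕ
cost (lit _)     = 1
cost (read _ e)  = 1 + cost e
cost (bin _ e f) = 1 + cost e + cost f

-- w ⊢ P , s ⇓ s′ [ t ]: with word size w, the program P started in memory s
-- halts in memory s′ after exactly t time units.  The rules are
-- deterministic, and diverging computations have no derivation.

infix 4 _⊢_,_⇓_[_]

data _⊢_,_⇓_[_] (w : ℕ) : Program → Memory → Memory → ℕ → Set where
  ⇓skip   : ∀ {s} → w ⊢ skip , s ⇓ s [ 1 ]
  ⇓assign : ∀ {s a e f} →
            w ⊢ assign a e f , s ⇓ write s a (eval w s e) (eval w s f)
              [ 1 + cost e + cost f ]
  ⇓seq    : ∀ {s s′ s″ P Q t u} →
            w ⊢ P , s ⇓ s′ [ t ] → w ⊢ Q , s′ ⇓ s″ [ u ] →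
            w ⊢ P ⨾ Q , s ⇓ s″ [ t + u ]
  ⇓ifz-0  : ∀ {s s′ e P Q t} → eval w s e ≡ 0 →
            w ⊢ P , s ⇓ s′ [ t ] →
            w ⊢ ifz e P Q , s ⇓ s′ [ 1 + cost e + t ]
  ⇓ifz-≢0 : ∀ {s s′ e P Q t} → eval w s e ≢ 0 →
            w ⊢ Q , s ⇓ s′ [ t ] →
            w ⊢ ifz e P Q , s ⇓ s′ [ 1 + cost e + t ]
  ⇓while-0  : ∀ {s e P} → eval w s e ≡ 0 →
              w ⊢ while e P , s ⇓ s [ 1 + cost e ]
  ⇓while-≢0 : ∀ {s s′ s″ e P t u} → eval w s e ≢ 0 →
              w ⊢ P , s ⇓ s′ [ t ] → w ⊢ while e P , s′ ⇓ s″ [ u ] →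
              w ⊢ while e P , s ⇓ s″ [ 1 + cost e + t + u ]

------------------------------------------------------------------------
-- Input and output conventions

-- Row-major adjacency matrix: the entry for (u , v) is at index u * n + v.
matrixCell : ∀ {n} → Graph n → ℕ → ℕ
matrixCell {n} G i with i <? n * n
... | yes i<n² = bit (uncurry (Graph.adj G) (remQuot n (fromℕ< i<n²)))
... | no  _    = 0

-- Cell 0 of array 0 holds n, array 1 holds the adjacency matrix, and all
-- other cells are zero.
input : ∀ {n} → Graph n → Memory
input {n} G 0 0 = n
input     G 1 i = matrixCell G i
input     G _ _ = 0

-- In a final memory, cell 0 of array 2 is the verdict, and array 3 labels
-- the vertices of the i-th side of the partition by i.
verdict : Memory → ℕ
verdict s = s 2 0

side : ∀ {n} → Memory → ℕ → Subset n
side s i = tabulate (λ v → s 3 (toℕ v) ≡ᵇ i)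

CorrectOutput : ∀ {n} → Graph n → Memory → Set
CorrectOutput G s =
  (verdict s ≡ 1 × IsMinimallySidedNonPath2Join G (side s 1) (side s 2)) ⊎
  (verdict s ≡ 0 × ¬ (∃[ X₁ ] ∃[ X₂ ] IsNonPath2Join G X₁ X₂))

-- P solves the problem on G within the given time bound whenever words have
-- at least k · log₂ (n + 2) bits.  As this must hold for the smallest such
-- w too, P can rely only on words of O(log n) bits.
Solves : Program → (k : ℕ) → ∀ {n} → Graph n → (bound : ℕ) → Set
Solves P k {n} G bound =
  ∀ w → (2 + n) ^ k ≤ 2 ^ w →
  ∃[ s ] ∃[ t ] (w ⊢ P , input G ⇓ s [ t ] × t ≤ bound × CorrectOutput G s)

{-# OPTIONS --safe #-}
module Submission where

-- Fix edges a₁a₂ and b₁b₂ that are to run between A₁ and A₂ and between B₁ and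
-- B₂.  Whether (X₁ , X₂) is a 2-join respecting them is a condition on pairs
-- u ∈ X₁, v ∈ X₂, so the admissible sides X₁ are the sets closed under an
-- implication digraph; propagation finds the least and the greatest one inside
-- a given set in O(n²) steps.  An admissible path side has no proper admissible
-- subset with at least three vertices.  Hence, after branching three times on
-- whether an undecided vertex lies in X₁, either the least set has grown twice,
-- or the greatest one has shrunk twice, or nothing is undecided; in each case
-- one of the two sets is a non-path side if there is such a side at all.
--
-- Starting from X = V, the algorithm runs through the n parent edges a₁a₂ of a
-- spanning tree and all m edges b₁b₂, and replaces X by a smaller non-path side
-- as long as this search succeeds.  Failure for a pair of edges persists when X
-- shrinks, so the final X contains no smaller non-path side.  X shrinks at most n times,
-- so there are O(nm + n) searches of O(n²) steps each.

open import Defs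
import Data.Bool
open import Data.Bool using (Bool; true; false; not; _∧_; _∨_; _xor_; if_then_else_; T)
open import Data.Bool.Properties using (T?; ∧-zeroʳ; ∧-identityʳ; ∧-comm; ∨-comm; ∨-zeroʳ)
open import Data.Empty using (⊥; ⊥-elim)
import Data.Fin as Fin
open import Data.Fin using (Fin; zero; suc; toℕ; fromℕ; fromℕ<; combine; remQuot)
open import Data.Fin.Properties
  using (any?; remQuot-combine; toℕ-combine; toℕ-fromℕ; toℕ-fromℕ<; toℕ-injective; toℕ-inject₁; toℕ<n)
open import Data.Fin.Subset using (Subset; _∈_; _∪_; _─_; _⊂_; ∣_∣)
open import Data.Fin.Subset.Properties
  using (x∈p∩q⁺; x∈p∩q⁻; x∈p∪q⁺; x∈p∪q⁻; x∈p∧x∉q⇒x∈p─q; p─q⊆p; ∪-comm; ∈⊤; ⊆-antisym; ⊆-max)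
import Data.List as List
open import Data.List using (length; filter; cartesianProduct)
open import Data.List.Properties using (length-++; filter-++; map-tabulate)
open import Data.Nat
open import Data.Nat.DivMod using (m<n⇒m%n≡m)
open import Data.Nat.Properties
open import Data.Product
import Data.Sum
open import Data.Sum using (_⊎_; inj₁; inj₂; [_,_]′)
open import Data.Unit using (⊤; tt)
import Data.Vec as Vec
open import Data.Vec using ([]; _∷_; lookup; tabulate)
open import Data.Vec.Properties using (lookup∘tabulate; tabulate-cong; []=⇒lookup; lookup⇒[]=)
open import Function using (_∘_; id)
open import Function.Bundles using (mk⇔; Equivalence)
open import Relation.Binary.Construct.Closure.ReflexiveTransitive using (Star; ε; _◅_)
open import Relation.Binary.Definitions using (Tri; tri<; tri≈; tri>)
open import Relation.Binary.PropositionalEquality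
open import Relation.Nullary
open import Relation.Nullary.Decidable using (_×-dec_)
open import Relation.Unary using (Decidable)

-- Three branchings come from the pigeonhole principle: among three decisions two are of the same
-- kind. Two inclusions are what the least set needs. Its seeds a₁ and b₁ are two vertices, the
-- first inclusion gives a third, and after the second it properly contains an admissible set of at
-- least three vertices, which no path side does. The greatest set is treated dually, through
-- complements. The other side of the candidate need not grow: it contains a side of the sought
-- non-path 2-join, and if it were a path side, the two would coincide. All candidates are tested in
-- full, so the branching argument serves completeness only. A failing search is charged to its pair
-- of edges, a successful one to the vertices that leave X; counting nested loops would give a
-- factor n too much, so the time is bounded with a potential function. The summand 1 in the bound
-- is for graphs with at most one vertex, where m = 0.

∧-true⁻ : ∀ {x y} → x ∧ y ≡ true → x ≡ true × y ≡ true
∧-true⁻ {true} {true} _ = refl , refl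

≡ᵇ-refl : ∀ m → (m ≡ᵇ m) ≡ true
≡ᵇ-refl zero    = refl
≡ᵇ-refl (suc m) = ≡ᵇ-refl m

≡ᵇ-true⁻ : ∀ m n → (m ≡ᵇ n) ≡ true → m ≡ n
≡ᵇ-true⁻ zero    zero    _ = refl
≡ᵇ-true⁻ (suc m) (suc n) e = cong suc (≡ᵇ-true⁻ m n e)

≢⇒≡ᵇ-false : ∀ m n → m ≢ n → (m ≡ᵇ n) ≡ false
≢⇒≡ᵇ-false m n m≢n with m ≡ᵇ n in eq
... | true  = contradiction (≡ᵇ-true⁻ m n eq) m≢n
... | false = refl

<ᵇ-true⁺ : ∀ {m n} → m < n → (m <ᵇ n) ≡ true
<ᵇ-true⁺ {zero}  {suc n} _       = refl
<ᵇ-true⁺ {suc m} {suc n} (s≤s p) = <ᵇ-true⁺ p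

<ᵇ-true⁻ : ∀ {m n} → (m <ᵇ n) ≡ true → m < n
<ᵇ-true⁻ {zero}  {suc n} _ = s≤s z≤n
<ᵇ-true⁻ {suc m} {suc n} e = s≤s (<ᵇ-true⁻ e)

≤ᵇ-true⁻ : ∀ m n → (m ≤ᵇ n) ≡ true → m ≤ n
≤ᵇ-true⁻ zero    n _ = z≤n
≤ᵇ-true⁻ (suc m) n e = <ᵇ-true⁻ e

<ᵇ-irrefl : ∀ n → (n <ᵇ n) ≡ false
<ᵇ-irrefl zero    = refl
<ᵇ-irrefl (suc n) = <ᵇ-irrefl n

write-other : ∀ s a i x b j → (b ≡ᵇ a) ≡ false → write s a i x b j ≡ s b j
write-other s a i x b j e rewrite e = refl

write-here : ∀ s a i x → write s a i x a i ≡ x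
write-here s a i x rewrite ≡ᵇ-refl a | ≡ᵇ-refl i = refl

-- A language of counted loops

infixr 5 _▸_

-- Every loop runs over 0, ..., n - 1, so each command halts, and its effect and its time are
-- recursive functions of the memory. `count` is primitive because `wellFormed` lets `set` store
-- only values of degree at most one, which excludes increments; a counter is instead bounded by the
-- loop index.
data Cmd : Set where
  nop   : Cmd
  set   : (a : ℕ) (e f : Expr) → Cmd
  _▸_   : Cmd → Cmd → Cmd
  if    : (e : Expr) (c d : Cmd) → Cmd
  for   : (i : ℕ) (c : Cmd) → Cmd
  count : (c i : ℕ) (e : Expr) → Cmd

var : ℕ → Expr
var a = read a (lit 0)

incr : ℕ → Program
incr a = assign a (lit 0) (bin plus (var a) (lit 1))

loop : ℕ → Program → Program
loop i P = assign i (lit 0) (lit 0) ⨾ while (bin less (var i) (var 0)) (P ⨾ incr i)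

compile : Cmd → Program
compile nop           = skip
compile (set a e f)   = assign a e f
compile (c ▸ d)       = compile c ⨾ compile d
compile (if e c d)    = ifz e (compile c) (compile d)
compile (for i c)     = loop i (compile c)
compile (count c i e) = assign c (lit 0) (lit 0) ⨾ loop i (ifz e skip (incr c))

⟦_⟧ : Expr → Memory → ℕ
⟦ lit x ⟧     s = x
⟦ read a e ⟧  s = s a (⟦ e ⟧ s)
⟦ bin o e f ⟧ s = evalOp o (⟦ e ⟧ s) (⟦ f ⟧ s)

branch : {A : Set} → ℕ → A → A → A
branch zero    x y = x
branch (suc _) x y = y

increment : ℕ → Memory → Memory
increment a s = write s a 0 (s a 0 + 1)

countStep : ℕ → Expr → Memory → Memory
countStep c e s = branch (⟦ e ⟧ s) s (increment c s)

iter : (Memory → Memory) → ℕ → Memory → Memory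
iter f zero    s = s
iter f (suc r) s = iter f r (f s)

-- Each evaluation of the loop test costs 6, and so does each increment of the index; the 6 in the
-- base case is the test that ends the loop.
iterTime : (Memory → Memory) → (Memory → ℕ) → ℕ → Memory → ℕ
iterTime f t zero    s = 6
iterTime f t (suc r) s = 6 + (t s + 6) + iterTime f t r (f s)

module Semantics (n : ℕ) where

  exec : Cmd → Memory → Memory
  exec nop           s = s
  exec (set a e f)   s = write s a (⟦ e ⟧ s) (⟦ f ⟧ s)
  exec (c ▸ d)       s = exec d (exec c s)
  exec (if e c d)    s = branch (⟦ e ⟧ s) (exec c s) (exec d s)
  exec (for i c)     s = iter (increment i ∘ exec c) n (write s i 0 0)
  exec (count c i e) s = iter (increment i ∘ countStep c e) n (write (write s c 0 0) i 0 0)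

  countStepTime : ℕ → Expr → Memory → ℕ
  countStepTime c e s = 1 + cost e + branch (⟦ e ⟧ s) 1 6

  time : Cmd → Memory → ℕ
  time nop           s = 1
  time (set a e f)   s = 1 + cost e + cost f
  time (c ▸ d)       s = time c s + time d (exec c s)
  time (if e c d)    s = 1 + cost e + branch (⟦ e ⟧ s) (time c s) (time d s)
  time (for i c)     s = 3 + iterTime (increment i ∘ exec c) (time c) n (write s i 0 0)
  time (count c i e) s =
    3 + (3 + iterTime (increment i ∘ countStep c e) (countStepTime c e) n
                      (write (write s c 0 0) i 0 0))

unread : ℕ → Expr → Bool
unread b (lit x)     = true
unread b (read a e)  = not (b ≡ᵇ a) ∧ unread b e
unread b (bin o e f) = unread b e ∧ unread b f

-- Tracked per array and computed as a Boolean, so that frame conditions of concrete commands are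
-- proved by `refl`.
unwritten : ℕ → Cmd → Bool
unwritten b nop           = true
unwritten b (set a e f)   = not (b ≡ᵇ a)
unwritten b (c ▸ d)       = unwritten b c ∧ unwritten b d
unwritten b (if e c d)    = unwritten b c ∧ unwritten b d
unwritten b (for i c)     = not (b ≡ᵇ i) ∧ unwritten b c
unwritten b (count c i e) = not (b ≡ᵇ c) ∧ not (b ≡ᵇ i)

-- If all memory cells are at most B ≥ 2, the value of e is at most B ^ degree e.
degree : Expr → ℕ
degree (lit x)         = x ∸ 1
degree (read _ _)      = 1
degree (bin plus e f)  = 1 + (degree e ⊔ degree f)
degree (bin monus e f) = degree e
degree (bin times e f) = degree e + degree f
degree (bin less e f)  = 0
degree (bin equal e f) = 0

-- A bound on the degrees of all expressions that the program evaluates. One more factor gives the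
-- strict inequality that modular reduction needs, hence the exponent 9 in the word size.
maxDegree : ℕ
maxDegree = 8

fits : Expr → Bool
fits (lit x)     = x ≤ᵇ 2
fits (read a e)  = fits e
fits (bin o e f) = (fits e ∧ fits f) ∧ (degree (bin o e f) ≤ᵇ maxDegree)

-- What keeps memories `Valid` during execution: n in array 0 is never overwritten, stored values
-- have degree at most one and so remain below the cell bound, and no loop body changes its own
-- index.
wellFormed : Cmd → Bool
wellFormed nop           = true
wellFormed (set a e f)   = not (0 ≡ᵇ a) ∧ ((fits e ∧ fits f) ∧ (degree f ≤ᵇ 1))
wellFormed (c ▸ d)       = wellFormed c ∧ wellFormed d
wellFormed (if e c d)    = fits e ∧ (wellFormed c ∧ wellFormed d)
wellFormed (for i c)     = not (0 ≡ᵇ i) ∧ (unwritten i c ∧ wellFormed c)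
wellFormed (count c i e) = (not (0 ≡ᵇ c) ∧ not (0 ≡ᵇ i)) ∧ ((not (i ≡ᵇ c) ∧ not (c ≡ᵇ i)) ∧ fits e)

not-true⁻ : ∀ {x} → not x ≡ true → x ≡ false
not-true⁻ {false} _ = refl

⟦⟧-cong : ∀ e {s s′} → (∀ b → unread b e ≡ false → ∀ j → s b j ≡ s′ b j) → ⟦ e ⟧ s ≡ ⟦ e ⟧ s′
⟦⟧-cong (lit x)     h = refl
⟦⟧-cong (read a e) {s} {s′} h
  rewrite ⟦⟧-cong e {s} {s′} (λ b u → h b (trans (cong (not (b ≡ᵇ a) ∧_) u) (∧-zeroʳ _)))
  = h a (cong (λ z → not z ∧ unread a e) (≡ᵇ-refl a)) _
⟦⟧-cong (bin o e f) {s} {s′} h =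
  cong₂ (evalOp o) (⟦⟧-cong e (λ b u → h b (cong (_∧ unread b f) u)))
                   (⟦⟧-cong f (λ b u → h b (trans (cong (unread b e ∧_) u) (∧-zeroʳ _))))

branch-elim : ∀ {A : Set} (P : A → Set) m x y → P x → P y → P (branch m x y)
branch-elim P zero    _ _ p q = p
branch-elim P (suc m) _ _ p q = q

increment-other : ∀ a s b j → (b ≡ᵇ a) ≡ false → increment a s b j ≡ s b j
increment-other a s b j = write-other s a 0 (s a 0 + 1) b j

increment-here : ∀ a s {k} → s a 0 ≡ k → increment a s a 0 ≡ suc k
increment-here a s e = trans (write-here s a 0 (s a 0 + 1)) (trans (+-comm (s a 0) 1) (cong suc e))

countStep-elim : (P : Memory → Set) → ∀ c e s → P s → P (increment c s) → P (countStep c e s)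
countStep-elim P c e s = branch-elim P (⟦ e ⟧ s) s (increment c s)

module Frames (n : ℕ) where
  open Semantics n

  iter-preserves : ∀ {f} (P : Memory → Set) → (∀ s → P s → P (f s)) → ∀ r s → P s → P (iter f r s)
  iter-preserves P h zero    s p = p
  iter-preserves P h (suc r) s p = iter-preserves P h r _ (h s p)

  exec-unwritten : ∀ c b → unwritten b c ≡ true → ∀ s j → exec c s b j ≡ s b j
  exec-unwritten nop         b u s j = refl
  exec-unwritten (set a e f) b u s j = write-other s a _ _ b j (not-true⁻ u)
  exec-unwritten (c ▸ d)     b u s j =
    let uc , ud = ∧-true⁻ u in
    trans (exec-unwritten d b ud _ j) (exec-unwritten c b uc s j)
  exec-unwritten (if e c d)  b u s j =
    let uc , ud = ∧-true⁻ u in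
    branch-elim (λ s′ → s′ b j ≡ s b j) (⟦ e ⟧ s) (exec c s) (exec d s)
      (exec-unwritten c b uc s j) (exec-unwritten d b ud s j)
  exec-unwritten (for i c)   b u s j =
    let ui , uc = ∧-true⁻ u in
    iter-preserves (λ s′ → s′ b j ≡ s b j)
      (λ s′ p → trans (increment-other i (exec c s′) b j (not-true⁻ ui))
                      (trans (exec-unwritten c b uc s′ j) p))
      n _ (write-other s i 0 0 b j (not-true⁻ ui))
  exec-unwritten (count c i e) b u s j =
    let uc , ui = ∧-true⁻ u in
    iter-preserves (λ s′ → s′ b j ≡ s b j)
      (λ s′ p → trans (increment-other i (countStep c e s′) b j (not-true⁻ ui))
                      (countStep-elim (λ s″ → s″ b j ≡ s b j) c e s′
                        p (trans (increment-other c s′ b j (not-true⁻ uc)) p)))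
      n _ (trans (write-other (write s c 0 0) i 0 0 b j (not-true⁻ ui))
        (write-other s c 0 0 b j (not-true⁻ uc)))

-- Correctness of compilation

module Compile (n w : ℕ) (wide : (2 + n) ^ (1 + maxDegree) ≤ 2 ^ w) where
  open Semantics n
  open Frames n

  -- Every cell stays at most n + 2, since the largest constant is 2 and the largest index is n.
  -- Being at least 2, `B` also absorbs a sum into one more factor, as `degree` presupposes.
  B : ℕ
  B = 2 + n

  Bounded : Memory → Set
  Bounded s = ∀ a i → s a i ≤ B

  B^-mono : ∀ {k l} → k ≤ l → B ^ k ≤ B ^ l
  B^-mono = ^-monoʳ-≤ B

  1≤B^ : ∀ k → 1 ≤ B ^ k
  1≤B^ k = B^-mono {0} {k} z≤n

  suc≤B^ : ∀ x → suc x ≤ B ^ x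
  suc≤B^ zero    = s≤s z≤n
  suc≤B^ (suc x) = begin
    suc (suc x)             ≤⟨ +-mono-≤ (1≤B^ x) (suc≤B^ x) ⟩
    B ^ x + B ^ x           ≡⟨ cong (B ^ x +_) (+-identityʳ _) ⟨
    2 * B ^ x               ≤⟨ *-monoˡ-≤ (B ^ x) {2} {B} (s≤s (s≤s z≤n)) ⟩
    B ^ suc x               ∎
    where open ≤-Reasoning

  bit≤ : ∀ x → bit x ≤ 1
  bit≤ true  = s≤s z≤n
  bit≤ false = z≤n

  value≤ : ∀ e {s} → Bounded s → ⟦ e ⟧ s ≤ B ^ degree e
  value≤ (lit zero)    bs = z≤n
  value≤ (lit (suc x)) bs = suc≤B^ x
  value≤ (read a e) {s} bs = ≤-trans (bs a _) (≤-reflexive (sym (*-identityʳ B)))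
  value≤ (bin plus e f) {s} bs = begin
    ⟦ e ⟧ s + ⟦ f ⟧ s             ≤⟨ +-mono-≤ (value≤ e bs) (value≤ f bs) ⟩
    B ^ degree e + B ^ degree f   ≤⟨ +-mono-≤ (B^-mono (m≤m⊔n (degree e) _))
                                              (B^-mono (m≤n⊔m (degree e) _)) ⟩
    B ^ d + B ^ d                 ≡⟨ cong (B ^ d +_) (+-identityʳ _) ⟨
    2 * B ^ d                     ≤⟨ *-monoˡ-≤ (B ^ d) {2} {B} (s≤s (s≤s z≤n)) ⟩
    B * B ^ d                     ∎
    where
    open ≤-Reasoning
    d = degree e ⊔ degree f
  value≤ (bin monus e f) {s} bs = ≤-trans (m∸n≤m (⟦ e ⟧ s) (⟦ f ⟧ s)) (value≤ e bs)
  value≤ (bin times e f) {s} bs = ≤-trans (*-mono-≤ (value≤ e bs) (value≤ f bs))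
    (≤-reflexive (sym (^-distribˡ-+-* B (degree e) (degree f))))
  value≤ (bin less e f) bs = bit≤ _
  value≤ (bin equal e f) bs = bit≤ _

  wrap-small : ∀ {x} → x ≤ B ^ maxDegree → wrap w x ≡ x
  wrap-small {x} p = m<n⇒m%n≡m {{m^n≢0 2 w}} (begin-strict
    x                        ≤⟨ p ⟩
    B ^ maxDegree            <⟨ ^-monoʳ-< B (s≤s (s≤s z≤n)) (n<1+n maxDegree) ⟩
    B ^ (1 + maxDegree)      ≤⟨ wide ⟩
    2 ^ w                    ∎)
    where open ≤-Reasoning

  -- The word size leaves room for every intermediate value, so reduction modulo 2 ^ w never takes
  -- effect and commands can be analysed over the natural numbers.
  eval-unwrapped : ∀ e {s} → fits e ≡ true → Bounded s → eval w s e ≡ ⟦ e ⟧ s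
  eval-unwrapped (lit x) ok bs = wrap-small (≤-trans (≤ᵇ-true⁻ x 2 ok) (begin
    2             ≤⟨ s≤s (s≤s z≤n) ⟩
    B             ≡⟨ *-identityʳ B ⟨
    B ^ 1         ≤⟨ B^-mono {1} {maxDegree} (s≤s z≤n) ⟩
    B ^ maxDegree ∎))
    where open ≤-Reasoning
  eval-unwrapped (read a e) {s} ok bs = cong (s a) (eval-unwrapped e ok bs)
  eval-unwrapped (bin o e f) {s} ok bs =
    let efs , dg = ∧-true⁻ ok; oe , of = ∧-true⁻ efs in
    trans (cong₂ (λ x y → wrap w (evalOp o x y)) (eval-unwrapped e oe bs) (eval-unwrapped f of bs))
      (wrap-small (≤-trans (value≤ (bin o e f) bs) (B^-mono (≤ᵇ-true⁻ (degree (bin o e f)) _ dg))))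

  Bounded-write : ∀ {s} a i {x} → Bounded s → x ≤ B → Bounded (write s a i x)
  Bounded-write a i bs x≤ b j with (b ≡ᵇ a) ∧ (j ≡ᵇ i)
  ... | true  = x≤
  ... | false = bs b j

  Valid : Memory → Set
  Valid s = Bounded s × s 0 0 ≡ n

  valid-write : ∀ {s} a i {x} → (0 ≡ᵇ a) ≡ false → Valid s → x ≤ B → Valid (write s a i x)
  valid-write {s} a i 0≢a (bs , sn) x≤ =
    Bounded-write a i bs x≤ , trans (write-other s a i _ 0 0 0≢a) sn

  assign⇓ : ∀ a e f {s} → fits e ≡ true → fits f ≡ true → Bounded s →
            w ⊢ assign a e f , s ⇓ write s a (⟦ e ⟧ s) (⟦ f ⟧ s) [ 1 + cost e + cost f ]
  assign⇓ a e f {s} oe of bs =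
    subst₂ (λ x y → w ⊢ assign a e f , s ⇓ write s a x y [ 1 + cost e + cost f ])
      (eval-unwrapped e oe bs) (eval-unwrapped f of bs) ⇓assign

  ifz⇓ : ∀ e {s P Q s₁ s₂ t₁ t₂} → fits e ≡ true → Bounded s →
         w ⊢ P , s ⇓ s₁ [ t₁ ] → w ⊢ Q , s ⇓ s₂ [ t₂ ] →
         w ⊢ ifz e P Q , s ⇓ branch (⟦ e ⟧ s) s₁ s₂ [ 1 + cost e + branch (⟦ e ⟧ s) t₁ t₂ ]
  ifz⇓ e {s} oe bs p q with ⟦ e ⟧ s in eq
  ... | zero  = ⇓ifz-0 (trans (eval-unwrapped e oe bs) eq) p
  ... | suc m = ⇓ifz-≢0 (λ z → 1+n≢0 (trans (sym eq) (trans (sym (eval-unwrapped e oe bs)) z))) q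

  module _ (i : ℕ) (0≢i : (0 ≡ᵇ i) ≡ false) {P : Program} {f : Memory → Memory} {t : Memory → ℕ}
           (J : ℕ → Memory → Set) (J⇒valid : ∀ {k s} → J k s → Valid s)
           (body : ∀ {k s} → k < n → J k s → s i 0 ≡ k →
                   w ⊢ P , s ⇓ f s [ t s ] × Valid (f s) × f s i 0 ≡ k × J (suc k) (increment i (f s)))
           where

    private
      test : Expr
      test = bin less (var i) (var 0)

    -- Shared by `for` and `count`. The invariant `J` is a parameter because `count` needs more than
    -- `Valid`: its counter must stay below the number of completed rounds.
    while⇓ : ∀ r {k s} → k + r ≡ n → J k s → s i 0 ≡ k →
             w ⊢ while test (P ⨾ incr i) , s ⇓ iter (increment i ∘ f) r s
               [ iterTime (increment i ∘ f) t r s ] × J n (iter (increment i ∘ f) r s)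
    while⇓ zero {k} {s} k≡n j si rewrite +-identityʳ k | k≡n =
      ⇓while-0 (trans (eval-unwrapped test refl (proj₁ (J⇒valid j)))
        (trans (cong₂ (λ x y → bit (x <ᵇ y)) si (proj₂ (J⇒valid j))) (cong bit (<ᵇ-irrefl n)))) , j
    while⇓ (suc r) {k} {s} k+r j si =
      let k<n = ≤-trans (s≤s (m≤m+n k r)) (≤-reflexive (trans (sym (+-suc k r)) k+r))
          run , vf , fi , j′ = body k<n j si
          rest , jn = while⇓ r (trans (sym (+-suc k r)) k+r) j′
                        (increment-here i (f s) fi)
      in ⇓while-≢0
           (λ z → 1+n≢0 (trans (sym (trans (eval-unwrapped test refl (proj₁ (J⇒valid j)))
             (trans (cong₂ (λ x y → bit (x <ᵇ y)) si (proj₂ (J⇒valid j)))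
               (cong bit (<ᵇ-true⁺ k<n))))) z))
           (⇓seq run (assign⇓ i (lit 0) (bin plus (var i) (lit 1)) refl refl (proj₁ vf)))
           rest , jn

    loop⇓ : ∀ {s} → Valid s → J 0 (write s i 0 0) →
            w ⊢ loop i P , s ⇓ iter (increment i ∘ f) n (write s i 0 0)
              [ 3 + iterTime (increment i ∘ f) t n (write s i 0 0) ]
            × J n (iter (increment i ∘ f) n (write s i 0 0))
    loop⇓ {s} vs j =
      let run , jn = while⇓ n refl j (write-here s i 0 0) in
      ⇓seq (assign⇓ i (lit 0) (lit 0) refl refl (proj₁ vs)) run , jn

  suc-increment : ∀ (s : Memory) i {k} → s i 0 ≡ k → s i 0 + 1 ≡ suc k
  suc-increment s i e = trans (+-comm (s i 0) 1) (cong suc e)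

  suc≤B : ∀ {k} → k < n → suc k ≤ B
  suc≤B k<n = ≤-trans k<n (m≤n+m n 2)

  compile⇓ : ∀ c → wellFormed c ≡ true → ∀ {s} → Valid s →
             w ⊢ compile c , s ⇓ exec c s [ time c s ] × Valid (exec c s)
  compile⇓ nop ok vs = ⇓skip , vs
  compile⇓ (set a e f) ok vs =
    let 0≢a , o = ∧-true⁻ ok; efs , df = ∧-true⁻ o; oe , of = ∧-true⁻ efs in
    assign⇓ a e f oe of (proj₁ vs) ,
    valid-write a _ (not-true⁻ 0≢a) vs (≤-trans (value≤ f (proj₁ vs))
      (≤-trans (B^-mono (≤ᵇ-true⁻ (degree f) 1 df)) (≤-reflexive (*-identityʳ B))))
  compile⇓ (c ▸ d) ok vs =
    let oc , od = ∧-true⁻ ok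
        p , vp = compile⇓ c oc vs
        q , vq = compile⇓ d od vp
    in ⇓seq p q , vq
  compile⇓ (if e c d) ok {s} vs =
    let oe , ocd = ∧-true⁻ ok; oc , od = ∧-true⁻ ocd
        p , vp = compile⇓ c oc vs
        q , vq = compile⇓ d od vs
    in ifz⇓ e oe (proj₁ vs) p q , branch-elim Valid (⟦ e ⟧ s) (exec c s) (exec d s) vp vq
  compile⇓ (for i c) ok {s} vs =
    let 0≢i , o = ∧-true⁻ ok; ui , oc = ∧-true⁻ o
        0≢i′ = not-true⁻ 0≢i
    in loop⇓ i 0≢i′ (λ k s → Valid s) (λ v → v)
         (λ {k} {s} k<n v si →
           let p , vp = compile⇓ c oc v
               fi = trans (exec-unwritten c i ui s 0) si
           in p , vp , fi ,
              valid-write i 0 0≢i′ vp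
                (≤-trans (≤-reflexive (suc-increment (exec c s) i fi)) (suc≤B k<n)))
         vs (valid-write i 0 0≢i′ vs z≤n)
  compile⇓ (count c i e) ok {s} vs =
    let o₁ , o₂ = ∧-true⁻ ok; 0≢c , 0≢i = ∧-true⁻ o₁; o₃ , oe = ∧-true⁻ o₂; i≢c , c≢i = ∧-true⁻ o₃
        0≢c′ = not-true⁻ 0≢c; 0≢i′ = not-true⁻ 0≢i
        v₀ = valid-write c 0 0≢c′ vs z≤n
        init = ≤-reflexive (trans (write-other (write s c 0 0) i 0 0 c 0 (not-true⁻ c≢i))
          (write-here s c 0 0))
        run , v , _ = loop⇓ i 0≢i′ (λ k s → Valid s × s c 0 ≤ k) proj₁
          (λ {k} {s} k<n (v , ck) si →
            let v₁ = valid-write c 0 0≢c′ v (≤-trans (≤-reflexive (+-comm (s c 0) 1))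
                       (≤-trans (s≤s ck) (suc≤B k<n)))
                vb = countStep-elim Valid c e s v v₁
                fi = countStep-elim (λ s′ → s′ i 0 ≡ k) c e s si
                       (trans (increment-other c s i 0 (not-true⁻ i≢c)) si)
                cb = countStep-elim (λ s′ → s′ c 0 ≤ suc k) c e s (m≤n⇒m≤1+n ck)
                       (≤-trans (≤-reflexive (increment-here c s refl)) (s≤s ck))
            in ifz⇓ e oe (proj₁ v) ⇓skip
                 (assign⇓ c (lit 0) (bin plus (var c) (lit 1)) refl refl (proj₁ v)) ,
               vb , fi ,
               valid-write i 0 0≢i′ vb
                 (≤-trans (≤-reflexive (suc-increment (countStep c e s) i fi)) (suc≤B k<n)) ,
               ≤-trans (≤-reflexive (increment-other i (countStep c e s) c 0 (not-true⁻ c≢i))) cb)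
          v₀ (valid-write i 0 0≢i′ v₀ z≤n , init)
    in ⇓seq (assign⇓ c (lit 0) (lit 0) refl refl (proj₁ vs)) run , v

-- Polynomial time bounds

loopDepth : Cmd → ℕ
loopDepth nop           = 0
loopDepth (set a e f)   = 0
loopDepth (c ▸ d)       = loopDepth c ⊔ loopDepth d
loopDepth (if e c d)    = loopDepth c ⊔ loopDepth d
loopDepth (for i c)     = suc (loopDepth c)
loopDepth (count c i e) = 1

-- The coefficient in the bound `size c * N ^ loopDepth c`. For its bookkeeping a `for` loop is
-- charged 9 once (initialisation and last test) and 12 per round (test and increment).
size : Cmd → ℕ
size nop           = 1
size (set a e f)   = 1 + cost e + cost f
size (c ▸ d)       = size c + size d
size (if e c d)    = 1 + cost e + (size c + size d)
size (for i c)     = 9 + (size c + 12)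
size (count c i e) = 12 + ((1 + cost e + 6) + 12)

module TimeBound (n : ℕ) where
  open Semantics n

  -- n + 1 instead of n, so that all powers are at least 1 and absorb constants even when n = 0.
  N : ℕ
  N = suc n

  1≤N^ : ∀ d → 1 ≤ N ^ d
  1≤N^ d = ^-monoʳ-≤ N {0} {d} z≤n

  ≤*N^ : ∀ x d → x ≤ x * N ^ d
  ≤*N^ x d = ≤-trans (≤-reflexive (sym (*-identityʳ x))) (*-monoʳ-≤ x (1≤N^ d))

  N^-mono : ∀ x {d e} → d ≤ e → x * N ^ d ≤ x * N ^ e
  N^-mono x p = *-monoʳ-≤ x (^-monoʳ-≤ N p)

  iterTime≤ : ∀ {f t} b → (∀ s → t s ≤ b) → ∀ r s → iterTime f t r s ≤ 6 + r * (b + 12)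
  iterTime≤ b h zero    s = ≤-refl
  iterTime≤ {f} {t} b h (suc r) s = begin
    6 + (t s + 6) + iterTime f t r (f s)   ≤⟨ +-mono-≤ (+-monoʳ-≤ 6 (+-monoˡ-≤ 6 (h s)))
                                                       (iterTime≤ b h r (f s)) ⟩
    6 + (b + 6) + (6 + r * (b + 12))       ≡⟨ cong (_+ (6 + r * (b + 12))) lemma ⟩
    (b + 12) + (6 + r * (b + 12))          ≡⟨ x+[y+z]≡y+[x+z] (b + 12) 6 _ ⟩
    6 + ((b + 12) + r * (b + 12))          ∎
    where
    open ≤-Reasoning
    lemma : 6 + (b + 6) ≡ b + 12
    lemma = trans (+-comm 6 (b + 6)) (+-assoc b 6 6)
    x+[y+z]≡y+[x+z] : ∀ x y z → x + (y + z) ≡ y + (x + z)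
    x+[y+z]≡y+[x+z] x y z = trans (sym (+-assoc x y z))
      (trans (cong (_+ z) (+-comm x y)) (+-assoc y x z))

  loopTime≤ : ∀ x b d → b ≤ x * N ^ d → ∀ k → k + n * (b + 12) ≤ (k + (x + 12)) * N ^ suc d
  loopTime≤ x b d b≤ k = begin
    k + n * (b + 12)                      ≤⟨ +-mono-≤ (≤*N^ k (suc d)) (*-mono-≤ (n≤1+n n)
                                               (+-mono-≤ b≤ (≤*N^ 12 d))) ⟩
    k * N ^ suc d + N * (x * N ^ d + 12 * N ^ d)
      ≡⟨ cong (λ z → k * N ^ suc d + N * z) (*-distribʳ-+ (N ^ d) x 12) ⟨
    k * N ^ suc d + N * ((x + 12) * N ^ d)
      ≡⟨ cong (k * N ^ suc d +_) (x*[y*z]≡y*[x*z] N (x + 12) (N ^ d)) ⟩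
    k * N ^ suc d + (x + 12) * N ^ suc d  ≡⟨ *-distribʳ-+ (N ^ suc d) k (x + 12) ⟨
    (k + (x + 12)) * N ^ suc d            ∎
    where
    open ≤-Reasoning
    x*[y*z]≡y*[x*z] : ∀ x y z → x * (y * z) ≡ y * (x * z)
    x*[y*z]≡y*[x*z] x y z = trans (sym (*-assoc x y z))
      (trans (cong (_* z) (*-comm x y)) (*-assoc y x z))

  time≤ : ∀ c s → time c s ≤ size c * N ^ loopDepth c
  time≤ nop         s = ≤-refl
  time≤ (set a e f) s = ≤-reflexive (sym (*-identityʳ (1 + cost e + cost f)))
  time≤ (c ▸ d)     s = ≤-trans
    (+-mono-≤ (≤-trans (time≤ c s) (N^-mono (size c) (m≤m⊔n (loopDepth c) (loopDepth d))))
              (≤-trans (time≤ d _) (N^-mono (size d) (m≤n⊔m (loopDepth c) (loopDepth d)))))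
    (≤-reflexive (sym (*-distribʳ-+ (N ^ (loopDepth c ⊔ loopDepth d)) (size c) (size d))))
  time≤ (if e c d)  s = ≤-trans
    (+-mono-≤ (≤*N^ (1 + cost e) D)
      (branch-elim (_≤ (size c + size d) * N ^ D) (⟦ e ⟧ s) (time c s) (time d s)
        (≤-trans (time≤ c s) (*-mono-≤ (m≤m+n (size c) _) (^-monoʳ-≤ N (m≤m⊔n (loopDepth c) _))))
        (≤-trans (time≤ d s)
          (*-mono-≤ (m≤n+m (size d) (size c)) (^-monoʳ-≤ N (m≤n⊔m (loopDepth c) _))))))
    (≤-reflexive (sym (*-distribʳ-+ (N ^ D) (1 + cost e) (size c + size d))))
    where D = loopDepth c ⊔ loopDepth d
  time≤ (for i c)   s =
    ≤-trans (+-monoʳ-≤ 3 (iterTime≤ _ (time≤ c) n _)) (loopTime≤ (size c) _ (loopDepth c) ≤-refl 9)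
  time≤ (count c i e) s =
    ≤-trans (+-monoʳ-≤ 6 (iterTime≤ (1 + cost e + 6)
              (λ s → +-monoʳ-≤ (1 + cost e) (branch-elim (_≤ 6) (⟦ e ⟧ s) 1 6 (s≤s z≤n) ≤-refl)) n _))
      (loopTime≤ (1 + cost e + 6) _ 0 (≤-reflexive (sym (*-identityʳ _))) 12)

-- Counting the vertices with a Boolean property

cnt : ∀ {n} → (Fin n → Bool) → ℕ
cnt {zero}  f = 0
cnt {suc n} f = bit (f zero) + cnt (f ∘ suc)

cnt-cong : ∀ {n} {f g : Fin n → Bool} → (∀ v → f v ≡ g v) → cnt f ≡ cnt g
cnt-cong {zero}  h = refl
cnt-cong {suc n} h = cong₂ _+_ (cong bit (h zero)) (cnt-cong (h ∘ suc))

bit-mono : ∀ {x y} → (x ≡ true → y ≡ true) → bit x ≤ bit y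
bit-mono {false} h = z≤n
bit-mono {true} {true} h = ≤-refl
bit-mono {true} {false} h with () ← h refl

cnt-mono : ∀ {n} {f g : Fin n → Bool} → (∀ v → f v ≡ true → g v ≡ true) → cnt f ≤ cnt g
cnt-mono {zero}  h = z≤n
cnt-mono {suc n} h = +-mono-≤ (bit-mono (h zero)) (cnt-mono (h ∘ suc))

cnt-mono-< : ∀ {n} {f g : Fin n → Bool} → (∀ v → f v ≡ true → g v ≡ true) →
             ∀ u → f u ≡ false → g u ≡ true → cnt f < cnt g
cnt-mono-< h zero fu gu rewrite fu | gu = s≤s (cnt-mono (h ∘ suc))
cnt-mono-< {f = f} {g} h (suc u) fu gu =
  ≤-trans (≤-reflexive (sym (+-suc (bit (f zero)) _)))
          (+-mono-≤ (bit-mono (h zero)) (cnt-mono-< (h ∘ suc) u fu gu))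

cnt≤ : ∀ {n} (f : Fin n → Bool) → cnt f ≤ n
cnt≤ {zero}  f = z≤n
cnt≤ {suc n} f with f zero
... | true  = s≤s (cnt≤ (f ∘ suc))
... | false = m≤n⇒m≤1+n (cnt≤ (f ∘ suc))

cnt-full : ∀ {n} {f : Fin n → Bool} → n ≤ cnt f → ∀ v → f v ≡ true
cnt-full {n} {f} p v with f v in eq
... | true  = refl
... | false = contradiction
  (≤-trans (cnt-mono-< {g = λ _ → true} (λ _ _ → refl) v eq refl) (cnt≤ (λ _ → true))) (≤⇒≯ p)

-- Boolean values of expressions

nz : ℕ → Bool
nz x = not (x ≡ᵇ 0)

nz-bit : ∀ b → nz (bit b) ≡ b
nz-bit true  = refl
nz-bit false = refl

nz-true⁻ : ∀ {x} → nz x ≡ true → x ≢ 0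
nz-true⁻ {suc x} _ ()

nz-true⁺ : ∀ {x} → x ≢ 0 → nz x ≡ true
nz-true⁺ {zero}  h = contradiction refl h
nz-true⁺ {suc x} h = refl

nz-false⁻ : ∀ {x} → nz x ≡ false → x ≡ 0
nz-false⁻ {zero} _ = refl

at : ℕ → Expr → Expr
at = read

andE orE xorE eqE ltE : Expr → Expr → Expr
andE = bin times
orE e f = bin less (lit 0) (bin plus e f)
eqE = bin equal
ltE = bin less

notE : Expr → Expr
notE e = bin equal e (lit 0)

xorE e f = notE (eqE e f)

-- A record rather than a bare equation: both sides of the equation compute, so `e` and `b` could
-- not be recovered from it by unification.
record Is (e : Expr) (s : Memory) (b : Bool) : Set where
  constructor is
  field value : ⟦ e ⟧ s ≡ bit b

module _ {s : Memory} where

  and-is : ∀ {e f x y} → Is e s x → Is f s y → Is (andE e f) s (x ∧ y)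
  and-is {x = true}  {true}  (is p) (is q) = is (cong₂ _*_ p q)
  and-is {x = true}  {false} (is p) (is q) = is (cong₂ _*_ p q)
  and-is {x = false} {y}     (is p) (is q) = is (cong₂ _*_ p q)

  or-is : ∀ {e f x y} → Is e s x → Is f s y → Is (orE e f) s (x ∨ y)
  or-is {x = true}          (is p) (is q) = is (cong₂ (λ a b → bit (0 <ᵇ (a + b))) p q)
  or-is {x = false} {true}  (is p) (is q) = is (cong₂ (λ a b → bit (0 <ᵇ (a + b))) p q)
  or-is {x = false} {false} (is p) (is q) = is (cong₂ (λ a b → bit (0 <ᵇ (a + b))) p q)

  not-is : ∀ {e x} → Is e s x → Is (notE e) s (not x)
  not-is {x = true}  (is p) = is (cong (λ a → bit (a ≡ᵇ 0)) p)
  not-is {x = false} (is p) = is (cong (λ a → bit (a ≡ᵇ 0)) p)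

  xor-is : ∀ {e f x y} → Is e s x → Is f s y → Is (xorE e f) s (x xor y)
  xor-is {x = true}  {true}  (is p) (is q) = is (cong₂ (λ a b → bit (bit (a ≡ᵇ b) ≡ᵇ 0)) p q)
  xor-is {x = true}  {false} (is p) (is q) = is (cong₂ (λ a b → bit (bit (a ≡ᵇ b) ≡ᵇ 0)) p q)
  xor-is {x = false} {true}  (is p) (is q) = is (cong₂ (λ a b → bit (bit (a ≡ᵇ b) ≡ᵇ 0)) p q)
  xor-is {x = false} {false} (is p) (is q) = is (cong₂ (λ a b → bit (bit (a ≡ᵇ b) ≡ᵇ 0)) p q)

  eq-is : ∀ {e f x y} → ⟦ e ⟧ s ≡ x → ⟦ f ⟧ s ≡ y → Is (eqE e f) s (x ≡ᵇ y)
  eq-is p q = is (cong₂ (λ a b → bit (a ≡ᵇ b)) p q)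

  lt-is : ∀ {e f x y} → ⟦ e ⟧ s ≡ x → ⟦ f ⟧ s ≡ y → Is (ltE e f) s (x <ᵇ y)
  lt-is p q = is (cong₂ (λ a b → bit (a <ᵇ b)) p q)

is-nz : ∀ {e s b} → Is e s b → nz (⟦ e ⟧ s) ≡ b
is-nz {b = b} (is p) = trans (cong nz p) (nz-bit b)

write-at : ∀ s a (i : ℕ) x j → j ≡ i → write s a i x a j ≡ x
write-at s a i x .i refl = write-here s a i x

write-off : ∀ s a (i : ℕ) x j → j ≢ i → write s a i x a j ≡ s a j
write-off s a i x j j≢i rewrite ≡ᵇ-refl a | ≢⇒≡ᵇ-false j i j≢i = refl

below-suc : ∀ {n} (k u : Fin n) → toℕ u < suc (toℕ k) → toℕ u < toℕ k ⊎ u ≡ k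
below-suc k u (s≤s p) with m≤n⇒m<n∨m≡n p
... | inj₁ q = inj₁ q
... | inj₂ q = inj₂ (toℕ-injective q)

toℕ-≢ : ∀ {n} {u v : Fin n} → u ≢ v → toℕ u ≢ toℕ v
toℕ-≢ h e = h (toℕ-injective e)

-- Invariants and amortised time of loops

Frame : Cmd → Memory → Memory → Set
Frame c s s′ = ∀ b → unwritten b c ≡ true → ∀ j → s′ b j ≡ s b j

loopSum : (ℕ → ℕ) → ℕ → ℕ → ℕ
loopSum b k zero    = 0
loopSum b k (suc r) = (b k + 12) + loopSum b (suc k) r

module Rules (n : ℕ) where
  open Semantics n public
  open Frames n public

  exec-frame : ∀ c s → Frame c s (exec c s)
  exec-frame c s b u j = exec-unwritten c b u s j

  if-elim : ∀ e c d s (P : Memory → Set) →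
            (nz (⟦ e ⟧ s) ≡ false → P (exec c s)) → (nz (⟦ e ⟧ s) ≡ true → P (exec d s)) →
            P (exec (if e c d) s)
  if-elim e c d s P p q with ⟦ e ⟧ s
  ... | zero  = p refl
  ... | suc _ = q refl

  record Step (i : ℕ) (c : Cmd) (s₀ : Memory) (I : ℕ → Memory → Set) (k : Fin n) (s : Memory) : Set where
    field
      index : s i 0 ≡ toℕ k
      frame : Frame (for i c) s₀ s
      inv   : I (toℕ k) s

  private
    module Loop (i : ℕ) (c : Cmd) (i∉c : unwritten i c ≡ true) (s₀ : Memory)
                (I : ℕ → Memory → Set)
                (step : ∀ k s → Step i c s₀ I k s → I (suc (toℕ k))
                  (write (exec c s) i 0 (suc (toℕ k))))
                where

      body : Memory → Memory
      body = increment i ∘ exec c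

      body-frame : ∀ s → Frame (for i c) s₀ s → Frame (for i c) s₀ (body s)
      body-frame s fr b u j =
        let ui , uc = ∧-true⁻ u in
        trans (increment-other i (exec c s) b j (not-true⁻ ui))
              (trans (exec-unwritten c b uc s j) (fr b u j))

      body-inv : ∀ k s → Step i c s₀ I k s → I (suc (toℕ k)) (body s)
      body-inv k s st = subst (λ x → I (suc (toℕ k)) (write (exec c s) i 0 x))
        (sym (trans (+-comm (exec c s i 0) 1)
               (cong suc (trans (exec-unwritten c i i∉c s 0) (Step.index st)))))
        (step k s st)

      start-frame : Frame (for i c) s₀ (write s₀ i 0 0)
      start-frame b u j = write-other s₀ i 0 0 b j (not-true⁻ (proj₁ (∧-true⁻ u)))

      body-index : ∀ {k} s → s i 0 ≡ k → body s i 0 ≡ suc k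
      body-index s si = increment-here i (exec c s) (trans (exec-unwritten c i i∉c s 0) si)

      module _ {k r} (k+r : k + suc r ≡ n) where
        now : k < n
        now = ≤-trans (s≤s (m≤m+n k r)) (≤-reflexive (trans (sym (+-suc k r)) k+r))

        here : Fin n
        here = fromℕ< now

        at-here : ∀ {s} → s i 0 ≡ k → Frame (for i c) s₀ s → I k s → Step i c s₀ I here s
        at-here si fr inv = record
          { index = trans si (sym (toℕ-fromℕ< now)) ; frame = fr
          ; inv = subst (λ m → I m _) (sym (toℕ-fromℕ< now)) inv }

        next : ∀ {s} → Step i c s₀ I here s → I (suc k) (body s)
        next {s} st = subst (λ m → I (suc m) (body s)) (toℕ-fromℕ< now) (body-inv here s st)

      run : ∀ r k s → k + r ≡ n → s i 0 ≡ k → Frame (for i c) s₀ s → I k s → I n (iter body r s)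
      run zero    k s k+r si fr inv = subst (λ m → I m s) (trans (sym (+-identityʳ k)) k+r) inv
      run (suc r) k s k+r si fr inv =
        run r (suc k) (body s) (trans (sym (+-suc k r)) k+r) (body-index s si) (body-frame s fr)
            (next k+r (at-here k+r si fr inv))

      module _ (Φ : Memory → ℕ) (b : ℕ → ℕ)
               (paid : ∀ k s → Step i c s₀ I k s → time c s + Φ (body s) ≤ Φ s + b (toℕ k)) where

        run-time : ∀ r k s → k + r ≡ n → s i 0 ≡ k → Frame (for i c) s₀ s → I k s →
                   iterTime body (time c) r s + Φ (iter body r s) ≤ 6 + (Φ s + loopSum b k r)
        run-time zero    k s k+r si fr inv = ≤-reflexive (cong (6 +_) (sym (+-identityʳ (Φ s))))
        run-time (suc r) k s k+r si fr inv = begin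
          6 + (t + 6) + R + Φ (iter body r (body s)) ≡⟨ +-assoc (6 + (t + 6)) R _ ⟩
          6 + (t + 6) + (R + Φ (iter body r (body s)))
            ≤⟨ +-monoʳ-≤ (6 + (t + 6)) (run-time r (suc k) (body s) (trans (sym (+-suc k r)) k+r)
                 (body-index s si) (body-frame s fr) (next k+r st)) ⟩
          6 + (t + 6) + (6 + (Φ (body s) + S))       ≡⟨ shuffle t (Φ (body s)) S ⟩
          6 + ((t + Φ (body s)) + (12 + S))          ≤⟨ +-monoʳ-≤ 6 (+-monoˡ-≤ (12 + S)
                                                          (subst (λ m → t + Φ (body s) ≤ Φ s + b m)
                                                            (toℕ-fromℕ< (now k+r)) (paid _ s st))) ⟩
          6 + ((Φ s + b k) + (12 + S))               ≡⟨ cong (6 +_)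
            (trans (+-assoc (Φ s) (b k) (12 + S))
                                                          (cong (Φ s +_) (sym (+-assoc (b k) 12 S)))) ⟩
          6 + (Φ s + ((b k + 12) + S))               ∎
          where
          open ≤-Reasoning
          st = at-here k+r si fr inv
          t = time c s
          R = iterTime body (time c) r (body s)
          S = loopSum b (suc k) r
          shuffle : ∀ t p q → 6 + (t + 6) + (6 + (p + q)) ≡ 6 + ((t + p) + (12 + q))
          shuffle t p q = cong (6 +_) (begin-equality
            (t + 6) + (6 + (p + q))  ≡⟨ +-assoc t 6 _ ⟩
            t + (12 + (p + q))       ≡⟨ cong (t +_) (+-comm 12 (p + q)) ⟩
            t + ((p + q) + 12)       ≡⟨ cong (t +_) (+-assoc p q 12) ⟩
            t + (p + (q + 12))       ≡⟨ +-assoc t p _ ⟨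
            (t + p) + (q + 12)       ≡⟨ cong ((t + p) +_) (+-comm q 12) ⟩
            (t + p) + (12 + q)       ∎)

  for-ind : ∀ i c (I : ℕ → Memory → Set) s₀ → unwritten i c ≡ true → I 0 (write s₀ i 0 0) →
            (∀ k s → Step i c s₀ I k s → I (suc (toℕ k)) (write (exec c s) i 0 (suc (toℕ k)))) →
            I n (exec (for i c) s₀)
  for-ind i c I s₀ i∉c init step = run n 0 _ refl (write-here s₀ i 0 0) start-frame init
    where open Loop i c i∉c s₀ I step

  -- The changes of the potential telescope over the rounds, so that only the budgets `b k` and the
  -- loop overhead remain. `Φ` must ignore the index cell, which the loop itself writes.
  for-time : ∀ i c (I : ℕ → Memory → Set) s₀ → unwritten i c ≡ true → I 0 (write s₀ i 0 0) →
             (∀ k s → Step i c s₀ I k s → I (suc (toℕ k)) (write (exec c s) i 0 (suc (toℕ k)))) →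
             (Φ : Memory → ℕ) (b : ℕ → ℕ) → (∀ s x → Φ (write s i 0 x) ≡ Φ s) →
             (∀ k s → Step i c s₀ I k s → time c s + Φ (exec c s) ≤ Φ s + b (toℕ k)) →
             time (for i c) s₀ + Φ (exec (for i c) s₀) ≤ Φ s₀ + (9 + loopSum b 0 n)
  for-time i c I s₀ i∉c init step Φ b Φ-index paid = begin
    3 + iterTime body (time c) n s₁ + Φ (iter body n s₁)
      ≤⟨ +-monoʳ-≤ 3 (run-time Φ b
        (λ k s st → ≤-trans (≤-reflexive (cong (time c s +_) (Φ-index _ _))) (paid k s st))
           n 0 s₁ refl (write-here s₀ i 0 0) start-frame init) ⟩
    9 + (Φ s₁ + loopSum b 0 n)      ≡⟨ cong (λ x → 9 + (x + loopSum b 0 n)) (Φ-index s₀ 0) ⟩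
    9 + (Φ s₀ + loopSum b 0 n)     ≡⟨ +-assoc 9 (Φ s₀) _ ⟨
    (9 + Φ s₀) + loopSum b 0 n     ≡⟨ cong (_+ loopSum b 0 n) (+-comm 9 (Φ s₀)) ⟩
    (Φ s₀ + 9) + loopSum b 0 n     ≡⟨ +-assoc (Φ s₀) 9 _ ⟩
    Φ s₀ + (9 + loopSum b 0 n)     ∎
    where
    open ≤-Reasoning
    open Loop i c i∉c s₀ I step
    s₁ = write s₀ i 0 0

  private
    module Count (c i : ℕ) (e : Expr) (i≢c : (i ≡ᵇ c) ≡ false) (c≢i : (c ≡ᵇ i) ≡ false)
                 (c∉e : unread c e ≡ true) (s₀ : Memory) where

      g : ℕ → Bool
      g k = nz (⟦ e ⟧ (write s₀ i 0 k))

      Same : Memory → Set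
      Same s = ∀ b → (b ≡ᵇ c) ≡ false → (b ≡ᵇ i) ≡ false → ∀ j → s b j ≡ s₀ b j

      value-same : ∀ s k → Same s → s i 0 ≡ k → (∀ j → j ≢ 0 → s i j ≡ s₀ i j) →
                   ⟦ e ⟧ s ≡ ⟦ e ⟧ (write s₀ i 0 k)
      value-same s k h si so = ⟦⟧-cong e agree
        where
        agree : ∀ b → unread b e ≡ false → ∀ j → s b j ≡ write s₀ i 0 k b j
        agree b u j with b ≡ᵇ c in bc
        ... | true  = contradiction
          (trans (sym u) (trans (cong (λ z → unread z e) (≡ᵇ-true⁻ b c bc)) c∉e)) λ ()
        ... | false with b ≡ᵇ i in bi
        ...   | false = h b bc bi j
        ...   | true  = trans (cong (λ z → s z j) (≡ᵇ-true⁻ b i bi)) (at-index j)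
          where
          at-index : ∀ j → s i j ≡ (if true ∧ (j ≡ᵇ 0) then k else s₀ b j)
          at-index zero    = si
          at-index (suc m) = trans (so (suc m) (λ ()))
            (cong (λ z → s₀ z (suc m)) (sym (≡ᵇ-true⁻ b i bi)))

      body : Memory → Memory
      body = increment i ∘ countStep c e

      total : ℕ → ℕ → ℕ
      total k zero    = 0
      total k (suc r) = bit (g k) + total (suc k) r

      body-c : ∀ s → body s c 0 ≡ bit (nz (⟦ e ⟧ s)) + s c 0
      body-c s with ⟦ e ⟧ s
      ... | zero  = increment-other i s c 0 c≢i
      ... | suc _ = trans (increment-other i (increment c s) c 0 c≢i) (increment-here c s refl)

      run : ∀ r k s → Same s → s i 0 ≡ k → (∀ j → j ≢ 0 → s i j ≡ s₀ i j) →
            iter body r s c 0 ≡ s c 0 + total k r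
      run zero    k s h si so = sym (+-identityʳ _)
      run (suc r) k s h si so = begin
        iter body r (body s) c 0            ≡⟨ run r (suc k) (body s) h′ si′ so′ ⟩
        body s c 0 + total (suc k) r        ≡⟨ cong (_+ total (suc k) r) (body-c s) ⟩
        bit (nz (⟦ e ⟧ s)) + s c 0 + total (suc k) r
          ≡⟨ cong (λ x → bit (nz x) + s c 0 + total (suc k) r) (value-same s k h si so) ⟩
        bit (g k) + s c 0 + total (suc k) r ≡⟨ cong (_+ total (suc k) r) (+-comm (bit (g k)) _) ⟩
        s c 0 + bit (g k) + total (suc k) r ≡⟨ +-assoc (s c 0) _ _ ⟩
        s c 0 + total k (suc r)             ∎
        where
        open ≡-Reasoning
        h′ : Same (body s)
        h′ b bc bi j = trans (increment-other i (countStep c e s) b j bi)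
          (countStep-elim (λ s′ → s′ b j ≡ s₀ b j) c e s (h b bc bi j)
            (trans (increment-other c s b j bc) (h b bc bi j)))
        i-kept : ∀ j {x} → s i j ≡ x → countStep c e s i j ≡ x
        i-kept j p = countStep-elim (λ s′ → s′ i j ≡ _) c e s p (trans (increment-other c s i j i≢c) p)
        si′ : body s i 0 ≡ suc k
        si′ = increment-here i (countStep c e s) (i-kept 0 si)
        so′ : ∀ j → j ≢ 0 → body s i j ≡ s₀ i j
        so′ j j≢0 = trans (write-off (countStep c e s) i 0 _ j j≢0) (i-kept j (so j j≢0))

      total-cnt : ∀ k r → total k r ≡ cnt {r} (λ v → g (k + toℕ v))
      total-cnt k zero    = refl
      total-cnt k (suc r) = cong₂ _+_ (cong (bit ∘ g) (sym (+-identityʳ k)))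
        (trans (total-cnt (suc k) r) (cnt-cong {r} (λ v → cong g (sym (+-suc k (toℕ v))))))

  -- The expression may read the index but not the counter, so in round v it has the value that it
  -- has in the initial memory with only the index changed.
  count-value : ∀ c i e s → (i ≡ᵇ c) ≡ false → (c ≡ᵇ i) ≡ false → unread c e ≡ true →
                {g : Fin n → Bool} → (∀ v → nz (⟦ e ⟧ (write s i 0 (toℕ v))) ≡ g v) →
                exec (count c i e) s c 0 ≡ cnt g
  count-value c i e s i≢c c≢i c∉e {g} h =
    trans (run n 0 (write (write s c 0 0) i 0 0)
             (λ b bc bi j → trans (write-other (write s c 0 0) i 0 0 b j bi)
               (write-other s c 0 0 b j bc))
             (write-here (write s c 0 0) i 0 0)
             (λ j j≢0 → trans (write-off (write s c 0 0) i 0 0 j j≢0) (write-other s c 0 0 i j i≢c)))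
      (cong₂ _+_ (trans (write-other (write s c 0 0) i 0 0 c 0 c≢i) (write-here s c 0 0))
                 (trans (total-cnt 0 n) (cnt-cong h)))
    where open Count c i e i≢c c≢i c∉e s

-- Worklist propagation

-- Array 14 holds vertex labels, 0 meaning unlabelled; array 4 marks the
-- processed vertices, and array 6 records by whom a vertex was labelled.

-- The default n, which is no vertex, signals failure. The loop does not stop at a hit, so the last
-- vertex satisfying `e` is returned.
find : Expr → Cmd
find e = set 5 (lit 0) (var 0) ▸ for 7 (if e nop (set 5 (lit 0) (var 7)))

pending : Expr
pending = andE (eqE (at 4 (var 7)) (lit 0)) (ltE (lit 0) (at 14 (var 7)))

visitBody : Expr → Cmd
visitBody arc = if (andE (eqE (at 14 (var 8)) (lit 0)) arc) nop
                   (set 14 (var 8) (at 14 (var 5)) ▸ set 6 (var 8) (var 5))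

visit : Expr → Cmd
visit arc = set 4 (var 5) (lit 1) ▸ for 8 (visitBody arc)

workRound : Expr → Cmd
workRound arc = find pending ▸ if (ltE (var 5) (var 0)) nop (visit arc)

-- A round that finds a pending vertex processes one more vertex, so n rounds suffice. A round
-- spends O(n) steps on the selection and O(n) on the arcs of the selected vertex, hence O(n²) in
-- all.
worklist : Expr → Cmd
worklist arc = for 7 (set 4 (var 7) (lit 0)) ▸ for 9 (workRound arc)

module Worklist (n : ℕ) where
  open Rules n

  Found : (Fin n → Bool) → ℕ → Set
  Found g x = (x ≡ n × (∀ v → g v ≡ false)) ⊎ (∃ λ v → x ≡ toℕ v × g v ≡ true)

  find-spec : ∀ e s₀ → s₀ 0 0 ≡ n → (g : Fin n → Bool) →
              (∀ s v → Frame (find e) s₀ s → s 7 0 ≡ toℕ v → Is e s (g v)) →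
              Found g (exec (find e) s₀ 5 0)
  find-spec e s₀ sn g e-is = finish {exec (find e) s₀}
    (for-ind 7 (if e nop (set 5 (lit 0) (var 7))) I s₁ refl (inj₁ (sn , λ _ ())) step)
    where
    s₁ = write s₀ 5 0 (s₀ 0 0)
    I : ℕ → Memory → Set
    I k s = (s 5 0 ≡ n × (∀ v → toℕ v < k → g v ≡ false)) ⊎ (∃ λ v → s 5 0 ≡ toℕ v × g v ≡ true)
    finish : ∀ {s} → I n s → Found g (s 5 0)
    finish {s} (inj₁ (p , h)) = inj₁ (p , λ v → h v (toℕ<n v))
    finish {s} (inj₂ q)       = inj₂ q
    step : ∀ k s → Rules.Step n 7 (if e nop (set 5 (lit 0) (var 7))) s₁ I k s → _
    step k s st = if-elim e nop (set 5 (lit 0) (var 7)) s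
      (λ s′ → I (suc (toℕ k)) (write s′ 7 0 (suc (toℕ k))))
      (λ z → keep (trans (sym (is-nz here)) z) inv)
        (λ z → inj₂ (k , index , trans (sym (is-nz here)) z))
      where
      open Rules.Step st
      here : Is e s (g k)
      here = e-is s k (λ b u j → let u₁ , u₂ = ∧-true⁻ {not (b ≡ᵇ 5)} u; u₃ , _ = ∧-true⁻ {not (b ≡ᵇ 7)} u₂ in
        trans (frame b u₂ j) (write-other s₀ 5 0 _ b j (not-true⁻ u₁))) index
      keep : g k ≡ false → I (toℕ k) s → I (suc (toℕ k)) s
      keep gk (inj₂ q) = inj₂ q
      keep gk (inj₁ (p , h)) = inj₁ (p , λ v v≤k → case (below-suc k v v≤k) v≤k)
        where
        case : ∀ {v} → toℕ v < toℕ k ⊎ v ≡ k → toℕ v < suc (toℕ k) → g v ≡ false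
        case (inj₁ lt) _ = h _ lt
        case (inj₂ refl) _ = gk

  Labelling : Set
  Labelling = Fin n → ℕ

  row : ℕ → Memory → Labelling
  row a s v = s a (toℕ v)

  -- The whole trace of single labellings is kept, because later arguments are inductions on it:
  -- agreement with a solution in `Steps-agree`, and the spanning tree in `separated`. `T` says by
  -- whom a vertex was labelled.
  data Steps (Arc : ℕ → Fin n → Fin n → Bool) (L T : Labelling) : Labelling → Labelling → Set where
    start : ∀ {L′ T′} → (∀ v → L′ v ≡ L v) → (∀ v → T′ v ≡ T v) → Steps Arc L T L′ T′
    step  : ∀ {L₁ T₁ L₂ T₂} x u → Steps Arc L T L₁ T₁ → L₁ x ≢ 0 → L₁ u ≡ 0 → Arc (L₁ x) x u ≡ true →
            L₂ u ≡ L₁ x → T₂ u ≡ toℕ x → (∀ v → v ≢ u → L₂ v ≡ L₁ v × T₂ v ≡ T₁ v) →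
            Steps Arc L T L₂ T₂

  Steps-resp : ∀ {Arc L T L₁ T₁ L₂ T₂} → Steps Arc L T L₁ T₁ →
               (∀ v → L₂ v ≡ L₁ v) → (∀ v → T₂ v ≡ T₁ v) → Steps Arc L T L₂ T₂
  Steps-resp (start p q) h k = start (λ v → trans (h v) (p v)) (λ v → trans (k v) (q v))
  Steps-resp (step x u st lx lu a p q r) h k =
    step x u st lx lu a (trans (h u) p) (trans (k u) q)
      (λ v v≢u → trans (h v) (proj₁ (r v v≢u)) , trans (k v) (proj₂ (r v v≢u)))

  Steps-extend : ∀ {Arc L T L₁ T₁} → Steps Arc L T L₁ T₁ → ∀ v → L v ≢ 0 → L₁ v ≡ L v
  Steps-extend (start p q) v h = p v
  Steps-extend (step x u st lx lu a p q r) v h with v Fin.≟ u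
  ... | yes refl = contradiction (trans (sym (Steps-extend st v h)) lu) h
  ... | no v≢u   = trans (proj₁ (r v v≢u)) (Steps-extend st v h)

  module _ (arc : Expr) (s₀ : Memory) (sn : s₀ 0 0 ≡ n) (Arc : ℕ → Fin n → Fin n → Bool)
           (arc-is : ∀ s x u → Frame (worklist arc) s₀ s → s 5 0 ≡ toℕ x → s 8 0 ≡ toℕ u →
                     Is arc s (Arc (row 14 s x) x u))
           where

    private
      W = worklist arc

      Reached : Memory → Set
      Reached s = Steps Arc (row 14 s₀) (row 6 s₀) (row 14 s) (row 6 s)

      Closed : Memory → Fin n → Set
      Closed s x = ∀ u → Arc (row 14 s x) x u ≡ true → row 14 s u ≢ 0

      module Visit (s₁ : Memory) (x : Fin n) (fr : Frame W s₀ s₁) (s₁5 : s₁ 5 0 ≡ toℕ x)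
                   (lx : row 14 s₁ x ≢ 0) (reached : Reached s₁) where

        record Inv (k : ℕ) (s : Memory) : Set where
          field
            extends : ∀ v → row 14 s₁ v ≢ 0 → row 14 s v ≡ row 14 s₁ v
            reach   : Reached s
            done    : ∀ u → toℕ u < k → Arc (row 14 s₁ x) x u ≡ true → row 14 s u ≢ 0

        spec : Inv n (exec (for 8 (visitBody arc)) s₁)
        spec = for-ind 8 (visitBody arc) Inv s₁ refl
                 (record { extends = λ _ _ → refl ; reach = reached ; done = λ _ () }) body
          where
          body : ∀ k s → Rules.Step n 8 (visitBody arc) s₁ Inv k s → _
          body k s st = if-elim (andE (eqE (at 14 (var 8)) (lit 0)) arc) nop
            (set 14 (var 8) (at 14 (var 5)) ▸ set 6 (var 8) (var 5)) s
            (λ s′ → Inv (suc (toℕ k)) (write s′ 8 0 (suc (toℕ k)))) skipped taken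
            where
            open Rules.Step st
            open Inv inv
            s5 : s 5 0 ≡ toℕ x
            s5 = trans (frame 5 refl 0) s₁5
            frW : Frame W s₀ s
            frW b u j = trans (frame b (unwritten-visit b u) j) (fr b u j)
              where
              unwritten-visit : ∀ b → unwritten b W ≡ true → unwritten b (for 8 (visitBody arc)) ≡ true
              unwritten-visit b u =
                let _ , u₁ = ∧-true⁻ {not (b ≡ᵇ 7) ∧ not (b ≡ᵇ 4)} u; _ , u₂ = ∧-true⁻ {not (b ≡ᵇ 9)} u₁
                    _ , u₃ = ∧-true⁻ {unwritten b (find pending)} u₂ in proj₂
                      (∧-true⁻ {not (b ≡ᵇ 4)} u₃)
            arc? : Is (andE (eqE (at 14 (var 8)) (lit 0)) arc) s
                      ((row 14 s k ≡ᵇ 0) ∧ Arc (row 14 s₁ x) x k)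
            arc? = and-is {e = eqE (at 14 (var 8)) (lit 0)} {arc}
                     (eq-is {e = at 14 (var 8)} {lit 0} (cong (s 14) index) refl)
                     (subst (Is arc s) (cong (λ l → Arc l x k) (extends x lx))
                       (arc-is s x k frW s5 index))
            skipped : _ → Inv (suc (toℕ k)) _
            skipped z = record
              { extends = extends ; reach = reach
              ; done = λ u u≤k → here u (below-suc k u u≤k) }
              where
              here : ∀ u → toℕ u < toℕ k ⊎ u ≡ k → Arc (row 14 s₁ x) x u ≡ true → row 14 s u ≢ 0
              here u (inj₁ lt) a = done u lt a
              here u (inj₂ refl) a l≡0 with () ←
                trans (sym (trans (cong (λ l → (l ≡ᵇ 0) ∧ Arc (row 14 s₁ x) x k) l≡0) a))
                      (trans (sym (is-nz arc?)) z)
            taken : _ → Inv (suc (toℕ k)) _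
            taken z = record
              { extends = λ v lv → trans
                (off v (λ v≡k → lv (trans (sym (extends v lv)) (trans (cong (row 14 s) v≡k) lk))))
                (extends v lv)
              ; reach = step x k reach (λ p → lx (trans (sym (extends x lx)) p)) lk
                          (trans (cong (λ l → Arc l x k) (extends x lx)) a)
                          newL newT (λ v v≢k → off v v≢k , offT v v≢k)
              ; done = λ u u≤k → here u (below-suc k u u≤k) }
              where
              both : ((row 14 s k ≡ᵇ 0) ∧ Arc (row 14 s₁ x) x k) ≡ true
              both = trans (sym (is-nz arc?)) z
              lk : row 14 s k ≡ 0
              lk = ≡ᵇ-true⁻ _ 0 (proj₁ (∧-true⁻ both))
              a : Arc (row 14 s₁ x) x k ≡ true
              a = proj₂ (∧-true⁻ {row 14 s k ≡ᵇ 0} both)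
              s₂ = exec (set 14 (var 8) (at 14 (var 5)) ▸ set 6 (var 8) (var 5)) s
              newL : row 14 s₂ k ≡ row 14 s x
              newL = trans (write-at s 14 (s 8 0) (s 14 (s 5 0)) (toℕ k) (sym index)) (cong (s 14) s5)
              newT : row 6 s₂ k ≡ toℕ x
              newT = trans (write-at (write s 14 (s 8 0) (s 14 (s 5 0))) 6 (s 8 0) (s 5 0) (toℕ k)
                (sym index)) s5
              off : ∀ v → v ≢ k → row 14 s₂ v ≡ row 14 s v
              off v v≢k = write-off s 14 (s 8 0) (s 14 (s 5 0)) (toℕ v)
                (λ e → toℕ-≢ v≢k (trans e index))
              offT : ∀ v → v ≢ k → row 6 s₂ v ≡ row 6 s v
              offT v v≢k = write-off (write s 14 (s 8 0) (s 14 (s 5 0))) 6 (s 8 0) (s 5 0) (toℕ v)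
                (λ e → toℕ-≢ v≢k (trans e index))
              here : ∀ u → toℕ u < toℕ k ⊎ u ≡ k → Arc (row 14 s₁ x) x u ≡ true → row 14 s₂ u ≢ 0
              here u (inj₁ lt) au l≡0 with u Fin.≟ k
              ... | yes refl = lx (trans (sym (extends x lx)) (trans (sym newL) l≡0))
              ... | no u≢k = done u lt au (trans (sym (off u u≢k)) l≡0)
              here u (inj₂ refl) au l≡0 = lx (trans (sym (extends x lx)) (trans (sym newL) l≡0))

      processed : Memory → Fin n → Bool
      processed s v = nz (row 4 s v)

      record Inv (k : ℕ) (s : Memory) : Set where
        field
          reach    : Reached s
          labelled : ∀ v → processed s v ≡ true → row 14 s v ≢ 0
          closed   : ∀ v → processed s v ≡ true → Closed s v
          -- Either each of the k rounds has processed a new vertex, or no labelled vertex is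
          -- waiting. At k = n both alternatives mean that every labelled vertex has been processed.
          progress : k ≤ cnt (processed s) ⊎ (∀ v → row 14 s v ≢ 0 → processed s v ≡ true)

      Inv-resp : ∀ {k s s′} → (∀ v → row 14 s′ v ≡ row 14 s v) → (∀ v → row 6 s′ v ≡ row 6 s v) →
                 (∀ v → row 4 s′ v ≡ row 4 s v) → Inv k s → Inv k s′
      Inv-resp {k} {s} {s′} h₁₄ h₆ h₄ i = record
        { reach = Steps-resp reach h₁₄ h₆
        ; labelled = λ v p e → labelled v (trans (sym (pr v)) p) (trans (sym (h₁₄ v)) e)
        ; closed = λ v p u a e → closed v (trans (sym (pr v)) p) u
                     (trans (cong (λ l → Arc l v u) (sym (h₁₄ v))) a) (trans (sym (h₁₄ u)) e)
        ; progress = prog progress }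
        where
        open Inv i
        pr : ∀ v → processed s′ v ≡ processed s v
        pr v = cong nz (h₄ v)
        prog : k ≤ cnt (processed s) ⊎ _ → k ≤ cnt (processed s′) ⊎ _
        prog (inj₁ p) = inj₁ (≤-trans p (≤-reflexive (cnt-cong (λ v → sym (pr v)))))
        prog (inj₂ p) = inj₂ (λ v l → trans (pr v) (p v (λ e → l (trans (h₁₄ v) e))))

      round : ∀ k s → Frame W s₀ s → Inv k s → Inv (suc k) (exec (workRound arc) s)
      round k s fr i = if-elim (ltE (var 5) (var 0)) nop (visit arc) s₁ (Inv (suc k)) skipped taken
        where
        s₁ = exec (find pending) s
        i₁ : Inv k s₁
        i₁ = Inv-resp (λ v → exec-frame (find pending) s 14 refl _)
          (λ v → exec-frame (find pending) s 6 refl _)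
               (λ v → exec-frame (find pending) s 4 refl _) i
        open Inv i₁
        found : Found (λ v → (row 4 s v ≡ᵇ 0) ∧ (0 <ᵇ row 14 s v)) (s₁ 5 0)
        found = find-spec pending s (trans (fr 0 refl 0) sn) _
          (λ s′ v f e → and-is {e = eqE (at 4 (var 7)) (lit 0)} {ltE (lit 0) (at 14 (var 7))}
                  (eq-is {e = at 4 (var 7)} {lit 0} (trans (cong (s′ 4) e) (f 4 refl (toℕ v))) refl)
                  (lt-is {e = lit 0} {at 14 (var 7)} refl (trans (cong (s′ 14) e) (f 14 refl (toℕ v)))))
        s₁n : s₁ 0 0 ≡ n
        s₁n = trans (exec-frame (find pending) s 0 refl 0) (trans (fr 0 refl 0) sn)
        is-lt : ∀ {m} → s₁ 5 0 ≡ m → nz (⟦ ltE (var 5) (var 0) ⟧ s₁) ≡ (m <ᵇ n)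
        is-lt e = is-nz (lt-is {s = s₁} {e = var 5} {var 0} e s₁n)
        skipped : _ → Inv (suc k) s₁
        skipped z with found
        ... | inj₂ (x , e , _) with () ← trans (sym (trans (is-lt e) (<ᵇ-true⁺ (toℕ<n x)))) z
        ... | inj₁ (e , none) = record
          { reach = reach ; labelled = labelled ; closed = closed ; progress = inj₂ all }
          where
          all : ∀ v → row 14 s₁ v ≢ 0 → processed s₁ v ≡ true
          all v lv with row 4 s v in p | none v
          ... | suc _ | _ = cong nz (trans (exec-frame (find pending) s 4 refl (toℕ v)) p)
          ... | zero | q with row 14 s v in l
          ...   | zero = contradiction (trans (exec-frame (find pending) s 14 refl (toℕ v)) l) lv
        taken : _ → Inv (suc k) (exec (visit arc) s₁)
        taken z with found
        ... | inj₁ (e , _) with () ← trans (sym z) (trans (is-lt e) (<ᵇ-irrefl n))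
        ... | inj₂ (x , e , px) = record
          { reach = V.reach
          ; labelled = λ v p l≡0 → labelled₂ v p (trans (sym (V.extends v (labelled₂ v p))) l≡0)
          ; closed = closed′
          ; progress = prog progress }
          where
          unprocessed : row 4 s₁ x ≡ 0
          unprocessed = trans (exec-frame (find pending) s 4 refl (toℕ x))
            (≡ᵇ-true⁻ _ 0 (proj₁ (∧-true⁻ px)))
          lx : row 14 s₁ x ≢ 0
          lx l = contradiction
            (trans (sym (trans (exec-frame (find pending) s 14 refl (toℕ x)) refl)) l)
                   (λ q → n≮n 0 (≤-trans (<ᵇ-true⁻ (proj₂ (∧-true⁻ {row 4 s x ≡ᵇ 0} px)))
                     (≤-reflexive q)))
          s₂ = exec (set 4 (var 5) (lit 1)) s₁
          fr₂ : Frame W s₀ s₂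
          fr₂ b u j =
            let _ , u₁ = ∧-true⁻ {not (b ≡ᵇ 7) ∧ not (b ≡ᵇ 4)} u; _ , u₂ = ∧-true⁻ {not (b ≡ᵇ 9)} u₁
                u₃ , u₄ = ∧-true⁻ {unwritten b (find pending)} u₂; u₅ , _ = ∧-true⁻ {not (b ≡ᵇ 4)} u₄ in
            trans (write-other s₁ 4 (s₁ 5 0) 1 b j (not-true⁻ u₅))
              (trans (exec-frame (find pending) s b u₃ j) (fr b u j))
          s₃ = exec (for 8 (visitBody arc)) s₂
          module V = Visit.Inv (Visit.spec s₂ x fr₂ e lx (Steps-resp reach (λ _ → refl) (λ _ → refl)))
          p₃ : ∀ v → row 4 s₃ v ≡ row 4 s₂ v
          p₃ v = exec-frame (for 8 (visitBody arc)) s₂ 4 refl (toℕ v)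
          px₂ : row 4 s₂ x ≡ 1
          px₂ = write-at s₁ 4 (s₁ 5 0) 1 (toℕ x) (sym e)
          poff : ∀ v → v ≢ x → row 4 s₂ v ≡ row 4 s₁ v
          poff v v≢x = write-off s₁ 4 (s₁ 5 0) 1 (toℕ v) (λ q → toℕ-≢ v≢x (trans q e))
          old : ∀ v → processed s₃ v ≡ true → v ≢ x → processed s₁ v ≡ true
          old v p v≢x = trans (sym (cong nz (trans (p₃ v) (poff v v≢x)))) p
          labelled₂ : ∀ v → processed s₃ v ≡ true → row 14 s₂ v ≢ 0
          labelled₂ v p with v Fin.≟ x
          ... | yes refl = lx
          ... | no v≢x = labelled v (old v p v≢x)
          closed′ : ∀ v → processed s₃ v ≡ true → Closed s₃ v
          closed′ v p u a with v Fin.≟ x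
          ... | yes refl = V.done u (toℕ<n u) (trans (cong (λ l → Arc l v u) (sym (V.extends v lx))) a)
          ... | no v≢x = λ l≡0 →
            let pv = old v p v≢x
                lu = closed v pv u (trans
                  (cong (λ l → Arc l v u) (sym (V.extends v (labelled v pv)))) a)
            in lu (trans (sym (V.extends u lu)) l≡0)
          kept : ∀ v → processed s₁ v ≡ true → processed s₃ v ≡ true
          kept v p with v Fin.≟ x
          ... | yes refl = cong nz (trans (p₃ v) px₂)
          ... | no v≢x = trans (cong nz (trans (p₃ v) (poff v v≢x))) p
          prog : k ≤ cnt (processed s₁) ⊎ (∀ v → row 14 s₁ v ≢ 0 → processed s₁ v ≡ true) → _
          prog (inj₂ all) with () ← trans (sym (cong nz unprocessed)) (all x lx)
          prog (inj₁ q) = inj₁ (≤-trans (s≤s q)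
            (cnt-mono-< kept x (cong nz unprocessed) (cong nz (trans (p₃ x) px₂))))

    worklist-spec : let s′ = exec (worklist arc) s₀ in
      Steps Arc (row 14 s₀) (row 6 s₀) (row 14 s′) (row 6 s′) ×
      (∀ x u → row 14 s′ x ≢ 0 → Arc (row 14 s′ x) x u ≡ true → row 14 s′ u ≢ 0)
    worklist-spec = reach , λ x u lx → closed x (all progress x lx) u
      where
      clear = for 7 (set 4 (var 7) (lit 0))
      s₁ = exec clear s₀
      cleared : ∀ v → row 4 s₁ v ≡ 0
      cleared v = for-ind 7 (set 4 (var 7) (lit 0)) (λ k s → ∀ v → toℕ v < k → row 4 s v ≡ 0) s₀
        refl (λ _ ())
        (λ k s st → λ v v≤k → here k s st v (below-suc k v v≤k)) v (toℕ<n v)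
        where
        here : ∀ k s → Rules.Step n 7 (set 4 (var 7) (lit 0)) s₀ _ k s → ∀ v → toℕ v < toℕ k ⊎ v ≡ k →
               write s 4 (s 7 0) 0 4 (toℕ v) ≡ 0
        here k s st v (inj₂ refl) = write-at s 4 (s 7 0) 0 (toℕ v) (sym (Rules.Step.index st))
        here k s st v (inj₁ lt) = trans (write-off s 4 (s 7 0) 0 (toℕ v)
          (λ q → <⇒≢ lt (trans q (Rules.Step.index st)))) (Rules.Step.inv st v lt)
      init : Inv 0 (write s₁ 9 0 0)
      init = record
        { reach = start (λ v → exec-frame clear s₀ 14 refl (toℕ v))
          (λ v → exec-frame clear s₀ 6 refl (toℕ v))
        ; labelled = λ v p → contradiction (trans (sym p) (cong nz (cleared v))) λ ()
        ; closed = λ v p → contradiction (trans (sym p) (cong nz (cleared v))) λ ()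
        ; progress = inj₁ z≤n }
      final : Inv n (exec W s₀)
      final = for-ind 9 (workRound arc) Inv s₁ refl init
        (λ k s st → Inv-resp (λ _ → refl) (λ _ → refl) (λ _ → refl)
          (round (toℕ k) s
            (λ b u j → let u₁ , u₂ = ∧-true⁻ {unwritten b clear} u in
              trans (Rules.Step.frame st b u₂ j) (exec-frame clear s₀ b u₁ j))
            (Rules.Step.inv st)))
      open Inv final
      all : n ≤ cnt (processed (exec W s₀)) ⊎ _ → ∀ v → row 14 (exec W s₀) v ≢ 0 → processed
        (exec W s₀) v ≡ true
      all (inj₁ p) v _ = cnt-full p v
      all (inj₂ p) v l = p v l

-- Boolean sets with exactly one or two elements

∧-true⁺ : ∀ {x y} → x ≡ true → y ≡ true → x ∧ y ≡ true
∧-true⁺ refl refl = refl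

∨-true⁻ : ∀ {x y} → x ∨ y ≡ true → x ≡ true ⊎ y ≡ true
∨-true⁻ {true}  _ = inj₁ refl
∨-true⁻ {false} p = inj₂ p

∨-true⁺₁ : ∀ {x y} → x ≡ true → x ∨ y ≡ true
∨-true⁺₁ refl = refl

∨-true⁺₂ : ∀ {x y} → y ≡ true → x ∨ y ≡ true
∨-true⁺₂ {x} refl = ∨-zeroʳ x

true≢false : ∀ {x} → x ≡ true → x ≡ false → ⊥
true≢false refl ()

≢true⇒false : ∀ {x} → x ≢ true → x ≡ false
≢true⇒false {true}  h = contradiction refl h
≢true⇒false {false} h = refl

not-false⁻ : ∀ {x} → not x ≡ false → x ≡ true
not-false⁻ {true} _ = refl

∧-not-false⁻ : ∀ {x y} → x ≡ true → x ∧ not y ≡ false → y ≡ true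
∧-not-false⁻ refl = not-false⁻

not-true⁺ : ∀ {x} → x ≡ false → not x ≡ true
not-true⁺ refl = refl

not-false⁺ : ∀ {x} → x ≡ true → not x ≡ false
not-false⁺ refl = refl

T⇒true : ∀ {x} → T x → x ≡ true
T⇒true {true} _ = refl

true⇒T : ∀ {x} → x ≡ true → T x
true⇒T refl = tt

eqF : ∀ {n} → Fin n → Fin n → Bool
eqF u v = toℕ u ≡ᵇ toℕ v

eqF-true⁻ : ∀ {n} {u v : Fin n} → eqF u v ≡ true → u ≡ v
eqF-true⁻ {u = u} {v} p = toℕ-injective (≡ᵇ-true⁻ (toℕ u) (toℕ v) p)

eqF-refl : ∀ {n} (u : Fin n) → eqF u u ≡ true
eqF-refl u = ≡ᵇ-refl (toℕ u)

eqF-false⁺ : ∀ {n} {u v : Fin n} → u ≢ v → eqF u v ≡ false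
eqF-false⁺ h = ≢true⇒false (h ∘ eqF-true⁻)

_minus_ : ∀ {n} → (Fin n → Bool) → Fin n → Fin n → Bool
(f minus x) v = f v ∧ not (eqF v x)

minus-true⁻ : ∀ {n} (f : Fin n → Bool) {x v} → (f minus x) v ≡ true → f v ≡ true × v ≢ x
minus-true⁻ f {x} {v} p =
  let q , r = ∧-true⁻ {f v} p in q , λ { refl → true≢false (eqF-refl v) (not-true⁻ r) }

minus-true⁺ : ∀ {n} (f : Fin n → Bool) {x v} → f v ≡ true → v ≢ x → (f minus x) v ≡ true
minus-true⁺ f p v≢x = ∧-true⁺ p (not-true⁺ (eqF-false⁺ v≢x))

cnt-minus : ∀ {n} (f : Fin n → Bool) x → f x ≡ true → cnt f ≡ suc (cnt (f minus x))
cnt-minus f zero    fx rewrite fx = cong suc (cnt-cong (λ v → sym (∧-identityʳ (f (suc v)))))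
cnt-minus f (suc x) fx = begin
  bit (f zero) + cnt (f ∘ suc)                     ≡⟨ cong (bit (f zero) +_)
    (cnt-minus (f ∘ suc) x fx) ⟩
  bit (f zero) + suc (cnt ((f ∘ suc) minus x))     ≡⟨ +-suc (bit (f zero)) _ ⟩
  suc (bit (f zero) + cnt ((f ∘ suc) minus x))     ≡⟨ cong
    (λ b → suc (bit b + cnt ((f ∘ suc) minus x))) (∧-identityʳ (f zero)) ⟨
  suc (cnt (f minus suc x))                        ∎
  where open ≡-Reasoning

cnt-zero⁻ : ∀ {n} (f : Fin n → Bool) → cnt f ≡ 0 → ∀ v → f v ≡ false
cnt-zero⁻ f p v with f v in fv
... | false = refl
... | true  = contradiction (trans (sym (cnt-minus f v fv)) p) λ ()

cnt-zero⁺ : ∀ {n} (f : Fin n → Bool) → (∀ v → f v ≡ false) → cnt f ≡ 0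
cnt-zero⁺ {zero}  f h = refl
cnt-zero⁺ {suc n} f h rewrite h zero = cnt-zero⁺ (f ∘ suc) (h ∘ suc)

cnt-suc⁻ : ∀ {n} (f : Fin n → Bool) → 0 < cnt f → ∃ λ v → f v ≡ true
cnt-suc⁻ {suc n} f p with f zero in f0
... | true  = zero , f0
... | false = let v , q = cnt-suc⁻ (f ∘ suc) p in suc v , q

One Two : ∀ {n} → (Fin n → Set) → Set
One P = ∃ λ x → P x × (∀ v → P v → v ≡ x)
Two P = ∃ λ x → ∃ λ y → x ≢ y × P x × P y × (∀ v → P v → v ≡ x ⊎ v ≡ y)

cnt-one⁻ : ∀ {n} (f : Fin n → Bool) → cnt f ≡ 1 → One (λ v → f v ≡ true)
cnt-one⁻ f p with x , fx ← cnt-suc⁻ f (≤-reflexive (sym p)) = x , fx , unique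
  where
  unique : ∀ v → f v ≡ true → v ≡ x
  unique v fv with v Fin.≟ x
  ... | yes v≡x = v≡x
  ... | no v≢x  = ⊥-elim (true≢false (minus-true⁺ f fv v≢x)
    (cnt-zero⁻ (f minus x) (cong pred (trans (sym (cnt-minus f x fx)) p)) v))

cnt-one⁺ : ∀ {n} (f : Fin n → Bool) → One (λ v → f v ≡ true) → cnt f ≡ 1
cnt-one⁺ f (x , fx , h) = trans (cnt-minus f x fx)
  (cong suc (cnt-zero⁺ (f minus x) (λ v → ≢true⇒false (λ p →
    let fv , v≢x = minus-true⁻ f p in v≢x (h v fv)))))

cnt-two⁻ : ∀ {n} (f : Fin n → Bool) → cnt f ≡ 2 → Two (λ v → f v ≡ true)
cnt-two⁻ f p with x , fx ← cnt-suc⁻ f (≤-trans (s≤s z≤n) (≤-reflexive (sym p)))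
  with y , fy , h ← cnt-one⁻ (f minus x) (cong pred (trans (sym (cnt-minus f x fx)) p))
  = let fy′ , y≢x = minus-true⁻ f fy in x , y , (λ e → y≢x (sym e)) , fx , fy′ , both
  where
  both : ∀ v → f v ≡ true → v ≡ x ⊎ v ≡ y
  both v fv with v Fin.≟ x
  ... | yes v≡x = inj₁ v≡x
  ... | no v≢x  = inj₂ (h v (minus-true⁺ f fv v≢x))

cnt-two⁺ : ∀ {n} (f : Fin n → Bool) → Two (λ v → f v ≡ true) → cnt f ≡ 2
cnt-two⁺ f (x , y , x≢y , fx , fy , h) = trans (cnt-minus f x fx)
  (cong suc (cnt-one⁺ (f minus x) (y , minus-true⁺ f fy (x≢y ∘ sym) , unique)))
  where
  unique : ∀ v → (f minus x) v ≡ true → v ≡ y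
  unique v p with minus-true⁻ f p
  ... | fv , v≢x with h v fv
  ...   | inj₁ v≡x = contradiction v≡x v≢x
  ...   | inj₂ v≡y = v≡y

Two-pin : ∀ {n} {P : Fin n → Set} → Two P → ∀ {s t} → P s → P t → s ≢ t → ∀ v → P v → v ≡ s ⊎ v ≡ t
Two-pin (x , y , x≢y , px , py , h) {s} {t} ps pt s≢t v pv with h s ps | h t pt | h v pv
... | inj₁ refl | inj₁ refl | _      = contradiction refl s≢t
... | inj₂ refl | inj₂ refl | _      = contradiction refl s≢t
... | inj₁ refl | inj₂ refl | r      = r
... | inj₂ refl | inj₁ refl | inj₁ e = inj₂ e
... | inj₂ refl | inj₁ refl | inj₂ e = inj₁ e

Two-other : ∀ {n} {P : Fin n → Set} → Two P → ∀ {s} → P s →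
            ∃ λ t → t ≢ s × P t × (∀ v → P v → v ≡ s ⊎ v ≡ t)
Two-other two@(x , y , x≢y , px , py , h) {s} ps with h s ps
... | inj₁ refl = y , (λ e → x≢y (sym e)) , py , h
... | inj₂ refl = x , x≢y , px , λ v pv → Data.Sum.swap (h v pv)

-- Recognising induced paths by degrees

VSet : ℕ → Set
VSet n = Fin n → Bool

co : ∀ {n} → VSet n → VSet n
co W v = not (W v)

module Paths {n : ℕ} (G : Graph n) where
  open Graph G using (adj; irrefl) renaming (sym to adj-sym)

  adj-flip : ∀ {u v} → adj u v ≡ true → adj v u ≡ true
  adj-flip {u} {v} p = trans (adj-sym v u) p

  -- A degree condition testable in O(n²) steps: locally, W together with a and b looks like a path
  -- from a to b with interior W. Additional cycles inside W would pass; they are excluded by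
  -- connectivity of G, in the form of `Anchored`.
  pathlike : VSet n → Fin n → Fin n → Bool
  pathlike W a b =
    ((cnt (λ v → W v ∧ adj a v) ≡ᵇ 1) ∧ (cnt (λ v → W v ∧ adj b v) ≡ᵇ 1)) ∧
    (cnt (λ u → W u ∧ not (cnt (λ v → (W v ∨ (eqF v a ∨ eqF v b)) ∧ adj u v) ≡ᵇ 2)) ≡ᵇ 0)

  Nbr : VSet n → Fin n → Fin n → Fin n → Fin n → Set
  Nbr W a b u v = (W v ≡ true ⊎ v ≡ a ⊎ v ≡ b) × adj u v ≡ true

  record PathShape (W : VSet n) (a b : Fin n) : Set where
    field
      endA : One (λ v → W v ≡ true × adj a v ≡ true)
      endB : One (λ v → W v ≡ true × adj b v ≡ true)
      two  : ∀ u → W u ≡ true → Two (Nbr W a b u)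

  Two-map : {P Q : Fin n → Set} → (∀ v → P v → Q v) → (∀ v → Q v → P v) → Two P → Two Q
  Two-map f g (x , y , x≢y , px , py , h) = x , y , x≢y , f x px , f y py , λ v q → h v (g v q)

  One-map : {P Q : Fin n → Set} → (∀ v → P v → Q v) → (∀ v → Q v → P v) → One P → One Q
  One-map f g (x , px , h) = x , f x px , λ v q → h v (g v q)

  Nbr⁻ : ∀ W a b u v → (W v ∨ (eqF v a ∨ eqF v b)) ∧ adj u v ≡ true → Nbr W a b u v
  Nbr⁻ W a b u v p with ∧-true⁻ {W v ∨ (eqF v a ∨ eqF v b)} p
  ... | q , r with ∨-true⁻ q
  ...   | inj₁ w = inj₁ w , r
  ...   | inj₂ e with ∨-true⁻ e
  ...     | inj₁ x = inj₂ (inj₁ (eqF-true⁻ x)) , r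
  ...     | inj₂ x = inj₂ (inj₂ (eqF-true⁻ x)) , r

  Nbr⁺ : ∀ W a b u v → Nbr W a b u v → (W v ∨ (eqF v a ∨ eqF v b)) ∧ adj u v ≡ true
  Nbr⁺ W a b u v (inj₁ w , r) = ∧-true⁺ (∨-true⁺₁ w) r
  Nbr⁺ W a b u v (inj₂ (inj₁ refl) , r) = ∧-true⁺ (∨-true⁺₂ {W v} (∨-true⁺₁ (eqF-refl v))) r
  Nbr⁺ W a b u v (inj₂ (inj₂ refl) , r) = ∧-true⁺ (∨-true⁺₂ {W v} (∨-true⁺₂ {eqF v a} (eqF-refl v))) r

  pathlike⁻ : ∀ W a b → pathlike W a b ≡ true → PathShape W a b
  pathlike⁻ W a b p =
    let q , r = ∧-true⁻ {(cnt (λ v → W v ∧ adj a v) ≡ᵇ 1) ∧ _} p; q₁ , q₂ = ∧-true⁻ {cnt (λ v → W v ∧ adj a v) ≡ᵇ 1} q in record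
    { endA = One-map (λ v → ∧-true⁻) (λ v (x , y) → ∧-true⁺ x y) (cnt-one⁻ _ (≡ᵇ-true⁻ _ 1 q₁))
    ; endB = One-map (λ v → ∧-true⁻) (λ v (x , y) → ∧-true⁺ x y) (cnt-one⁻ _ (≡ᵇ-true⁻ _ 1 q₂))
    ; two  = λ u wu → Two-map (Nbr⁻ W a b u) (Nbr⁺ W a b u) (cnt-two⁻ _ (degree-two u wu r)) }
    where
    degree-two : ∀ u → W u ≡ true → _ → cnt (λ v → (W v ∨ (eqF v a ∨ eqF v b)) ∧ adj u v) ≡ 2
    degree-two u wu r = ≡ᵇ-true⁻ _ 2 (∧-not-false⁻ wu (cnt-zero⁻ _ (≡ᵇ-true⁻ _ 0 r) u))

  pathlike⁺ : ∀ W a b → PathShape W a b → pathlike W a b ≡ true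
  pathlike⁺ W a b sh = ∧-true⁺
    (∧-true⁺ (cong (_≡ᵇ 1) (cnt-one⁺ _ (One-map (λ v (x , y) → ∧-true⁺ x y) (λ v → ∧-true⁻) endA)))
             (cong (_≡ᵇ 1) (cnt-one⁺ _ (One-map (λ v (x , y) → ∧-true⁺ x y) (λ v → ∧-true⁻) endB))))
    (cong (_≡ᵇ 0) (cnt-zero⁺ _ (λ u → ≢true⇒false (λ p → let wu , q = ∧-true⁻ {W u} p in
      true≢false (cong (_≡ᵇ 2) (cnt-two⁺ _ (Two-map (Nbr⁺ W a b u) (Nbr⁻ W a b u) (two u wu))))
        (not-true⁻ q)))))
    where open PathShape sh

  PathShape-swap : ∀ {W a b} → PathShape W a b → PathShape W b a
  PathShape-swap sh = record
    { endA = endB ; endB = endA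
    ; two = λ u wu → Two-map (λ v (x , y) → turn x , y) (λ v (x , y) → turn x , y) (two u wu) }
    where
    open PathShape sh
    turn : ∀ {A B C : Set} → A ⊎ B ⊎ C → A ⊎ C ⊎ B
    turn (inj₁ x) = inj₁ x
    turn (inj₂ (inj₁ x)) = inj₂ (inj₂ x)
    turn (inj₂ (inj₂ x)) = inj₂ (inj₁ x)

  pathlike-cong : ∀ {W W′} a b → (∀ v → W v ≡ W′ v) → pathlike W a b ≡ pathlike W′ a b
  pathlike-cong a b h = cong₂ _∧_
    (cong₂ _∧_ (cong (_≡ᵇ 1) (cnt-cong (λ v → cong (_∧ adj a v) (h v))))
               (cong (_≡ᵇ 1) (cnt-cong (λ v → cong (_∧ adj b v) (h v)))))
    (cong (_≡ᵇ 0) (cnt-cong (λ u → cong₂ (λ x y → x ∧ not (y ≡ᵇ 2)) (h u)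
      (cnt-cong (λ v → cong (λ x → (x ∨ (eqF v a ∨ eqF v b)) ∧ adj u v) (h v))))))

  record PathOn (W : VSet n) {k : ℕ} (p : Fin (suc k) → Fin n) : Set where
    field
      inj   : ∀ {i j} → p i ≡ p j → i ≡ j
      into  : ∀ i → W (p i) ≡ true
      onto  : ∀ v → W v ≡ true → ∃ λ i → p i ≡ v
      edge⁻ : ∀ i j → adj (p i) (p j) ≡ true → toℕ j ≡ suc (toℕ i) ⊎ toℕ i ≡ suc (toℕ j)
      edge⁺ : ∀ i j → toℕ j ≡ suc (toℕ i) → adj (p i) (p j) ≡ true

  -- Every component of G[W] meets the neighbourhood of a or of b. Sets `Z` closed under adjacency
  -- in W stand for unions of components.
  Anchored : VSet n → Fin n → Fin n → Set
  Anchored W a b = ∀ (Z : VSet n) → (∀ v → Z v ≡ true → W v ≡ true) →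
    (∀ u v → Z u ≡ true → W v ≡ true → adj u v ≡ true → Z v ≡ true) →
    ∀ z → Z z ≡ true → ∃ λ u → Z u ≡ true × (adj a u ≡ true ⊎ adj b u ≡ true)

  PathBetween : VSet n → Fin n → Fin n → Set
  PathBetween W a b = ∃ λ k → ∃ λ (p : Fin (suc k) → Fin n) →
    PathOn W p × adj a (p zero) ≡ true × adj b (p (fromℕ k)) ≡ true

  no-loop : ∀ {u v} → adj u v ≡ true → u ≢ v
  no-loop {u} e refl = true≢false e (irrefl u)

  -- Peel off the unique neighbour x of a; it plays the role of a for W ∖ {x}.
  walk : ∀ m W a b → cnt W ≡ m → W a ≡ false → W b ≡ false → a ≢ b →
         PathShape W a b → Anchored W a b → PathBetween W a b
  walk zero W a b w0 _ _ _ sh _ =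
    let x , (wx , _) , _ = PathShape.endA sh in ⊥-elim (true≢false wx (cnt-zero⁻ W w0 x))
  walk (suc m) W a b w# a∉ b∉ a≢b sh anch with PathShape.endA sh
  ... | x , (wx , ax) , x-only = decide (adj b x) refl
    where
    open PathShape sh
    W′ = W minus x
    Nx = two x wx
    Nxa : Nbr W a b x a
    Nxa = inj₂ (inj₁ refl) , adj-flip ax

    decide : ∀ c → adj b x ≡ c → PathBetween W a b
    -- Now a and b are the two neighbours of x, so no other vertex of W is adjacent to x. Remaining
    -- vertices would form a closed set, which `anch` joins to a or b; but x is the only neighbour
    -- of either in W.
    decide true bx = 0 , (λ _ → x) , record
      { inj = λ { {zero} {zero} _ → refl }
      ; into = λ _ → wx
      ; onto = λ v wv → zero , sym (only v wv)
      ; edge⁻ = λ i j e → ⊥-elim (no-loop e refl)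
      ; edge⁺ = λ { zero zero () }
      } , ax , bx
      where
      isolated : ∀ v → W v ≡ true → adj x v ≡ true → ⊥
      isolated v wv xv with Two-pin Nx Nxa (inj₂ (inj₂ refl) , adj-flip bx) a≢b v (inj₁ wv , xv)
      ... | inj₁ refl = true≢false wv a∉
      ... | inj₂ refl = true≢false wv b∉
      only : ∀ v → W v ≡ true → v ≡ x
      only v wv with v Fin.≟ x
      ... | yes v≡x = v≡x
      ... | no v≢x with anch W′ (λ u → proj₁ ∘ minus-true⁻ W)
                          (λ u t zu wt ut → minus-true⁺ W wt λ { refl →
                             isolated u (proj₁ (minus-true⁻ W zu)) (adj-flip ut) })
                          v (minus-true⁺ W wv v≢x)
      ...   | u , zu , inj₁ au = let wu , u≢x = minus-true⁻ W zu in contradiction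
        (x-only u (wu , au)) u≢x
      ...   | u , zu , inj₂ bu = let wu , u≢x = minus-true⁻ W zu; _ , _ , y-only = endB in
        contradiction (trans (y-only u (wu , bu)) (sym (y-only x (wx , bx)))) u≢x
    decide false bx with Two-other Nx Nxa
    ... | y , y≢a , (y∈ , xy) , Nx-only = extend
            (walk m W′ x b (cong pred (trans (sym (cnt-minus W x wx)) w#))
                  x∉W′ (cong (_∧ _) b∉) (λ x≡b → true≢false wx (trans (cong W x≡b) b∉)) shape′ anch′)
      where
      x∉W′ : W′ x ≡ false
      x∉W′ = ≢true⇒false (λ p → proj₂ (minus-true⁻ W p) refl)
      b≁ : ∀ {v} → adj b v ≡ true → v ≢ x
      b≁ bv refl = true≢false bv bx
      wy : W y ≡ true
      wy = [ (λ w → w) , [ (λ e → contradiction e y≢a) ,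
        (λ { refl → ⊥-elim (true≢false (adj-flip xy) bx) }) ]′ ]′ y∈
      to : ∀ u → W′ u ≡ true → ∀ v → Nbr W a b u v → Nbr W′ x b u v
      to u wu v (inj₂ (inj₂ e) , uv) = inj₂ (inj₂ e) , uv
      to u wu v (inj₂ (inj₁ refl) , uv) = let w , u≢x = minus-true⁻ W wu in
        contradiction (x-only u (w , adj-flip uv)) u≢x
      to u wu v (inj₁ wv , uv) with v Fin.≟ x
      ... | yes v≡x = inj₂ (inj₁ v≡x) , uv
      ... | no v≢x  = inj₁ (minus-true⁺ W wv v≢x) , uv
      from : ∀ u v → Nbr W′ x b u v → Nbr W a b u v
      from u v (inj₁ wv , uv) = inj₁ (proj₁ (minus-true⁻ W wv)) , uv
      from u v (inj₂ (inj₁ refl) , uv) = inj₁ wx , uv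
      from u v (inj₂ (inj₂ e) , uv) = inj₂ (inj₂ e) , uv
      y-unique : ∀ v → W′ v ≡ true × adj x v ≡ true → v ≡ y
      y-unique v (wv , xv) with Nx-only v (inj₁ (proj₁ (minus-true⁻ W wv)) , xv)
      ... | inj₁ refl = ⊥-elim (true≢false (proj₁ (minus-true⁻ W wv)) a∉)
      ... | inj₂ e = e
      shape′ : PathShape W′ x b
      shape′ = record
        { endA = y , (minus-true⁺ W wy (λ e → no-loop xy (sym e)) , xy) , y-unique
        ; endB = One-map (λ v (wv , bv) → minus-true⁺ W wv (b≁ bv) , bv)
                         (λ v (wv , bv) → proj₁ (minus-true⁻ W wv) , bv) endB
        ; two = λ u wu → Two-map (to u wu) (from u) (two u (proj₁ (minus-true⁻ W wu)))
        }
      anch′ : Anchored W′ x b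
      anch′ Z Z⊆ Zc z zz with any? (λ u → (Z u ∧ adj x u) Data.Bool.≟ true)
      ... | yes (u , p) = let zu , xu = ∧-true⁻ {Z u} p in u , zu , inj₁ xu
      -- If Z contains no neighbour of x, it is closed in W too, so `anch` applies; a neighbour of a
      -- in Z would have to be x, which is not in `W′`.
      ... | no none with anch Z (λ v zv → proj₁ (minus-true⁻ W (Z⊆ v zv)))
                           (λ u v zu wv uv → Zc u v zu (minus-true⁺ W wv λ { refl →
                              none (u , ∧-true⁺ zu (adj-flip uv)) }) uv) z zz
      ...   | u , zu , inj₂ bu = u , zu , inj₂ bu
      ...   | u , zu , inj₁ au = let wu , u≢x = minus-true⁻ W (Z⊆ u zu) in contradiction
        (x-only u (wu , au)) u≢x
      extend : PathBetween W′ x b → PathBetween W a b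
      extend (k , p , po , xp , bp) = suc k , q , record
        { inj = inj′ ; into = into′ ; onto = onto′ ; edge⁻ = edge⁻′ ; edge⁺ = edge⁺′ } , ax , bp
        where
        open PathOn po
        q : Fin (2 + k) → Fin n
        q zero    = x
        q (suc i) = p i
        p≢x : ∀ i → p i ≢ x
        p≢x i = proj₂ (minus-true⁻ W (into i))
        inj′ : ∀ {i j} → q i ≡ q j → i ≡ j
        inj′ {zero}  {zero}  e = refl
        inj′ {zero}  {suc j} e = contradiction (sym e) (p≢x j)
        inj′ {suc i} {zero}  e = contradiction e (p≢x i)
        inj′ {suc i} {suc j} e = cong suc (inj e)
        into′ : ∀ i → W (q i) ≡ true
        into′ zero    = wx
        into′ (suc i) = proj₁ (minus-true⁻ W (into i))
        onto′ : ∀ v → W v ≡ true → ∃ λ i → q i ≡ v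
        onto′ v wv with v Fin.≟ x
        ... | yes refl = zero , refl
        ... | no v≢x = let i , e = onto v (minus-true⁺ W wv v≢x) in suc i , e
        first : ∀ j → adj x (p j) ≡ true → j ≡ zero
        first j e = inj (trans (y-unique (p j) (into j , e)) (sym (y-unique (p zero) (into zero , xp))))
        edge⁻′ : ∀ i j → adj (q i) (q j) ≡ true → toℕ j ≡ suc (toℕ i) ⊎ toℕ i ≡ suc (toℕ j)
        edge⁻′ zero    zero    e = ⊥-elim (no-loop e refl)
        edge⁻′ zero    (suc j) e = inj₁ (cong (suc ∘ toℕ) (first j e))
        edge⁻′ (suc i) zero    e = inj₂ (cong (suc ∘ toℕ) (first i (adj-flip e)))
        edge⁻′ (suc i) (suc j) e = Data.Sum.map (cong suc) (cong suc) (edge⁻ i j e)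
        edge⁺′ : ∀ i j → toℕ j ≡ suc (toℕ i) → adj (q i) (q j) ≡ true
        edge⁺′ zero    (suc zero) e = xp
        edge⁺′ (suc i) (suc j)    e = edge⁺ i j (cong pred e)

  exit : ∀ {X} (Z : VSet n) {z y} → Star (λ u v → u ∈ X × v ∈ X × Adj G u v) z y →
         Z z ≡ true → Z y ≡ false → ∃ λ u → ∃ λ v → Z u ≡ true × Z v ≡ false × adj u v ≡ true
  exit Z ε zz zy = ⊥-elim (true≢false zz zy)
  exit Z {z} (_◅_ {j = v} (_ , _ , zv) st) zz zy with Z v in e
  ... | true  = exit Z st e zy
  ... | false = z , v , zz , e , T⇒true zv

module _ {n : ℕ} where

  ∈-lookup : ∀ {X : Subset n} {v} → v ∈ X → lookup X v ≡ true
  ∈-lookup = []=⇒lookup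

  lookup-∈ : ∀ {X : Subset n} {v} → lookup X v ≡ true → v ∈ X
  lookup-∈ {X} {v} = lookup⇒[]= v X

  ∈-tabulate⁻ : ∀ {W : VSet n} {v} → v ∈ tabulate W → W v ≡ true
  ∈-tabulate⁻ {W} {v} p = trans (sym (lookup∘tabulate W v)) (∈-lookup p)

  ∈-tabulate⁺ : ∀ {W : VSet n} {v} → W v ≡ true → v ∈ tabulate W
  ∈-tabulate⁺ {W} {v} p = lookup-∈ (trans (lookup∘tabulate W v) p)

card : ∀ {n} (X : Subset n) → ∣ X ∣ ≡ cnt (lookup X)
card []          = refl
card (true ∷ X)  = cong suc (card X)
card (false ∷ X) = card X

xor-false⁺ : ∀ {x y} → (x ≡ true → y ≡ true) → (y ≡ true → x ≡ true) → x xor y ≡ false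
xor-false⁺ {true}  {true}  f g = refl
xor-false⁺ {true}  {false} f g = sym (f refl)
xor-false⁺ {false} {true}  f g = sym (g refl)
xor-false⁺ {false} {false} f g = refl

xor-false⁻ : ∀ {x y} → x xor y ≡ false → x ≡ y
xor-false⁻ {true}  {true}  _ = refl
xor-false⁻ {false} {false} _ = refl

∨-false⁻ : ∀ {x y} → x ∨ y ≡ false → x ≡ false × y ≡ false
∨-false⁻ {false} p = refl , p

∨-false⁺ : ∀ {x y} → x ≡ false → y ≡ false → x ∨ y ≡ false
∨-false⁺ refl p = p

-- Edges a₁a₂ and b₁b₂ that are prescribed to lie in A₁ × A₂ and B₁ × B₂.
record Quad (n : ℕ) : Set where
  constructor quad
  field a₁ b₁ a₂ b₂ : Fin n

opposite : ∀ {n} → Quad n → Quad n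
opposite (quad a₁ b₁ a₂ b₂) = quad a₂ b₂ a₁ b₁

-- 2-joins as closed sets of an implication digraph

module Joins {n : ℕ} (G : Graph n) where
  open Graph G using (adj; irrefl) renaming (sym to adj-sym)
  open Paths G

  -- Given the quad, u ∈ X₁ and v ∈ X₂ belong to A₁, B₁, A₂, B₂ precisely when
  -- they are adjacent to a₂, b₂, a₁, b₁; bad u v says that this forbids
  -- u ∈ X₁ and v ∈ X₂.
  bad : Quad n → Fin n → Fin n → Bool
  bad (quad a₁ b₁ a₂ b₂) u v =
    (adj u v xor ((adj u a₂ ∧ adj v a₁) ∨ (adj u b₂ ∧ adj v b₁))) ∨
    ((adj u a₂ ∧ adj u b₂) ∨ (adj v a₁ ∧ adj v b₁))

  bad-opposite : ∀ q u v → bad (opposite q) v u ≡ bad q u v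
  bad-opposite (quad a₁ b₁ a₂ b₂) u v = cong₂ _∨_
    (cong₂ _xor_ (adj-sym v u) (cong₂ _∨_ (∧-comm (adj v a₁) _) (∧-comm (adj v b₁) _)))
    (∨-comm (adj v a₁ ∧ adj v b₁) _)

  -- Size and path conditions are left out, because only closure under the arcs u → v with
  -- `bad q u v` can be maintained by propagation.
  record Valid (q : Quad n) (W : VSet n) : Set where
    open Quad q
    field
      a₁∈ : W a₁ ≡ true
      b₁∈ : W b₁ ≡ true
      a₂∉ : W a₂ ≡ false
      b₂∉ : W b₂ ≡ false
      a₁a₂ : adj a₁ a₂ ≡ true
      b₁b₂ : adj b₁ b₂ ≡ true
      closed : ∀ u v → W u ≡ true → W v ≡ false → bad q u v ≡ false

  -- Exchanging the sides reverses the arcs. Statements about the least admissible set thereby apply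
  -- to the complement of the greatest one.
  Valid-opposite : ∀ {q W} → Valid q W → Valid (opposite q) (co W)
  Valid-opposite {q} {W} va = record
    { a₁∈ = not-true⁺ a₂∉ ; b₁∈ = not-true⁺ b₂∉ ; a₂∉ = not-false⁺ a₁∈ ; b₂∉ = not-false⁺ b₁∈
    ; a₁a₂ = adj-flip a₁a₂ ; b₁b₂ = adj-flip b₁b₂
    ; closed = λ u v wu wv → trans (bad-opposite q v u) (closed v u (not-false⁻ wv) (not-true⁻ wu)) }
    where open Valid va

  module ValidFacts {a₁ b₁ a₂ b₂ : Fin n} {W} (va : Valid (quad a₁ b₁ a₂ b₂) W) where
    open Valid va public

    parts : ∀ u v → W u ≡ true → W v ≡ false →
            adj u v ≡ (adj u a₂ ∧ adj v a₁) ∨ (adj u b₂ ∧ adj v b₁) ×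
            adj u a₂ ∧ adj u b₂ ≡ false × adj v a₁ ∧ adj v b₁ ≡ false
    parts u v wu wv =
      let p , q = ∨-false⁻ {adj u v xor _} (closed u v wu wv); r , t = ∨-false⁻ {adj u a₂ ∧ adj u b₂} q
      in xor-false⁻ p , r , t

    crossing⁻ : ∀ {u v} → W u ≡ true → W v ≡ false → adj u v ≡ true →
                (adj u a₂ ≡ true × adj v a₁ ≡ true) ⊎ (adj u b₂ ≡ true × adj v b₁ ≡ true)
    crossing⁻ {u} {v} wu wv e with ∨-true⁻ {adj u a₂ ∧ adj v a₁}
      (trans (sym (proj₁ (parts u v wu wv))) e)
    ... | inj₁ p = inj₁ (∧-true⁻ p)
    ... | inj₂ p = inj₂ (∧-true⁻ p)

    A-crossing⁺ : ∀ {u v} → W u ≡ true → W v ≡ false → adj u a₂ ≡ true → adj v a₁ ≡ true → adj u v ≡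
      true
    A-crossing⁺ {u} {v} wu wv p q = trans (proj₁ (parts u v wu wv)) (∨-true⁺₁ (∧-true⁺ p q))

    B-crossing⁺ : ∀ {u v} → W u ≡ true → W v ≡ false → adj u b₂ ≡ true → adj v b₁ ≡ true → adj u v ≡
      true
    B-crossing⁺ {u} {v} wu wv p q = trans (proj₁ (parts u v wu wv))
      (∨-true⁺₂ {adj u a₂ ∧ adj v a₁} (∧-true⁺ p q))

    not-both₁ : ∀ {u} → W u ≡ true → adj u a₂ ≡ true → adj u b₂ ≡ true → ⊥
    not-both₁ wu p q = true≢false (∧-true⁺ p q) (proj₁ (proj₂ (parts _ a₂ wu a₂∉)))

    not-both₂ : ∀ {v} → W v ≡ false → adj v a₁ ≡ true → adj v b₁ ≡ true → ⊥
    not-both₂ wv p q = true≢false (∧-true⁺ p q) (proj₂ (proj₂ (parts a₁ _ a₁∈ wv)))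

    a₂≢b₂ : a₂ ≢ b₂
    a₂≢b₂ e = not-both₁ a₁∈ a₁a₂ (trans (cong (adj a₁) (sym e)) a₁a₂)

    a₁≢b₁ : a₁ ≢ b₁
    a₁≢b₁ e = not-both₁ a₁∈ a₁a₂ (trans (cong (λ x → adj x b₂) e) b₁b₂)

    -- By connectivity some edge leaves Z. As Z is closed in W, this edge crosses to the other side,
    -- and its end in Z is therefore a neighbour of a₂ or b₂.
    anchored : Connected G → Anchored W a₂ b₂
    anchored conn Z Z⊆ Zc z zz
      with exit Z (conn z a₂ ∈⊤ ∈⊤) zz (≢true⇒false (λ p → true≢false (Z⊆ a₂ p) a₂∉))
    ... | u , v , zu , zv , uv with W v in wv
    ...   | true  = ⊥-elim (true≢false (Zc u v zu wv uv) zv)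
    ...   | false with crossing⁻ (Z⊆ u zu) wv uv
    ...     | inj₁ (p , _) = u , zu , inj₁ (adj-flip p)
    ...     | inj₂ (p , _) = u , zu , inj₂ (adj-flip p)

    -- A valid subset of a path side contains, with each interior vertex, its neighbours.
    path-minimal : ∀ {Y} → Valid (quad a₁ b₁ a₂ b₂) Y → (∀ v → Y v ≡ true → W v ≡ true) →
                   3 ≤ cnt Y → PathBetween W a₂ b₂ → PathShape W a₂ b₂ → ∀ v → W v ≡ true → Y v ≡ true
    path-minimal {Y} vy Y⊆ 3≤ (k , p , po , ap , bp) sh v wv =
      let i , e = onto v wv in subst (λ x → Y x ≡ true) e (all i)
      where
      open PathOn po
      module VY = Valid vy
      a-only : ∀ {u} → W u ≡ true → adj u a₂ ≡ true → u ≡ p zero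
      a-only wu e = let _ , _ , h = PathShape.endA sh in
        trans (h _ (wu , adj-flip e)) (sym (h _ (into zero , ap)))
      b-only : ∀ {u} → W u ≡ true → adj u b₂ ≡ true → u ≡ p (fromℕ k)
      b-only wu e = let _ , _ , h = PathShape.endB sh in
        trans (h _ (wu , adj-flip e)) (sym (h _ (into (fromℕ k) , bp)))
      pa : a₁ ≡ p zero
      pa = a-only (Y⊆ a₁ VY.a₁∈) a₁a₂
      pb : b₁ ≡ p (fromℕ k)
      pb = b-only (Y⊆ b₁ VY.b₁∈) b₁b₂
      -- Besides the ends a₁ and b₁, Y has an interior vertex of the path; from there membership in
      -- Y spreads in both directions (`up` and `down`).
      third : ∃ λ c → Y c ≡ true × c ≢ a₁ × c ≢ b₁
      third = let c , q = cnt-suc⁻ ((Y minus a₁) minus b₁) (≤-pred (≤-pred (≤-trans 3≤ (≤-reflexive (trans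
                    (cnt-minus Y a₁ VY.a₁∈)
                      (cong suc (cnt-minus (Y minus a₁) b₁ (minus-true⁺ Y VY.b₁∈ (a₁≢b₁ ∘ sym)))))))))
                  r , c≢b = minus-true⁻ (Y minus a₁) q
                  y , c≢a = minus-true⁻ Y r
              in c , y , c≢a , c≢b
      -- If p j were outside Y, validity of Y would make p i adjacent to a₂ or b₂, and thus an end
      -- of the path.
      interior-closed : ∀ i j → i ≢ zero → i ≢ fromℕ k → Y (p i) ≡ true → adj (p i) (p j) ≡ true → Y
        (p j) ≡ true
      interior-closed i j i≢0 i≢k yi e with Y (p j) in yj
      ... | true = refl
      ... | false with ∨-true⁻ {adj (p i) a₂ ∧ adj (p j) a₁}
        (trans (sym (xor-false⁻ (proj₁ (∨-false⁻ (VY.closed (p i) (p j) yi yj))))) e)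
      ...   | inj₁ q = contradiction (inj (a-only (into i) (proj₁ (∧-true⁻ q)))) i≢0
      ...   | inj₂ q = contradiction (inj (b-only (into i) (proj₁ (∧-true⁻ {adj (p i) b₂} q)))) i≢k
      c = proj₁ third
      ic = proj₁ (onto c (Y⊆ c (proj₁ (proj₂ third))))
      pc : p ic ≡ c
      pc = proj₂ (onto c (Y⊆ c (proj₁ (proj₂ third))))
      ic≢0 : ic ≢ zero
      ic≢0 e = proj₁ (proj₂ (proj₂ third)) (trans (sym pc) (trans (cong p e) (sym pa)))
      yc : Y (p ic) ≡ true
      yc = trans (cong Y pc) (proj₁ (proj₂ third))
      ic≢k : ic ≢ fromℕ k
      ic≢k e = proj₂ (proj₂ (proj₂ third)) (trans (sym pc) (trans (cong p e) (sym pb)))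
      up : ∀ d j → toℕ ic + d ≡ toℕ j → Y (p j) ≡ true
      up zero j e = subst (λ i → Y (p i) ≡ true) (toℕ-injective (trans (sym (+-identityʳ _)) e)) yc
      up (suc d) j e =
        interior-closed i j (λ z → <⇒≢
          (≤-trans (n≢0⇒n>0 (λ z′ → ic≢0 (toℕ-injective z′))) (m≤m+n (toℕ ic) d))
                              (sym (trans (sym ti) (cong toℕ z))))
          (λ z → <⇒≢ (≤-trans (s≤s
            (≤-reflexive (trans (sym (toℕ-fromℕ k)) (trans (cong toℕ (sym z)) ti))))
            (≤-trans (≤-reflexive (trans (sym (+-suc _ d)) e)) (≤-pred (toℕ<n j)))) refl)
          (up d i (sym ti)) (edge⁺ i j (trans (sym e) (trans (+-suc _ d) (cong suc (sym ti)))))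
        where
        below : toℕ ic + d < suc k
        below = ≤-trans (≤-reflexive (trans (sym (+-suc _ d)) e)) (≤-trans (n≤1+n _) (toℕ<n j))
        i = fromℕ< below
        ti : toℕ i ≡ toℕ ic + d
        ti = toℕ-fromℕ< below
      down : ∀ d j → toℕ j + d ≡ toℕ ic → Y (p j) ≡ true
      down zero j e = subst (λ i → Y (p i) ≡ true) (toℕ-injective (trans (sym e) (+-identityʳ _))) yc
      down (suc d) j e =
        interior-closed i j (λ z → 1+n≢0 (trans (sym ti) (cong toℕ z)))
          (λ z → ic≢k (toℕ-injective
            (≤-antisym (≤-trans (≤-pred (toℕ<n ic)) (≤-reflexive (sym (toℕ-fromℕ k))))
             (≤-trans (≤-reflexive (trans (cong toℕ (sym z)) ti))
               (≤-trans (s≤s (m≤m+n (toℕ j) d)) (≤-reflexive (trans (sym (+-suc _ d)) e)))))))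
          (down d i (trans (cong (_+ d) ti) (trans (sym (+-suc _ d)) e)))
          (adj-flip (edge⁺ j i ti))
        where
        below : suc (toℕ j) < suc k
        below = ≤-trans (s≤s
          (≤-trans (s≤s (m≤m+n (toℕ j) d)) (≤-reflexive (trans (sym (+-suc _ d)) e)))) (toℕ<n ic)
        i = fromℕ< below
        ti : toℕ i ≡ suc (toℕ j)
        ti = toℕ-fromℕ< below
      all : ∀ j → Y (p j) ≡ true
      all j with ≤-total (toℕ ic) (toℕ j)
      ... | inj₁ le = up (toℕ j ∸ toℕ ic) j (m+[n∸m]≡n le)
      ... | inj₂ le = down (toℕ ic ∸ toℕ j) j (m+[n∸m]≡n le)

    path-between : Connected G → PathShape W a₂ b₂ → PathBetween W a₂ b₂
    path-between conn sh = walk _ W a₂ b₂ refl a₂∉ b₂∉ a₂≢b₂ sh (anchored conn)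

  swap-split : ∀ {X₁ X₂ A₁ B₁ A₂ B₂} → IsSplit G X₁ X₂ A₁ B₁ A₂ B₂ → IsSplit G X₁ X₂ B₁ A₁ B₂ A₂
  swap-split {A₁ = A₁} {B₁} {A₂} {B₂} sp = record
    { X-cover = X-cover ; X-disjoint = X-disjoint
    ; A₁⊆X₁ = B₁⊆X₁ ; B₁⊆X₁ = A₁⊆X₁ ; A₂⊆X₂ = B₂⊆X₂ ; B₂⊆X₂ = A₂⊆X₂
    ; A₁B₁-disjoint = λ { (v , p) → let x , y = x∈p∩q⁻ B₁ A₁ p in A₁B₁-disjoint (v , x∈p∩q⁺ (y , x)) }
    ; A₂B₂-disjoint = λ { (v , p) → let x , y = x∈p∩q⁻ B₂ A₂ p in A₂B₂-disjoint (v , x∈p∩q⁺ (y , x)) }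
    ; A₁-nonempty = B₁-nonempty ; B₁-nonempty = A₁-nonempty ; A₂-nonempty = B₂-nonempty ;
      B₂-nonempty = A₂-nonempty
    ; A-complete = B-complete ; B-complete = A-complete
    ; no-other = λ u v x y e → Data.Sum.swap (no-other u v x y e)
    ; X₁-size = X₁-size ; X₂-size = X₂-size }
    where open IsSplit sp

  flip-split : ∀ {X₁ X₂ A₁ B₁ A₂ B₂} → IsSplit G X₁ X₂ A₁ B₁ A₂ B₂ → IsSplit G X₂ X₁ A₂ B₂ A₁ B₁
  flip-split {X₁} {X₂} sp = record
    { X-cover = trans (∪-comm X₂ X₁) X-cover
    ; X-disjoint = λ { (v , p) → let x , y = x∈p∩q⁻ X₂ X₁ p in X-disjoint (v , x∈p∩q⁺ (y , x)) }
    ; A₁⊆X₁ = A₂⊆X₂ ; B₁⊆X₁ = B₂⊆X₂ ; A₂⊆X₂ = A₁⊆X₁ ; B₂⊆X₂ = B₁⊆X₁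
    ; A₁B₁-disjoint = A₂B₂-disjoint ; A₂B₂-disjoint = A₁B₁-disjoint
    ; A₁-nonempty = A₂-nonempty ; B₁-nonempty = B₂-nonempty ; A₂-nonempty = A₁-nonempty ;
      B₂-nonempty = B₁-nonempty
    ; A-complete = λ u v x y → true⇒T (adj-flip (T⇒true (A-complete v u y x)))
    ; B-complete = λ u v x y → true⇒T (adj-flip (T⇒true (B-complete v u y x)))
    ; no-other = λ u v x y e → Data.Sum.map Data.Product.swap Data.Product.swap
      (no-other v u y x (true⇒T (adj-flip (T⇒true e))))
    ; X₁-size = X₂-size ; X₂-size = X₁-size }
    where open IsSplit sp

  module SplitFacts {X₁ X₂ A₁ B₁ A₂ B₂} (sp : IsSplit G X₁ X₂ A₁ B₁ A₂ B₂) where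
    open IsSplit sp public

    W : VSet n
    W = lookup X₁

    ∈X₂⇒ : ∀ {v} → v ∈ X₂ → W v ≡ false
    ∈X₂⇒ {v} p = ≢true⇒false (λ q → X-disjoint (v , x∈p∩q⁺ (lookup-∈ q , p)))

    ⇒∈X₂ : ∀ {v} → W v ≡ false → v ∈ X₂
    ⇒∈X₂ {v} p with x∈p∪q⁻ X₁ X₂ (subst (v ∈_) (sym X-cover) ∈⊤)
    ... | inj₁ q = ⊥-elim (true≢false (∈-lookup q) p)
    ... | inj₂ q = q

    lookup-X₂ : ∀ v → lookup X₂ v ≡ co W v
    lookup-X₂ v with W v in e
    ... | false = ∈-lookup (⇒∈X₂ e)
    ... | true  = ≢true⇒false (λ q → true≢false e (∈X₂⇒ (lookup-∈ q)))

    in-A₁ : ∀ {u y} → u ∈ X₁ → y ∈ A₂ → adj u y ≡ true → u ∈ A₁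
    in-A₁ {u} {y} u∈ y∈ e with no-other u y u∈ (A₂⊆X₂ y∈) (true⇒T e)
    ... | inj₁ (p , _) = p
    ... | inj₂ (_ , q) = contradiction (y , x∈p∩q⁺ (y∈ , q)) A₂B₂-disjoint

    in-B₁ : ∀ {u y} → u ∈ X₁ → y ∈ B₂ → adj u y ≡ true → u ∈ B₁
    in-B₁ {u} {y} u∈ y∈ e with no-other u y u∈ (B₂⊆X₂ y∈) (true⇒T e)
    ... | inj₂ (p , _) = p
    ... | inj₁ (_ , q) = contradiction (y , x∈p∩q⁺ (q , y∈)) A₂B₂-disjoint

    in-A₂ : ∀ {x v} → x ∈ A₁ → v ∈ X₂ → adj v x ≡ true → v ∈ A₂
    in-A₂ {x} {v} x∈ v∈ e with no-other x v (A₁⊆X₁ x∈) v∈ (true⇒T (adj-flip e))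
    ... | inj₁ (_ , p) = p
    ... | inj₂ (q , _) = contradiction (x , x∈p∩q⁺ (x∈ , q)) A₁B₁-disjoint

    in-B₂ : ∀ {x v} → x ∈ B₁ → v ∈ X₂ → adj v x ≡ true → v ∈ B₂
    in-B₂ {x} {v} x∈ v∈ e with no-other x v (B₁⊆X₁ x∈) v∈ (true⇒T (adj-flip e))
    ... | inj₂ (_ , p) = p
    ... | inj₁ (q , _) = contradiction (x , x∈p∩q⁺ (q , x∈)) A₁B₁-disjoint

    A-adj : ∀ {u v} → u ∈ A₁ → v ∈ A₂ → adj u v ≡ true
    A-adj p q = T⇒true (A-complete _ _ p q)

    B-adj : ∀ {u v} → u ∈ B₁ → v ∈ B₂ → adj u v ≡ true
    B-adj p q = T⇒true (B-complete _ _ p q)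

    -- In a split, adjacency to a single vertex of A₂ already decides membership in A₁, and
    -- similarly for the other three sets; so any choice of representatives works.
    split-valid : ∀ {a₁ b₁ a₂ b₂} → a₁ ∈ A₁ → b₁ ∈ B₁ → a₂ ∈ A₂ → b₂ ∈ B₂ → Valid (quad a₁ b₁ a₂ b₂) W
    split-valid {a₁} {b₁} {a₂} {b₂} x y z t = record
      { a₁∈ = ∈-lookup (A₁⊆X₁ x) ; b₁∈ = ∈-lookup (B₁⊆X₁ y)
      ; a₂∉ = ∈X₂⇒ (A₂⊆X₂ z) ; b₂∉ = ∈X₂⇒ (B₂⊆X₂ t)
      ; a₁a₂ = A-adj x z ; b₁b₂ = B-adj y t ; closed = closed }
      where
      closed : ∀ u v → W u ≡ true → W v ≡ false → bad (quad a₁ b₁ a₂ b₂) u v ≡ false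
      closed u v wu wv = ∨-false⁺ (xor-false⁺ to from) (∨-false⁺
        (≢true⇒false (λ p → let p₁ , p₂ = ∧-true⁻ {adj u a₂} p in
           A₁B₁-disjoint (u , x∈p∩q⁺ (in-A₁ u∈ z p₁ , in-B₁ u∈ t p₂))))
        (≢true⇒false (λ p → let p₁ , p₂ = ∧-true⁻ {adj v a₁} p in
           A₂B₂-disjoint (v , x∈p∩q⁺ (in-A₂ x v∈ p₁ , in-B₂ y v∈ p₂)))))
        where
        u∈ = lookup-∈ wu
        v∈ = ⇒∈X₂ wv
        to : adj u v ≡ true → (adj u a₂ ∧ adj v a₁) ∨ (adj u b₂ ∧ adj v b₁) ≡ true
        to e with no-other u v u∈ v∈ (true⇒T e)
        ... | inj₁ (p , q) = ∨-true⁺₁ (∧-true⁺ (A-adj p z) (adj-flip (A-adj x q)))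
        ... | inj₂ (p , q) = ∨-true⁺₂ {adj u a₂ ∧ adj v a₁} (∧-true⁺ (B-adj p t) (adj-flip (B-adj y q)))
        from : (adj u a₂ ∧ adj v a₁) ∨ (adj u b₂ ∧ adj v b₁) ≡ true → adj u v ≡ true
        from e with ∨-true⁻ {adj u a₂ ∧ adj v a₁} e
        ... | inj₁ p = let p₁ , p₂ = ∧-true⁻ {adj u a₂} p in A-adj (in-A₁ u∈ z p₁) (in-A₂ x v∈ p₂)
        ... | inj₂ p = let p₁ , p₂ = ∧-true⁻ {adj u b₂} p in B-adj (in-B₁ u∈ t p₁) (in-B₂ y v∈ p₂)

    module _ {a₂ b₂} (a₂∈ : a₂ ∈ A₂) (b₂∈ : b₂ ∈ B₂) where

      shape⇒path-side : Connected G → PathShape W a₂ b₂ → IsPathSide G X₁ A₁ B₁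
      shape⇒path-side conn sh
        with k , p , po , ap , bp ← ValidFacts.path-between
               (split-valid (proj₂ A₁-nonempty) (proj₂ B₁-nonempty) a₂∈ b₂∈) conn sh
        = k , p , on , in-A₁ (lookup-∈ (into zero)) a₂∈ (adj-flip ap) ,
          in-B₁ (lookup-∈ (into (fromℕ k))) b₂∈ (adj-flip bp) , interior
        where
        open PathOn po
        on : IsPathOn G X₁ p
        on = record
          { injective = inj
          ; image = λ v → mk⇔ (λ v∈ → onto v (∈-lookup v∈)) (λ { (i , refl) → lookup-∈ (into i) })
          ; edges = λ i j → mk⇔ (λ e → edge⁻ i j (T⇒true e))
              (λ { (inj₁ e) → true⇒T (edge⁺ i j e) ; (inj₂ e) → true⇒T (adj-flip (edge⁺ j i e)) }) }
        interior : ∀ i → i ≢ zero → i ≢ fromℕ k → p i ∈ X₁ ─ (A₁ ∪ B₁)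
        interior i i≢0 i≢k = x∈p∧x∉q⇒x∈p─q (lookup-∈ (into i)) λ q → end (x∈p∪q⁻ A₁ B₁ q)
          where
          end : p i ∈ A₁ ⊎ p i ∈ B₁ → ⊥
          end (inj₁ q) = let _ , _ , h = PathShape.endA sh in
            i≢0 (inj (trans (h _ (into i , adj-flip (A-adj q a₂∈))) (sym (h _ (into zero , ap)))))
          end (inj₂ q) = let _ , _ , h = PathShape.endB sh in
            i≢k (inj (trans (h _ (into i , adj-flip (B-adj q b₂∈))) (sym (h _ (into (fromℕ k) , bp)))))

      path-side⇒shape : IsPathSide G X₁ A₁ B₁ → PathShape W a₂ b₂
      path-side⇒shape (k , p , on , pa , pb , interior) = record
        { endA = p zero , (into zero , adj-flip (A-adj pa a₂∈)) ,
            λ v (wv , e) → let i , q = onto v wv in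
              trans (sym q) (cong p
                (A-end i (in-A₁ (lookup-∈ (into i)) a₂∈
                (subst (λ x → adj x a₂ ≡ true) (sym q) (adj-flip e)))))
        ; endB = p (fromℕ k) , (into (fromℕ k) , adj-flip (B-adj pb b₂∈)) ,
            λ v (wv , e) → let i , q = onto v wv in
              trans (sym q) (cong p
                (B-end i (in-B₁ (lookup-∈ (into i)) b₂∈
                (subst (λ x → adj x b₂ ≡ true) (sym q) (adj-flip e)))))
        ; two = λ u wu → let i , q = onto u wu in subst (λ x → Two (Nbr W a₂ b₂ x)) q (two i) }
        where
        open IsPathOn on
        into : ∀ i → W (p i) ≡ true
        into i = ∈-lookup (Equivalence.from (image (p i)) (i , refl))
        onto : ∀ v → W v ≡ true → ∃ λ i → p i ≡ v
        onto v wv = Equivalence.to (image v) (lookup-∈ wv)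
        a₂∉ : W a₂ ≡ false
        a₂∉ = ∈X₂⇒ (A₂⊆X₂ a₂∈)
        b₂∉ : W b₂ ≡ false
        b₂∉ = ∈X₂⇒ (B₂⊆X₂ b₂∈)
        outside-end : ∀ i → p i ∈ A₁ ∪ B₁ → i ≢ zero → i ≢ fromℕ k → ⊥
        outside-end i q i≢0 i≢k = proj₂ (x∈p─q⁻ (interior i i≢0 i≢k)) q
          where
          x∈p─q⁻ : ∀ {x} {S T : Subset n} → x ∈ S ─ T → x ∈ S × ¬ (x ∈ T)
          x∈p─q⁻ {x} {S} {T} m = p─q⊆p S T m , λ t → x∉ S T m t
            where
            x∉ : ∀ {m} {x} (S T : Subset m) → x ∈ S ─ T → x ∈ T → ⊥
            x∉ (s ∷ S) (true ∷ T) () Vec.here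
            x∉ (s ∷ S) (true ∷ T) (Vec.there m) (Vec.there t) = x∉ S T m t
            x∉ (s ∷ S) (false ∷ T) (Vec.there m) (Vec.there t) = x∉ S T m t
        A-end : ∀ i → p i ∈ A₁ → i ≡ zero
        A-end i q with i Fin.≟ zero | i Fin.≟ fromℕ k
        ... | yes e | _      = e
        ... | no _  | yes refl = contradiction (p i , x∈p∩q⁺ (q , pb)) A₁B₁-disjoint
        ... | no i≢0 | no i≢k = ⊥-elim (outside-end i (x∈p∪q⁺ (inj₁ q)) i≢0 i≢k)
        B-end : ∀ i → p i ∈ B₁ → i ≡ fromℕ k
        B-end i q with i Fin.≟ zero | i Fin.≟ fromℕ k
        ... | _ | yes e      = e
        ... | yes refl | no _ = contradiction (p i , x∈p∩q⁺ (pa , q)) A₁B₁-disjoint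
        ... | no i≢0 | no i≢k = ⊥-elim (outside-end i (x∈p∪q⁺ (inj₂ q)) i≢0 i≢k)
        edge⁺ : ∀ i j → toℕ j ≡ suc (toℕ i) ⊎ toℕ i ≡ suc (toℕ j) → adj (p i) (p j) ≡ true
        edge⁺ i j e = T⇒true (Equivalence.from (edges i j) e)
        -- With a₂ counted as the predecessor of the first vertex and b₂ as the successor of the
        -- last, each vertex of the path has exactly one neighbour before it and one after it.
        Before After : Fin (suc k) → Set
        Before i = ∃ λ x → Nbr W a₂ b₂ (p i) x ×
          ((x ≡ a₂ × i ≡ zero) ⊎ (∃ λ j → x ≡ p j × toℕ i ≡ suc (toℕ j)))
        After i = ∃ λ x → Nbr W a₂ b₂ (p i) x ×
          ((x ≡ b₂ × i ≡ fromℕ k) ⊎ (∃ λ j → x ≡ p j × toℕ j ≡ suc (toℕ i)))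
        before : ∀ i → Before i
        before zero = a₂ , (inj₂ (inj₁ refl) , A-adj pa a₂∈) , inj₁ (refl , refl)
        before (suc i) = p (Fin.inject₁ i) ,
          (inj₁ (into _) , edge⁺ _ _ (inj₂ e)) , inj₂ (_ , refl , e)
          where
          e : suc (toℕ i) ≡ suc (toℕ (Fin.inject₁ i))
          e = cong suc (sym (toℕ-inject₁ i))
        after : ∀ i → After i
        after i with i Fin.≟ fromℕ k
        ... | yes refl = b₂ , (inj₂ (inj₂ refl) , B-adj pb b₂∈) , inj₁ (refl , refl)
        ... | no i≢k = p j , (inj₁ (into j) , edge⁺ i j (inj₁ tj)) , inj₂ (j , refl , tj)
          where
          lt : suc (toℕ i) < suc k
          lt = s≤s (≤∧≢⇒< (≤-pred (toℕ<n i)) (λ e → i≢k (toℕ-injective (trans e (sym (toℕ-fromℕ k))))))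
          j = fromℕ< lt
          tj : toℕ j ≡ suc (toℕ i)
          tj = toℕ-fromℕ< lt
        two : ∀ i → Two (Nbr W a₂ b₂ (p i))
        two i with before i | after i
        ... | x , nx , xk | y , ny , yk = x , y , differ xk yk , nx , ny , λ v nv → which v nv xk yk
          where
          differ : ∀ {x y} → (x ≡ a₂ × i ≡ zero) ⊎ (∃ λ j → x ≡ p j × toℕ i ≡ suc (toℕ j)) →
                   (y ≡ b₂ × i ≡ fromℕ k) ⊎ (∃ λ j → y ≡ p j × toℕ j ≡ suc (toℕ i)) → x ≢ y
          differ (inj₁ (refl , _)) (inj₁ (refl , _)) e =
            A₂B₂-disjoint (a₂ , x∈p∩q⁺ (a₂∈ , subst (_∈ B₂) (sym e) b₂∈))
          differ (inj₁ (refl , _)) (inj₂ (j , refl , _)) e = true≢false (into j)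
            (trans (cong W (sym e)) a₂∉)
          differ (inj₂ (j , refl , _)) (inj₁ (refl , _)) e = true≢false (into j) (trans (cong W e) b₂∉)
          differ (inj₂ (j , refl , e₁)) (inj₂ (j′ , refl , e₂)) e =
            m≢1+m+n (toℕ j′) {1}
              (trans e₂ (cong suc (trans e₁
              (trans (cong (suc ∘ toℕ) (injective e)) (+-comm 1 (toℕ j′))))))
          which : ∀ v → Nbr W a₂ b₂ (p i) v → ∀ {x y} →
                  (x ≡ a₂ × i ≡ zero) ⊎ (∃ λ j → x ≡ p j × toℕ i ≡ suc (toℕ j)) →
                  (y ≡ b₂ × i ≡ fromℕ k) ⊎ (∃ λ j → y ≡ p j × toℕ j ≡ suc (toℕ i)) → v ≡ x ⊎ v ≡ y
          which v (inj₂ (inj₁ refl) , e) xk yk with A-end i (in-A₁ (lookup-∈ (into i)) a₂∈ e) | xk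
          ... | _    | inj₁ (x≡ , _) = inj₁ (sym x≡)
          ... | refl | inj₂ (_ , _ , ())
          which v (inj₂ (inj₂ refl) , e) xk yk with B-end i (in-B₁ (lookup-∈ (into i)) b₂∈ e) | yk
          ... | _    | inj₁ (y≡ , _) = inj₂ (sym y≡)
          ... | refl | inj₂ (j , _ , e₂) =
            contradiction (≤-trans (≤-reflexive (trans (cong suc (sym (toℕ-fromℕ k))) (sym e₂)))
              (≤-pred (toℕ<n j))) (n≮n k)
          which v (inj₁ wv , e) xk yk with onto v wv
          ... | j , refl with Equivalence.to (edges i j) (true⇒T e) | xk | yk
          ...   | inj₁ q | _ | inj₂ (j′ , refl , e₂) = inj₂ (cong p (toℕ-injective (trans q (sym e₂))))
          ...   | inj₁ q | _ | inj₁ (_ , refl) =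
            contradiction (≤-trans (≤-reflexive (trans (cong suc (sym (toℕ-fromℕ k))) (sym q)))
              (≤-pred (toℕ<n j))) (n≮n k)
          ...   | inj₂ q | inj₂ (j′ , refl , e₁) | _ = inj₁
            (cong p (toℕ-injective (Data.Nat.Properties.suc-injective (trans (sym q) e₁))))
          ...   | inj₂ () | inj₁ (_ , refl) | _

  -- The decidable counterpart of `IsNonPath2Join`: the path conditions are evaluated at the four
  -- prescribed vertices only, instead of over all splits.
  record NonPath (q : Quad n) (W : VSet n) : Set where
    open Quad q
    field
      valid  : Valid q W
      size₁  : 3 ≤ cnt W
      size₂  : 3 ≤ cnt (co W)
      no-path₁ : pathlike W a₂ b₂ ≡ false
      no-path₂ : pathlike (co W) a₁ b₁ ≡ false

  module _ (conn : Connected G) where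

    split⇒NonPath : ∀ {X₁ X₂ A₁ B₁ A₂ B₂ a₁ b₁ a₂ b₂} (sp : IsSplit G X₁ X₂ A₁ B₁ A₂ B₂) →
      ¬ IsPath2Join G X₁ X₂ → a₁ ∈ A₁ → b₁ ∈ B₁ → a₂ ∈ A₂ → b₂ ∈ B₂ → NonPath (quad a₁ b₁ a₂ b₂)
        (lookup X₁)
    split⇒NonPath {X₁} {X₂} sp np a₁∈ b₁∈ a₂∈ b₂∈ = record
      { valid = S.split-valid a₁∈ b₁∈ a₂∈ b₂∈
      ; size₁ = ≤-trans S.X₁-size (≤-reflexive (card X₁))
      ; size₂ = ≤-trans S.X₂-size (≤-reflexive (trans (card X₂) (cnt-cong S.lookup-X₂)))
      ; no-path₁ = ≢true⇒false (λ p → np (_ , _ , _ , _ , sp ,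
          inj₁ (S.shape⇒path-side a₂∈ b₂∈ conn (pathlike⁻ _ _ _ p))))
      ; no-path₂ = ≢true⇒false (λ p → np (_ , _ , _ , _ , sp ,
          inj₂ (F.shape⇒path-side a₁∈ b₁∈ conn
            (pathlike⁻ _ _ _ (trans (pathlike-cong _ _ S.lookup-X₂) p)))))
      }
      where
      module S = SplitFacts sp
      module F = SplitFacts (flip-split sp)

    -- An edge between the sides joins A₁ to A₂ or B₁ to B₂, and in the second case A and B can be
    -- exchanged. Hence any crossing edge, in particular a tree edge, may serve as a₁a₂.
    nonpath⇒NonPath : ∀ {X₁ X₂} → IsNonPath2Join G X₁ X₂ → ∀ x y → x ∈ X₁ → y ∈ X₂ → adj x y ≡ true →
                      ∃ λ b₁ → ∃ λ b₂ → NonPath (quad x b₁ y b₂) (lookup X₁)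
    nonpath⇒NonPath ((A₁ , B₁ , A₂ , B₂ , sp) , np) x y x∈ y∈ e with IsSplit.no-other sp x y x∈ y∈
      (true⇒T e)
    ... | inj₁ (p , q) = let b₁ , r = IsSplit.B₁-nonempty sp; b₂ , t = IsSplit.B₂-nonempty sp in
      b₁ , b₂ , split⇒NonPath sp np p r q t
    ... | inj₂ (p , q) = let b₁ , r = IsSplit.A₁-nonempty sp; b₂ , t = IsSplit.A₂-nonempty sp in
      b₁ , b₂ , split⇒NonPath (swap-split sp) np p r q t

    NonPath⇒nonpath : ∀ {q W} → NonPath q W → IsNonPath2Join G (tabulate W) (tabulate (co W))
    NonPath⇒nonpath {quad a₁ b₁ a₂ b₂} {W} np = (_ , _ , _ , _ , split) , not-path
      where
      open NonPath np
      open ValidFacts valid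
      A₁ = tabulate (λ u → W u ∧ adj u a₂)
      B₁ = tabulate (λ u → W u ∧ adj u b₂)
      A₂ = tabulate (λ v → co W v ∧ adj v a₁)
      B₂ = tabulate (λ v → co W v ∧ adj v b₁)
      both : ∀ {f g : VSet n} {v} → v ∈ tabulate (λ u → f u ∧ g u) → f v ≡ true × g v ≡ true
      both p = ∧-true⁻ (∈-tabulate⁻ p)
      split : IsSplit G (tabulate W) (tabulate (co W)) A₁ B₁ A₂ B₂
      split = record
        { X-cover = ⊆-antisym (⊆-max _) (λ {v} _ → cover v (W v) refl)
        ; X-disjoint = λ { (v , p) → let x , y = x∈p∩q⁻ _ _ p in
            true≢false (∈-tabulate⁻ x) (not-true⁻ (∈-tabulate⁻ y)) }
        ; A₁⊆X₁ = λ p → ∈-tabulate⁺ (proj₁ (both {W} p)) ; B₁⊆X₁ = λ p → ∈-tabulate⁺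
          (proj₁ (both {W} p))
        ; A₂⊆X₂ = λ p → ∈-tabulate⁺ (proj₁ (both {co W} p)) ; B₂⊆X₂ = λ p → ∈-tabulate⁺
          (proj₁ (both {co W} p))
        ; A₁B₁-disjoint = λ { (v , p) → let x , y = x∈p∩q⁻ _ _ p; w , e = both {W} x in not-both₁ w
          e (proj₂ (both {W} y)) }
        ; A₂B₂-disjoint = λ { (v , p) → let x , y = x∈p∩q⁻ _ _ p; w , e = both {co W} x in
            not-both₂ (not-true⁻ w) e (proj₂ (both {co W} y)) }
        ; A₁-nonempty = a₁ , ∈-tabulate⁺ (∧-true⁺ a₁∈ a₁a₂)
        ; B₁-nonempty = b₁ , ∈-tabulate⁺ (∧-true⁺ b₁∈ b₁b₂)
        ; A₂-nonempty = a₂ , ∈-tabulate⁺ (∧-true⁺ (not-true⁺ a₂∉) (adj-flip a₁a₂))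
        ; B₂-nonempty = b₂ , ∈-tabulate⁺ (∧-true⁺ (not-true⁺ b₂∉) (adj-flip b₁b₂))
        ; A-complete = λ u v p q → let wu , eu = both {W} p; wv , ev = both {co W} q in
            true⇒T (A-crossing⁺ wu (not-true⁻ wv) eu ev)
        ; B-complete = λ u v p q → let wu , eu = both {W} p; wv , ev = both {co W} q in
            true⇒T (B-crossing⁺ wu (not-true⁻ wv) eu ev)
        ; no-other = λ u v p q e → let wu = ∈-tabulate⁻ p; wv = ∈-tabulate⁻ {W = co W} q in
            Data.Sum.map (λ (x , y) → ∈-tabulate⁺ (∧-true⁺ wu x) , ∈-tabulate⁺ (∧-true⁺ wv y))
                         (λ (x , y) → ∈-tabulate⁺ (∧-true⁺ wu x) , ∈-tabulate⁺ (∧-true⁺ wv y))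
                         (crossing⁻ wu (not-true⁻ wv) (T⇒true e))
        ; X₁-size = ≤-trans size₁
          (≤-reflexive (sym (trans (card (tabulate W)) (cnt-cong (lookup∘tabulate W)))))
        ; X₂-size = ≤-trans size₂
          (≤-reflexive (sym (trans (card (tabulate (co W))) (cnt-cong (lookup∘tabulate (co W))))))
        }
        where
        cover : ∀ v b → W v ≡ b → v ∈ tabulate W ∪ tabulate (co W)
        cover v true  e = x∈p∪q⁺ (inj₁ (∈-tabulate⁺ e))
        cover v false e = x∈p∪q⁺ (inj₂ (∈-tabulate⁺ {W = co W} (not-true⁺ e)))

      no-shape₁ : ∀ {a b} → a ≡ a₂ × b ≡ b₂ ⊎ a ≡ b₂ × b ≡ a₂ → PathShape (lookup (tabulate W)) a b → ⊥
      no-shape₁ (inj₁ (refl , refl)) sh =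
        true≢false (trans (pathlike-cong a₂ b₂ (λ v → sym (lookup∘tabulate W v)))
          (pathlike⁺ _ _ _ sh)) no-path₁
      no-shape₁ (inj₂ (refl , refl)) sh = no-shape₁ (inj₁ (refl , refl)) (PathShape-swap sh)

      no-shape₂ : ∀ {a b} → a ≡ a₁ × b ≡ b₁ ⊎ a ≡ b₁ × b ≡ a₁ → PathShape (lookup (tabulate (co W)))
        a b → ⊥
      no-shape₂ (inj₁ (refl , refl)) sh =
        true≢false (trans (pathlike-cong a₁ b₁ (λ v → sym (lookup∘tabulate (co W) v)))
          (pathlike⁺ _ _ _ sh)) no-path₂
      no-shape₂ (inj₂ (refl , refl)) sh = no-shape₂ (inj₁ (refl , refl)) (PathShape-swap sh)

      -- An arbitrary split of the same partition can at most exchange A and B: if a₁a₂ and b₁b₂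
      -- were of the same kind, a₁ would be adjacent to both a₂ and b₂.
      not-path : ¬ IsPath2Join G (tabulate W) (tabulate (co W))
      not-path (A₁ , B₁ , A₂ , B₂ , sp , side) with SplitFacts.no-other sp a₁ a₂ (∈-tabulate⁺ a₁∈)
        (∈-tabulate⁺ (not-true⁺ a₂∉)) (true⇒T a₁a₂)
                                                 | SplitFacts.no-other sp b₁ b₂ (∈-tabulate⁺ b₁∈)
                                                   (∈-tabulate⁺ (not-true⁺ b₂∉)) (true⇒T b₁b₂)
      ... | inj₁ (p , _) | inj₁ (_ , q) = not-both₁ a₁∈ a₁a₂ (SplitFacts.A-adj sp p q)
      ... | inj₂ (p , _) | inj₂ (_ , q) = not-both₁ a₁∈ a₁a₂ (SplitFacts.B-adj sp p q)
      ... | inj₁ (p , q) | inj₂ (r , t) = case side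
        where
        case : _ → ⊥
        case (inj₁ s) = no-shape₁ (inj₁ (refl , refl)) (SplitFacts.path-side⇒shape sp q t s)
        case (inj₂ s) = no-shape₂ (inj₁ (refl , refl))
          (SplitFacts.path-side⇒shape (flip-split sp) p r s)
      ... | inj₂ (p , q) | inj₁ (r , t) = case side
        where
        case : _ → ⊥
        case (inj₁ s) = no-shape₁ (inj₂ (refl , refl)) (SplitFacts.path-side⇒shape sp t q s)
        case (inj₂ s) = no-shape₂ (inj₂ (refl , refl))
          (SplitFacts.path-side⇒shape (flip-split sp) r p s)

-- Branching search for a smaller non-path side

_⊆ᵇ_ : ∀ {n} → VSet n → VSet n → Set
Y ⊆ᵇ S = ∀ v → Y v ≡ true → S v ≡ true

co-anti : ∀ {n} {Y S : VSet n} → Y ⊆ᵇ S → co S ⊆ᵇ co Y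
co-anti h v p = not-true⁺ (≢true⇒false (λ y → true≢false (h v y) (not-true⁻ p)))

⊆ᵇ-antisym : ∀ {n} {Y S : VSet n} → Y ⊆ᵇ S → S ⊆ᵇ Y → ∀ v → Y v ≡ S v
⊆ᵇ-antisym {Y = Y} {S} h k v with Y v in y | S v in s
... | true  | true  = refl
... | false | false = refl
... | true  | false = ⊥-elim (true≢false (h v y) s)
... | false | true  = ⊥-elim (true≢false (k v s) y)

module Search {n : ℕ} (G : Graph n) (conn : Connected G) where
  open Graph G using (adj)
  open Paths G
  open Joins G

  -- The goal of a search below X. Properness is expressed by cardinality, which the program can
  -- count.
  record Improves (q : Quad n) (X W : VSet n) : Set where
    field
      nonPath : NonPath q W
      smaller : cnt W < cnt X
      inside  : W ⊆ᵇ X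

  passes : Quad n → VSet n → VSet n → Bool
  passes q@(quad a₁ b₁ a₂ b₂) X W =
    (((((((((W a₁ ∧ W b₁) ∧ (not (W a₂) ∧ not (W b₂))) ∧ (adj a₁ a₂ ∧ adj b₁ b₂))
    ∧ (2 <ᵇ cnt W))
    ∧ (2 <ᵇ cnt (co W)))
    ∧ (cnt W <ᵇ cnt X))
    ∧ (cnt (λ v → W v ∧ not (X v)) ≡ᵇ 0))
    ∧ (cnt (λ u → nz (cnt (λ v → (W u ∧ not (W v)) ∧ bad q u v))) ≡ᵇ 0))
    ∧ not (pathlike W a₂ b₂))
    ∧ not (pathlike (co W) a₁ b₁)

  passes⁻ : ∀ q X W → passes q X W ≡ true → Improves q X W
  passes⁻ q@(quad a₁ b₁ a₂ b₂) X W p =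
    let p , no₂ = ∧-true⁻ {_} {not (pathlike (co W) a₁ b₁)} p
        p , no₁ = ∧-true⁻ {_} {not (pathlike W a₂ b₂)} p
        p , cl = ∧-true⁻ {_} {cnt (λ u → nz (cnt (λ v → (W u ∧ not (W v)) ∧ bad q u v))) ≡ᵇ 0} p
        p , ins = ∧-true⁻ {_} {cnt (λ v → W v ∧ not (X v)) ≡ᵇ 0} p
        p , sm = ∧-true⁻ {_} {cnt W <ᵇ cnt X} p
        p , s₂ = ∧-true⁻ {_} {2 <ᵇ cnt (co W)} p
        p , s₁ = ∧-true⁻ {_} {2 <ᵇ cnt W} p
        p , e = ∧-true⁻ {(W a₁ ∧ W b₁) ∧ (not (W a₂) ∧ not (W b₂))} p
        i , o = ∧-true⁻ {W a₁ ∧ W b₁} p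
        ia , ib = ∧-true⁻ {W a₁} i
        oa , ob = ∧-true⁻ {not (W a₂)} o
        ea , eb = ∧-true⁻ {adj a₁ a₂} e
    in record
      { nonPath = record
        { valid = record
          { a₁∈ = ia ; b₁∈ = ib ; a₂∉ = not-true⁻ oa ; b₂∉ = not-true⁻ ob ; a₁a₂ = ea ; b₁b₂ = eb
          ; closed = λ u v wu wv → closed u v wu wv (cnt-zero⁻ _ (≡ᵇ-true⁻ _ 0 cl) u) }
        ; size₁ = <ᵇ-true⁻ s₁ ; size₂ = <ᵇ-true⁻ s₂
        ; no-path₁ = not-true⁻ no₁ ; no-path₂ = not-true⁻ no₂ }
      ; smaller = <ᵇ-true⁻ sm
      ; inside = λ v wv → ∧-not-false⁻ wv (cnt-zero⁻ _ (≡ᵇ-true⁻ _ 0 ins) v) }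
    where
    closed : ∀ u v → W u ≡ true → W v ≡ false →
             nz (cnt (λ v → (W u ∧ not (W v)) ∧ bad q u v)) ≡ false → bad q u v ≡ false
    closed u v wu wv z = ≢true⇒false λ b → true≢false
      (∧-true⁺ {W u ∧ not (W v)} (∧-true⁺ wu (not-true⁺ wv)) b) (cnt-zero⁻ _ (nz-false⁻ z) v)

  passes⁺ : ∀ q X W → Improves q X W → passes q X W ≡ true
  passes⁺ q@(quad a₁ b₁ a₂ b₂) X W im =
    ∧-true⁺ (∧-true⁺ (∧-true⁺ (∧-true⁺ (∧-true⁺ (∧-true⁺ (∧-true⁺ (∧-true⁺
      (∧-true⁺ (∧-true⁺ a₁∈ b₁∈) (∧-true⁺ (not-true⁺ a₂∉) (not-true⁺ b₂∉))) (∧-true⁺ a₁a₂ b₁b₂))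
      (<ᵇ-true⁺ size₁)) (<ᵇ-true⁺ size₂)) (<ᵇ-true⁺ smaller))
      (cong (_≡ᵇ 0) (cnt-zero⁺ _ (λ v → ≢true⇒false λ p → let x , y = ∧-true⁻ {W v} p in
         true≢false (inside v x) (not-true⁻ y)))))
      (cong (_≡ᵇ 0) (cnt-zero⁺ _ (λ u → cong nz (cnt-zero⁺ _ (λ v → ≢true⇒false λ p →
         let x , b = ∧-true⁻ {W u ∧ not (W v)} p; y , z = ∧-true⁻ {W u} x in
         true≢false b (closed u v y (not-true⁻ z))))))))
      (not-true⁺ no-path₁)) (not-true⁺ no-path₂)
    where
    open Improves im
    open NonPath nonPath
    open Valid valid

  Valid-cong : ∀ {q W W′} → (∀ v → W v ≡ W′ v) → Valid q W → Valid q W′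
  Valid-cong h va = record
    { a₁∈ = trans (sym (h _)) a₁∈ ; b₁∈ = trans (sym (h _)) b₁∈
    ; a₂∉ = trans (sym (h _)) a₂∉ ; b₂∉ = trans (sym (h _)) b₂∉ ; a₁a₂ = a₁a₂ ; b₁b₂ = b₁b₂
    ; closed = λ u v wu wv → closed u v (trans (h u) wu) (trans (h v) wv) }
    where open Valid va

  Improves-cong : ∀ {q X W W′} → (∀ v → W v ≡ W′ v) → Improves q X W → Improves q X W′
  Improves-cong h im = record
    { nonPath = record
      { valid = Valid-cong h valid
      ; size₁ = ≤-trans size₁ (≤-reflexive (cnt-cong h))
      ; size₂ = ≤-trans size₂ (≤-reflexive (cnt-cong (cong not ∘ h)))
      ; no-path₁ = trans (pathlike-cong _ _ (sym ∘ h)) no-path₁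
      ; no-path₂ = trans (pathlike-cong _ _ (λ v → cong not (sym (h v)))) no-path₂ }
    ; smaller = ≤-trans (s≤s (≤-reflexive (cnt-cong (sym ∘ h)))) smaller
    ; inside = λ v w → inside v (trans (h v) w) }
    where
    open Improves im
    open NonPath nonPath

  -- `path-minimal` with the explicit path replaced by the degree test; this is the only property of
  -- path sides on which the search relies.
  pathlike-rigid : ∀ {q W Y} → Valid q W → Valid q Y → Y ⊆ᵇ W → 3 ≤ cnt Y →
                   pathlike W (Quad.a₂ q) (Quad.b₂ q) ≡ true → W ⊆ᵇ Y
  pathlike-rigid {q} {W} vw vy Y⊆ 3≤ p =
    let sh = pathlike⁻ W _ _ p in path-minimal vy Y⊆ 3≤ (path-between conn sh) sh
    where open ValidFacts {Quad.a₁ q} {Quad.b₁ q} {Quad.a₂ q} {Quad.b₂ q} vw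

  -- Grown 2 q S rules out that S is a path side, by pathlike-rigid.
  Grown : ℕ → Quad n → VSet n → Set
  Grown 0             q S = ⊤
  Grown 1             q S = 3 ≤ cnt S
  Grown (suc (suc _)) q S = ∃ λ Y → Valid q Y × 3 ≤ cnt Y × Y ⊆ᵇ S × ∃ λ v → S v ≡ true × Y v ≡ false

  Grown-mono : ∀ i {q S S′} → S ⊆ᵇ S′ → Grown i q S → Grown i q S′
  Grown-mono 0             h g = tt
  Grown-mono 1             h g = ≤-trans g (cnt-mono h)
  Grown-mono (suc (suc _)) h (Y , vy , 3≤ , Y⊆ , v , sv , yv) = Y , vy , 3≤ , (λ u → h u ∘ Y⊆ u) , v
    , h v sv , yv

  two≤ : ∀ {q S} → Valid q S → 2 ≤ cnt S
  two≤ {q} {S} vs = ≤-trans (s≤s (s≤s z≤n)) (≤-reflexive (sym (trans (cnt-minus S a₁ a₁∈)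
      (cong suc (cnt-minus (S minus a₁) b₁ (minus-true⁺ S b₁∈ (a₁≢b₁ ∘ sym)))))))
    where
    open Quad q
    open ValidFacts {a₁} {b₁} {a₂} {b₂} vs

  -- A valid set has the two vertices a₁ ≠ b₁, so one new vertex makes three. At the next growth the
  -- old set itself becomes the witness Y.
  grow : ∀ i {q S S′ v} → Valid q S → S ⊆ᵇ S′ → S v ≡ false → S′ v ≡ true → Grown i q S → Grown
    (suc i) q S′
  grow 0 vs h sv sv′ g = ≤-trans (s≤s (two≤ vs)) (cnt-mono-< h _ sv sv′)
  grow 1 {S = S} vs h sv sv′ g = S , vs , g , h , _ , sv′ , sv
  grow (suc (suc i)) vs h sv sv′ g = Grown-mono 2 h g

  module _ {q X W} (im : Improves q X W) where
    open Improves im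
    open NonPath nonPath
    open Quad q

    -- S is no path side because of the witness Y inside it. Its complement contains the valid set
    -- `co W`, so if it were a path side, rigidity would give `co S` = `co W`, and `co W` is not a
    -- path side.
    improve-within : ∀ {i S} → Valid q S → S ⊆ᵇ W → Grown (2 + i) q S → Improves q X S
    improve-within {S = S} vs S⊆ (Y , vy , 3≤ , Y⊆ , v , sv , yv) = record
      { nonPath = record
        { valid = vs
        ; size₁ = ≤-trans 3≤ (cnt-mono Y⊆)
        ; size₂ = ≤-trans size₂ (cnt-mono (co-anti S⊆))
        ; no-path₁ = ≢true⇒false λ p → true≢false (pathlike-rigid vs vy Y⊆ 3≤ p v sv) yv
        ; no-path₂ = ≢true⇒false λ p → true≢false (trans (pathlike-cong a₁ b₁ (⊆ᵇ-antisym (co-anti S⊆)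
            (pathlike-rigid (Valid-opposite vs) (Valid-opposite valid) (co-anti S⊆) size₂ p))) p)
              no-path₂ }
      ; smaller = ≤-trans (s≤s (cnt-mono S⊆)) smaller
      ; inside = λ u → inside u ∘ S⊆ u }

    -- Dual to `improve-within`, except that U contains W and so does not inherit its smallness; the
    -- vertex x of X outside U supplies it.
    improve-around : ∀ {j U x} → Valid q U → W ⊆ᵇ U → U ⊆ᵇ X → X x ≡ true → U x ≡ false →
                     Grown (2 + j) (opposite q) (co U) → Improves q X U
    improve-around {U = U} {x} vu W⊆ U⊆ xx ux (Y , vy , 3≤ , Y⊆ , v , sv , yv) = record
      { nonPath = record
        { valid = vu
        ; size₁ = ≤-trans size₁ (cnt-mono W⊆)
        ; size₂ = ≤-trans 3≤ (cnt-mono Y⊆)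
        ; no-path₁ = ≢true⇒false λ p → true≢false (trans (pathlike-cong a₂ b₂ (⊆ᵇ-antisym W⊆
            (pathlike-rigid vu valid W⊆ size₁ p))) p) no-path₁
        ; no-path₂ = ≢true⇒false λ p →
            true≢false (pathlike-rigid (Valid-opposite vu) vy Y⊆ 3≤ p v sv) yv }
      ; smaller = cnt-mono-< U⊆ x ux xx
      ; inside = U⊆ }

  -- Label 1 puts a vertex in the side that is sought, label 2 outside it.

  open Worklist n using (Labelling; Steps; Steps-extend)
  open Worklist.Steps

  In NotOut : Labelling → VSet n
  In L v     = L v ≡ᵇ 1
  NotOut L v = not (L v ≡ᵇ 2)

  -- Label 1 travels along the arcs u → v with `bad q u v`, label 2 against them: a vertex inside
  -- forces its successors in, a vertex outside forces its predecessors out.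
  arcOf : Quad n → ℕ → Fin n → Fin n → Bool
  arcOf q l x u = ((l ≡ᵇ 1) ∧ bad q x u) ∨ ((l ≡ᵇ 2) ∧ bad q u x)

  Agrees : VSet n → Fin n → ℕ → Set
  Agrees W v l = l ≡ 0 ⊎ (l ≡ 1 × W v ≡ true) ⊎ (l ≡ 2 × W v ≡ false)

  -- Describes a labelling that has arisen from i inclusions and j exclusions, all made in agreement
  -- with the solution W. `dropped` remembers a vertex of X that was excluded, as `improve-around`
  -- requires.
  record Consistent (q : Quad n) (X W : VSet n) (i j : ℕ) (L : Labelling) : Set where
    open Quad q
    field
      agrees  : ∀ v → Agrees W v (L v)
      seed₁   : L a₁ ≡ 1 × L b₁ ≡ 1
      seed₂   : L a₂ ≡ 2 × L b₂ ≡ 2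
      avoids  : ∀ v → X v ≡ false → L v ≡ 2
      grown₁  : Grown i q (In L)
      grown₂  : Grown j (opposite q) (co (NotOut L))
      dropped : j ≡ 0 ⊎ ∃ λ x → X x ≡ true × L x ≡ 2

  Consistent-extend : ∀ {q X W i j L L′} → Consistent q X W i j L →
    (∀ v → L v ≢ 0 → L′ v ≡ L v) → (∀ v → Agrees W v (L′ v)) → Consistent q X W i j L′
  Consistent-extend {i = i} {j} {L} {L′} c ext ag = record
    { agrees = ag
    ; seed₁ = keep (proj₁ seed₁) (λ ()) , keep (proj₂ seed₁) (λ ())
    ; seed₂ = keep (proj₁ seed₂) (λ ()) , keep (proj₂ seed₂) (λ ())
    ; avoids = λ v p → keep (avoids v p) (λ ())
    ; grown₁ = Grown-mono i (λ v p → trans (cong (_≡ᵇ 1) (keep (≡ᵇ-true⁻ (L v) 1 p) (λ ()))) refl)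
      grown₁
    ; grown₂ = Grown-mono j
      (λ v p → not-true⁺ (not-false⁺
      (cong (_≡ᵇ 2) (keep (≡ᵇ-true⁻ (L v) 2 (not-false⁻ (not-true⁻ p))) (λ ()))))) grown₂
    ; dropped = Data.Sum.map₂ (λ (x , p , q) → x , p , keep q (λ ())) dropped }
    where
    open Consistent c
    keep : ∀ {v l} → L v ≡ l → l ≢ 0 → L′ v ≡ l
    keep {v} refl h = ext v h

  agree-1 : ∀ W {v l} → Agrees W v l → l ≡ 1 → W v ≡ true
  agree-1 W (inj₂ (inj₁ (_ , w))) e = w
  agree-1 W (inj₁ refl) ()
  agree-1 W (inj₂ (inj₂ (refl , _))) ()

  agree-2 : ∀ W {v l} → Agrees W v l → l ≡ 2 → W v ≡ false
  agree-2 W (inj₂ (inj₂ (_ , w))) e = w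
  agree-2 W (inj₁ refl) ()
  agree-2 W (inj₂ (inj₁ (refl , _))) ()

  bad-forward : ∀ {q W u v} → Valid q W → bad q u v ≡ true → W u ≡ true → W v ≡ true
  bad-forward {W = W} {u} {v} va b wu with W v in wv
  ... | true  = refl
  ... | false = ⊥-elim (true≢false b (Valid.closed va u v wu wv))

  -- A solution W is closed under the arcs, so every forced label agrees with it. Without a solution
  -- the labels may conflict; such candidates are left to the test to reject.
  Steps-agree : ∀ {q W L T L′ T′} → Valid q W → Steps (arcOf q) L T L′ T′ →
                (∀ v → Agrees W v (L v)) → ∀ v → Agrees W v (L′ v)
  Steps-agree {W = W} va (start h _) ag v = subst (Agrees W v) (sym (h v)) (ag v)
  Steps-agree {q} {W} va (step {L₁} {L₂ = L₂} x u st lx lu arc eu _ off) ag v with v Fin.≟ u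
  ... | no v≢u = subst (Agrees W v) (sym (proj₁ (off v v≢u))) (Steps-agree va st ag v)
  ... | yes refl = subst (Agrees W u) (sym eu) (new (Steps-agree va st ag x) arc)
    where
    new : ∀ {l} → Agrees W x l → arcOf q l x u ≡ true → Agrees W u l
    new (inj₁ refl) ()
    new (inj₂ (inj₁ (refl , wx))) a with ∨-true⁻ {bad q x u} a
    ... | inj₁ b = inj₂ (inj₁ (refl , bad-forward va b wx))
    new (inj₂ (inj₂ (refl , wx))) b = inj₂
      (inj₂ (refl , ≢true⇒false λ wu → true≢false (bad-forward va b wu) wx))

  module _ {q X W i j L} (im : Improves q X W) (c : Consistent q X W i j L)
           (fixed : ∀ x u → L x ≢ 0 → arcOf q (L x) x u ≡ true → L u ≢ 0) where
    open Consistent c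
    open Improves im
    open NonPath nonPath
    open Quad q

    private
      module V = Valid valid

    In⊆ : In L ⊆ᵇ W
    In⊆ v p = agree-1 W (agrees v) (≡ᵇ-true⁻ (L v) 1 p)

    ⊆NotOut : W ⊆ᵇ NotOut L
    ⊆NotOut v w = not-true⁺ (≢true⇒false λ p → true≢false w (agree-2 W (agrees v) (≡ᵇ-true⁻ (L v) 2 p)))

    NotOut⊆ : NotOut L ⊆ᵇ X
    NotOut⊆ v p with X v in xv
    ... | true  = refl
    ... | false = ⊥-elim (true≢false (cong (_≡ᵇ 2) (avoids v xv)) (not-true⁻ p))

    In-valid : Valid q (In L)
    In-valid = record
      { a₁∈ = cong (_≡ᵇ 1) (proj₁ seed₁) ; b₁∈ = cong (_≡ᵇ 1) (proj₂ seed₁)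
      ; a₂∉ = cong (_≡ᵇ 1) (proj₁ seed₂) ; b₂∉ = cong (_≡ᵇ 1) (proj₂ seed₂)
      ; a₁a₂ = V.a₁a₂ ; b₁b₂ = V.b₁b₂ ; closed = closed }
      where
      closed : ∀ u v → In L u ≡ true → In L v ≡ false → bad q u v ≡ false
      closed u v lu lv = ≢true⇒false λ b → refute b (agrees v)
        where
        lu≡1 = ≡ᵇ-true⁻ (L u) 1 lu
        refute : bad q u v ≡ true → Agrees W v (L v) → ⊥
        refute b (inj₁ l) = fixed u v (λ z → 1+n≢0 (trans (sym lu≡1) z))
          (trans (cong (λ l → arcOf q l u v) lu≡1) (∨-true⁺₁ b)) l
        refute b (inj₂ (inj₁ (l , _))) = true≢false (cong (_≡ᵇ 1) l) lv
        refute b (inj₂ (inj₂ (_ , w))) = true≢false (bad-forward valid b (In⊆ u lu)) w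

    NotOut-valid : Valid q (NotOut L)
    NotOut-valid = record
      { a₁∈ = ⊆NotOut a₁ V.a₁∈ ; b₁∈ = ⊆NotOut b₁ V.b₁∈
      ; a₂∉ = cong (not ∘ (_≡ᵇ 2)) (proj₁ seed₂) ; b₂∉ = cong (not ∘ (_≡ᵇ 2)) (proj₂ seed₂)
      ; a₁a₂ = V.a₁a₂ ; b₁b₂ = V.b₁b₂ ; closed = closed }
      where
      closed : ∀ u v → NotOut L u ≡ true → NotOut L v ≡ false → bad q u v ≡ false
      closed u v lu lv = ≢true⇒false λ b → refute b (agrees u)
        where
        lv≡2 = ≡ᵇ-true⁻ (L v) 2 (not-false⁻ lv)
        refute : bad q u v ≡ true → Agrees W u (L u) → ⊥
        refute b (inj₁ l) = fixed v u (λ z → 1+n≢0 (trans (sym lv≡2) z))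
          (trans (cong (λ l → arcOf q l v u) lv≡2) b) l
        refute b (inj₂ (inj₁ (_ , w))) =
          true≢false (bad-forward valid b w) (agree-2 W (agrees v) lv≡2)
        refute b (inj₂ (inj₂ (l , _))) = true≢false (cong (_≡ᵇ 2) l) (not-true⁻ lu)

    leaf : 3 ≤ i + j ⊎ (∀ v → L v ≢ 0) → Improves q X (In L) ⊎ Improves q X (NotOut L)
    -- A complete labelling that agrees with W is W itself.
    leaf (inj₂ decided) = inj₁ (Improves-cong same im)
      where
      same : ∀ v → W v ≡ In L v
      same v with agrees v
      ... | inj₁ l = contradiction l (decided v)
      ... | inj₂ (inj₁ (l , w)) = trans w (sym (cong (_≡ᵇ 1) l))
      ... | inj₂ (inj₂ (l , w)) = trans w (sym (cong (_≡ᵇ 1) l))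
    leaf (inj₁ 3≤) = by-size i j 3≤ grown₁ grown₂ dropped
      where
      by-size : ∀ i j → 3 ≤ i + j → Grown i q (In L) → Grown j (opposite q) (co (NotOut L)) →
                j ≡ 0 ⊎ (∃ λ x → X x ≡ true × L x ≡ 2) → Improves q X (In L) ⊎ Improves q X (NotOut L)
      by-size (suc (suc i)) j _ g₁ g₂ _ = inj₁ (improve-within im {i} In-valid In⊆ g₁)
      by-size i (suc (suc j)) _ g₁ g₂ (inj₂ (x , xx , lx)) =
        inj₂ (improve-around im {j} {x = x} NotOut-valid ⊆NotOut NotOut⊆ xx
          (not-false⁺ (cong (_≡ᵇ 2) lx)) g₂)
      by-size 0 1 (s≤s ())
      by-size 1 1 (s≤s (s≤s ()))
      by-size 1 0 (s≤s ())

    module _ {x : Fin n} {L′ : Labelling} (lx : L x ≡ 0) (off : ∀ v → v ≢ x → L′ v ≡ L v) where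

      private
        ext : ∀ v → L v ≢ 0 → L′ v ≡ L v
        ext v h = off v λ { refl → h lx }

        agrees′ : Agrees W x (L′ x) → ∀ v → Agrees W v (L′ v)
        agrees′ a v with v Fin.≟ x
        ... | yes refl = a
        ... | no v≢x = subst (Agrees W v) (sym (off v v≢x)) (agrees v)

      include : W x ≡ true → L′ x ≡ 1 → Consistent q X W (suc i) j L′
      include wx l′ = record
        { agrees = C.agrees ; seed₁ = C.seed₁ ; seed₂ = C.seed₂ ; avoids = C.avoids
        ; grown₂ = C.grown₂ ; dropped = C.dropped
        ; grown₁ = grow i In-valid
            (λ v p → cong (_≡ᵇ 1)
              (trans (ext v (λ z → 1+n≢0 (trans (sym (≡ᵇ-true⁻ (L v) 1 p)) z))) (≡ᵇ-true⁻ (L v) 1 p)))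
            (cong (_≡ᵇ 1) lx) (cong (_≡ᵇ 1) l′) grown₁ }
        where module C = Consistent (Consistent-extend c ext (agrees′ (inj₂ (inj₁ (l′ , wx)))))

      exclude : W x ≡ false → L′ x ≡ 2 → Consistent q X W i (suc j) L′
      exclude wx l′ = record
        { agrees = C.agrees ; seed₁ = C.seed₁ ; seed₂ = C.seed₂ ; avoids = C.avoids ; grown₁ = C.grown₁
        ; grown₂ = grow j (Valid-opposite NotOut-valid)
            (λ v p → not-true⁺ (not-false⁺ (cong (_≡ᵇ 2) (let l = ≡ᵇ-true⁻ (L v) 2 (not-false⁻ (not-true⁻ p)) in
               trans (ext v (λ z → 1+n≢0 (trans (sym l) z))) l))))
            (not-false⁺ (not-true⁺ (cong (_≡ᵇ 2) lx))) (not-true⁺ (not-false⁺ (cong (_≡ᵇ 2) l′))) grown₂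
        -- x was undecided and therefore lies in X, everything outside X being labelled 2.
        ; dropped = inj₂ (x , NotOut⊆ x (not-true⁺ (cong (_≡ᵇ 2) lx)) , l′) }
        where module C = Consistent (Consistent-extend c ext (agrees′ (inj₂ (inj₂ (l′ , wx)))))

-- The search program

-- Arrays 10 to 13 hold a₁, b₁, a₂, b₂; array 3 holds the current sides, array 15
-- a candidate set, 16 the outcome of its test, and 18 is set upon success.

-- Leaves bits unchanged but has degree 0, so that `set` may store a product of bits.
truth : Expr → Expr
truth e = ltE (lit 0) e

edgeE : Expr → Expr → Expr
edgeE u v = at 1 (bin plus (bin times u (var 0)) v)

badE : Expr → Expr → Expr
badE u v =
  orE (xorE (edgeE u v) (orE (andE (edgeE u (var 12)) (edgeE v (var 10)))
                             (andE (edgeE u (var 13)) (edgeE v (var 11)))))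
      (orE (andE (edgeE u (var 12)) (edgeE u (var 13))) (andE (edgeE v (var 10)) (edgeE v (var 11))))

arcE : Expr
arcE = orE (andE (eqE (at 14 (var 5)) (lit 1)) (badE (var 5) (var 8)))
           (andE (eqE (at 14 (var 5)) (lit 2)) (badE (var 8) (var 5)))

tally : Expr → Cmd
tally = count 17 7

-- For counts whose condition is itself a count. As `count` only evaluates an expression, the inner
-- counts are first turned into bits in array 19.
table : Expr → Expr → Cmd
table e f = for 8 (tally e ▸ set 19 (var 8) f)

require : Expr → Cmd
require e = set 16 (lit 0) (truth (andE (var 16) e))

endE : (Expr → Expr) → ℕ → Expr
endE member a = andE (member (var 7)) (edgeE (var a) (var 7))

degreeE : (Expr → Expr) → ℕ → ℕ → Expr
degreeE member a b =
  andE (orE (member (var 7)) (orE (eqE (var 7) (var a)) (eqE (var 7) (var b)))) (edgeE (var 8) (var 7))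

testPath : (Expr → Expr) → ℕ → ℕ → Cmd
testPath member a b =
  tally (endE member a) ▸ set 26 (lit 0) (eqE (var 17) (lit 1)) ▸
  tally (endE member b) ▸ set 26 (lit 0) (truth (andE (var 26) (eqE (var 17) (lit 1)))) ▸
  table (degreeE member a b) (truth (andE (member (var 8)) (notE (eqE (var 17) (lit 2))))) ▸
  tally (at 19 (var 7)) ▸ set 26 (lit 0) (truth (andE (var 26) (eqE (var 17) (lit 0)))) ▸
  require (notE (var 26))

in₁ in₂ : Expr → Expr
in₁ = at 15
in₂ e = notE (at 15 e)

testSeeds testSize₁ testSize₂ testSmaller testInside testClosed test : Cmd
testSeeds = set 16 (lit 0) (truth (andE
  (andE (andE (in₁ (var 10)) (in₁ (var 11))) (andE (in₂ (var 12)) (in₂ (var 13))))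
  (andE (edgeE (var 10) (var 12)) (edgeE (var 11) (var 13)))))
testSize₁ = tally (in₁ (var 7)) ▸ require (ltE (lit 2) (var 17))
testSize₂ = tally (in₂ (var 7)) ▸ require (ltE (lit 2) (var 17))
testSmaller = count 25 7 (eqE (at 3 (var 7)) (lit 1)) ▸ tally (in₁ (var 7)) ▸ require
  (ltE (var 17) (var 25))
testInside = tally (andE (in₁ (var 7)) (notE (eqE (at 3 (var 7)) (lit 1)))) ▸ require
  (eqE (var 17) (lit 0))
testClosed =
  table (andE (andE (in₁ (var 8)) (in₂ (var 7))) (badE (var 8) (var 7))) (notE (eqE (var 17) (lit 0))) ▸
  tally (at 19 (var 7)) ▸ require (eqE (var 17) (lit 0))
test = testSeeds ▸ testSize₁ ▸ testSize₂ ▸ testSmaller ▸ testInside ▸ testClosed ▸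
       testPath in₁ 12 13 ▸ testPath in₂ 10 11

accept : Cmd
-- Subtracting the bit from 2 gives label 1 to the members and label 2 to the other vertices.
accept = for 7 (set 3 (var 7) (bin monus (lit 2) (at 15 (var 7)))) ▸ set 2 (lit 0) (lit 1) ▸ set 18
  (lit 0) (lit 1)

attempt : Expr → Cmd
attempt e = for 7 (set 15 (var 7) e) ▸ test ▸ if (var 16) nop accept

-- Array `30 + d` saves the labelling during the first recursive call, and its cell n, which belongs
-- to no vertex, the branching vertex. If nothing is undecided, `find` returns n and the writes to
-- array 14 hit no vertex. After a success the search goes on, from then on relative to the smaller
-- X.
search : ℕ → Cmd
search zero = worklist arcE ▸
  attempt (eqE (at 14 (var 7)) (lit 1)) ▸ attempt (notE (eqE (at 14 (var 7)) (lit 2)))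
search (suc d) = worklist arcE ▸
  for 7 (set (30 + d) (var 7) (at 14 (var 7))) ▸
  find (eqE (at 14 (var 7)) (lit 0)) ▸
  set (30 + d) (var 0) (var 5) ▸
  set 14 (var 5) (lit 1) ▸
  search d ▸
  for 7 (set 14 (var 7) (at (30 + d) (var 7))) ▸
  set 14 (at (30 + d) (var 0)) (lit 2) ▸
  search d

sideLabel : Bool → ℕ
sideLabel b = if b then 1 else 2

-- Testing a candidate set

module Execution {n : ℕ} (G : Graph n) where
  open Graph G using (adj)
  open Paths G
  open Joins G
  open Rules n
  open Worklist n hiding (start; step)

  record Input (s : Memory) : Set where
    field
      order  : s 0 0 ≡ n
      matrix : ∀ u v → s 1 (toℕ u * n + toℕ v) ≡ bit (adj u v)

  record Base (q : Quad n) (s : Memory) : Set where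
    open Quad q
    field
      input-ok : Input s
      reg-a₁ : s 10 0 ≡ toℕ a₁
      reg-b₁ : s 11 0 ≡ toℕ b₁
      reg-a₂ : s 12 0 ≡ toℕ a₂
      reg-b₂ : s 13 0 ≡ toℕ b₂
    open Input input-ok public

  Sides : VSet n → Memory → Set
  Sides X s = ∀ v → s 3 (toℕ v) ≡ sideLabel (X v)

  keepsInput keepsBase : Cmd → Bool
  keepsInput c = unwritten 0 c ∧ unwritten 1 c
  keepsBase c = keepsInput c ∧ ((unwritten 10 c ∧ unwritten 11 c) ∧ (unwritten 12 c ∧ unwritten 13 c))

  Input-frame : ∀ c {s s′} → keepsInput c ≡ true → Frame c s s′ → Input s → Input s′
  Input-frame c k fr i =
    let k₀ , k₁ = ∧-true⁻ {unwritten 0 c} k in record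
    { order = trans (fr 0 k₀ 0) order ; matrix = λ u v → trans (fr 1 k₁ _) (matrix u v) }
    where open Input i

  Base-frame : ∀ c {q s s′} → keepsBase c ≡ true → Frame c s s′ → Base q s → Base q s′
  Base-frame c k fr b =
    let ki , kr = ∧-true⁻ {keepsInput c} k; k₁ , k₂ = ∧-true⁻ {unwritten 10 c ∧ unwritten 11 c} kr
        ka , kb = ∧-true⁻ {unwritten 10 c} k₁; kc , kd = ∧-true⁻ {unwritten 12 c} k₂ in record
    { input-ok = Input-frame c ki fr input-ok
    ; reg-a₁ = trans (fr 10 ka 0) reg-a₁ ; reg-b₁ = trans (fr 11 kb 0) reg-b₁
    ; reg-a₂ = trans (fr 12 kc 0) reg-a₂ ; reg-b₂ = trans (fr 13 kd 0) reg-b₂ }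
    where open Base b

  Base-exec : ∀ c {q s} → keepsBase c ≡ true → Base q s → Base q (exec c s)
  Base-exec c {s = s} k = Base-frame c k (exec-frame c s)

  truth-is : ∀ {e s b} → Is e s b → Is (truth e) s b
  truth-is {b = true}  (is p) = is (cong (λ x → bit (0 <ᵇ x)) p)
  truth-is {b = false} (is p) = is (cong (λ x → bit (0 <ᵇ x)) p)

  edge-is : ∀ {s e f u v} → Input s → ⟦ e ⟧ s ≡ toℕ u → ⟦ f ⟧ s ≡ toℕ v → Is (edgeE e f) s (adj u v)
  edge-is {s} {u = u} {v} i p q = is (trans
    (cong (s 1) (cong₂ _+_ (cong₂ _*_ p (Input.order i)) q)) (Input.matrix i u v))

  bad-is : ∀ {q s e f u v} → Base q s → ⟦ e ⟧ s ≡ toℕ u → ⟦ f ⟧ s ≡ toℕ v → Is (badE e f) s (bad q u v)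
  bad-is b p q =
    or-is (xor-is (edge-is i p q) (or-is (and-is (edge-is i p reg-a₂) (edge-is i q reg-a₁))
                                         (and-is (edge-is i p reg-b₂) (edge-is i q reg-b₁))))
          (or-is (and-is (edge-is i p reg-a₂) (edge-is i p reg-b₂))
                 (and-is (edge-is i q reg-a₁) (edge-is i q reg-b₁)))
    where
    open Base b
    i = input-ok

  fill-spec : ∀ a e s₀ (g : Fin n → ℕ) → (7 ≡ᵇ a) ≡ false →
              (∀ s v → Frame (for 7 (set a (var 7) e)) s₀ s → s 7 0 ≡ toℕ v → ⟦ e ⟧ s ≡ g v) →
              ∀ v → exec (for 7 (set a (var 7) e)) s₀ a (toℕ v) ≡ g v
  fill-spec a e s₀ g 7≢a e-is v =
    for-ind 7 (set a (var 7) e) (λ k s → ∀ v → toℕ v < k → s a (toℕ v) ≡ g v) s₀ (cong not 7≢a)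
      (λ _ ()) step v (toℕ<n v)
    where
    a≢7 : (a ≡ᵇ 7) ≡ false
    a≢7 = ≢⇒≡ᵇ-false a 7 λ { refl → contradiction 7≢a λ () }
    step : ∀ k s → Rules.Step n 7 (set a (var 7) e) s₀ _ k s → ∀ v → toℕ v < suc (toℕ k) →
           write (write s a (s 7 0) (⟦ e ⟧ s)) 7 0 (suc (toℕ k)) a (toℕ v) ≡ g v
    step k s st v lt = trans (write-other (write s a (s 7 0) (⟦ e ⟧ s)) 7 0 _ a (toℕ v) a≢7)
      (here (below-suc k v lt))
      where
      open Rules.Step st
      here : toℕ v < toℕ k ⊎ v ≡ k → write s a (s 7 0) (⟦ e ⟧ s) a (toℕ v) ≡ g v
      here (inj₁ lt) = trans (write-off s a (s 7 0) _ (toℕ v) (λ p → <⇒≢ lt (trans p index))) (inv v lt)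
      here (inj₂ refl) = trans (write-at s a (s 7 0) _ (toℕ v) (sym index)) (e-is s v frame index)

  sideLabel-1 : ∀ b → (sideLabel b ≡ᵇ 1) ≡ b
  sideLabel-1 true  = refl
  sideLabel-1 false = refl

  side-is : ∀ {s v b} → s 7 0 ≡ toℕ {n} v → s 3 (toℕ v) ≡ sideLabel b → Is
    (eqE (at 3 (var 7)) (lit 1)) s b
  side-is {s} {b = b} p l =
    subst (Is _ s) (sideLabel-1 b) (eq-is {e = at 3 (var 7)} (trans (cong (s 3) p) l) refl)

  record Triple (P : Memory → Set) (c : Cmd) (Q : Memory → Set) : Set where
    constructor triple
    field run : ∀ s → P s → Q (exec c s)

  seq : ∀ {P Q R c d} → Triple P c Q → Triple Q d R → Triple P (c ▸ d) R
  seq (triple f) (triple g) = triple λ s p → g _ (f s p)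

  module Testing (q : Quad n) (X W : VSet n) where
    open Quad q

    record Ctx (s : Memory) : Set where
      field
        base  : Base q s
        sides : Sides X s
        bits  : ∀ v → s 15 (toℕ v) ≡ bit (W v)

    keeps : Cmd → Bool
    keeps c = keepsBase c ∧ (unwritten 3 c ∧ unwritten 15 c)

    Ctx-frame : ∀ c {s s′} → keeps c ≡ true → Frame c s s′ → Ctx s → Ctx s′
    Ctx-frame c k fr ctx =
      let kb , k′ = ∧-true⁻ {keepsBase c} k; k₃ , k₁₅ = ∧-true⁻ {unwritten 3 c} k′ in record
      { base = Base-frame c kb fr base
      ; sides = λ v → trans (fr 3 k₃ _) (sides v) ; bits = λ v → trans (fr 15 k₁₅ _) (bits v) }
      where open Ctx ctx

    Ctx-exec : ∀ c {s} → keeps c ≡ true → Ctx s → Ctx (exec c s)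
    Ctx-exec c {s} k = Ctx-frame c k (exec-frame c s)

    in₁-is : ∀ {s e v} → Ctx s → ⟦ e ⟧ s ≡ toℕ v → Is (in₁ e) s (W v)
    in₁-is {s} {v = v} ctx p = is (trans (cong (s 15) p) (Ctx.bits ctx v))

    in₂-is : ∀ {s e v} → Ctx s → ⟦ e ⟧ s ≡ toℕ v → Is (in₂ e) s (co W v)
    in₂-is ctx p = not-is (in₁-is ctx p)

    inX-is : ∀ {s v} → Ctx s → s 7 0 ≡ toℕ v → Is (eqE (at 3 (var 7)) (lit 1)) s (X v)
    inX-is {v = v} ctx p = side-is p (Ctx.sides ctx v)

    count-is : ∀ c e g → (7 ≡ᵇ c) ≡ false → (c ≡ᵇ 7) ≡ false → unread c e ≡ true →
               (∀ s v → Ctx s → s 7 0 ≡ toℕ v → Is e s (g v)) →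
               ∀ s → Ctx s → exec (count c 7 e) s c 0 ≡ cnt g
    count-is c e g p q u e-is s ctx = count-value c 7 e s p q u
      (λ v → is-nz (e-is _ v (Ctx-exec (set 7 (lit 0) (lit (toℕ v))) refl ctx) refl))

    tally-is : ∀ e g → unread 17 e ≡ true → (∀ s v → Ctx s → s 7 0 ≡ toℕ v → Is e s (g v)) →
               ∀ s → Ctx s → exec (tally e) s 17 0 ≡ cnt g
    tally-is e g = count-is 17 e g refl refl

    table-is : ∀ e f (g : Fin n → Fin n → Bool) (h : Fin n → Bool) → unread 17 e ≡ true →
               (∀ s u v → Ctx s → s 8 0 ≡ toℕ u → s 7 0 ≡ toℕ v → Is e s (g u v)) →
               (∀ s u → Ctx s → s 8 0 ≡ toℕ u → s 17 0 ≡ cnt (g u) → Is f s (h u)) →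
               ∀ s → Ctx s → ∀ u → exec (table e f) s 19 (toℕ u) ≡ bit (h u)
    table-is e f g h u17 e-is f-is s₀ ctx u =
      for-ind 8 (tally e ▸ set 19 (var 8) f) (λ k s → ∀ u → toℕ u < k → s 19 (toℕ u) ≡ bit (h u))
        s₀ refl (λ _ ()) step u (toℕ<n u)
      where
      step : ∀ k s → Rules.Step n 8 (tally e ▸ set 19 (var 8) f) s₀ _ k s → ∀ u → toℕ u < suc (toℕ k) →
             exec (tally e ▸ set 19 (var 8) f) s 19 (toℕ u) ≡ bit (h u)
      step k s st u lt = here (below-suc k u lt)
        where
        open Rules.Step st
        ctxₛ : Ctx s
        ctxₛ = Ctx-frame (table e f) refl frame ctx
        s₁ = exec (tally e) s
        i₁ : s₁ 8 0 ≡ toℕ k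
        i₁ = trans (exec-frame (tally e) s 8 refl 0) index
        total : s₁ 17 0 ≡ cnt (g k)
        total = count-value 17 7 e s refl refl u17
          (λ v → is-nz (e-is _ k v (Ctx-exec (set 7 (lit 0) (lit (toℕ v))) refl ctxₛ) index refl))
        here : toℕ u < toℕ k ⊎ u ≡ k → write s₁ 19 (s₁ 8 0) (⟦ f ⟧ s₁) 19 (toℕ u) ≡ bit (h u)
        here (inj₁ lt) = trans (write-off s₁ 19 (s₁ 8 0) _ (toℕ u) (λ p → <⇒≢ lt (trans p i₁)))
          (trans (exec-frame (tally e) s 19 refl (toℕ u)) (inv u lt))
        here (inj₂ refl) = trans (write-at s₁ 19 (s₁ 8 0) _ (toℕ u) (sym i₁))
          (Is.value (f-is s₁ k (Ctx-exec (tally e) refl ctxₛ) i₁ total))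

    record State (x : Bool) (y : ℕ) (s : Memory) : Set where
      constructor state
      field
        ctx     : Ctx s
        outcome : s 16 0 ≡ bit x
        path    : s 26 0 ≡ y

    keepsState : Cmd → Bool
    keepsState c = keeps c ∧ (unwritten 16 c ∧ unwritten 26 c)

    State-exec : ∀ c {x y s} → keepsState c ≡ true → State x y s → State x y (exec c s)
    State-exec c {s = s} k (state ctx p r) =
      let kc , k′ = ∧-true⁻ {keeps c} k; k₁₆ , k₂₆ = ∧-true⁻ {unwritten 16 c} k′ in
      state (Ctx-exec c kc ctx) (trans (exec-unwritten c 16 k₁₆ s 0) p)
        (trans (exec-unwritten c 26 k₂₆ s 0) r)

    Counted : Bool → ℕ → ℕ → Memory → Set
    Counted x y k s = State x y s × s 17 0 ≡ k

    Rows : Bool → ℕ → (Fin n → Bool) → Memory → Set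
    Rows x y h s = State x y s × (∀ u → s 19 (toℕ u) ≡ bit (h u))

    tally-triple : ∀ {x y} e g → unread 17 e ≡ true → (∀ s v → Ctx s → s 7 0 ≡ toℕ v → Is e s (g v)) →
                   Triple (State x y) (tally e) (Counted x y (cnt g))
    tally-triple e g u e-is = triple λ s st →
      State-exec (tally e) refl st , tally-is e g u e-is s (State.ctx st)

    table-triple : ∀ {x y} e f (g : Fin n → Fin n → Bool) (h : Fin n → Bool) → unread 17 e ≡ true →
                   (∀ s u v → Ctx s → s 8 0 ≡ toℕ u → s 7 0 ≡ toℕ v → Is e s (g u v)) →
                   (∀ s u → Ctx s → s 8 0 ≡ toℕ u → s 17 0 ≡ cnt (g u) → Is f s (h u)) →
                   Triple (State x y) (table e f) (Rows x y h)
    table-triple e f g h u e-is f-is = triple λ s st →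
      State-exec (table e f) refl st , table-is e f g h u e-is f-is s (State.ctx st)

    rows-triple : ∀ {x y} h → Triple (Rows x y h) (tally (at 19 (var 7))) (Counted x y (cnt h))
    rows-triple h = triple λ s (st , rows) →
      State-exec (tally (at 19 (var 7))) refl st ,
      count-value 17 7 (at 19 (var 7)) s refl refl refl (λ v → trans (cong nz (rows v)) (nz-bit (h v)))

    require-triple : ∀ {P x y e b} → (∀ s → P s → State x y s × Is e s b) → Triple P (require e)
      (State (x ∧ b) y)
    require-triple {e = e} h = triple λ s p → let state c o r , i = h s p in
      state (Ctx-exec (require e) refl c) (Is.value (truth-is (and-is {e = var 16} (is o) i))) r

    path-triple : ∀ {x y k f b} → (∀ s → Counted x y k s → Is f s b) →
                  Triple (Counted x y k) (set 26 (lit 0) f) (State x (bit b))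
    path-triple {f = f} h = triple λ s p → let state c o r , i = p in
      state (Ctx-exec (set 26 (lit 0) f) refl c) o (Is.value (h s p))

    -- Tests compose because each one conjoins its outcome to cell 16, whatever that holds; the
    -- existential forgets the scratch value in cell 26.
    Checks : Cmd → Bool → Set
    Checks c b = ∀ {x y} → Triple (State x y) c (λ s → ∃ λ y′ → State (x ∧ b) y′ s)

    some : ∀ {x y c P} → Triple P c (State x y) → Triple P c (λ s → ∃ λ y′ → State x y′ s)
    some t = triple λ s p → _ , Triple.run t s p

    counted-is : ∀ {x y k s} e {l} → Counted x y k s → ⟦ e ⟧ s ≡ l → Is (eqE (var 17) e) s (k ≡ᵇ l)
    counted-is e (_ , t) p = eq-is {e = var 17} {e} t p

    size-triple : ∀ {x y k} → Triple (Counted x y k) (require (ltE (lit 2) (var 17)))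
      (State (x ∧ (2 <ᵇ k)) y)
    size-triple = require-triple (λ s (st , t) → st , lt-is {e = lit 2} {var 17} refl t)

    none-triple : ∀ {x y k} → Triple (Counted x y k) (require (eqE (var 17) (lit 0)))
      (State (x ∧ (k ≡ᵇ 0)) y)
    none-triple = require-triple (λ s c → proj₁ c , counted-is (lit 0) c refl)

    size₁-checks : Checks testSize₁ (2 <ᵇ cnt W)
    size₁-checks = some (seq (tally-triple (in₁ (var 7)) W refl (λ s v c e → in₁-is c e)) size-triple)

    size₂-checks : Checks testSize₂ (2 <ᵇ cnt (co W))
    size₂-checks = some (seq (tally-triple (in₂ (var 7)) (co W) refl (λ s v c e → in₂-is c e))
      size-triple)

    smaller-checks : Checks testSmaller (cnt W <ᵇ cnt X)
    smaller-checks {x} {y} = some (seq {Q = λ s → State x y s × s 25 0 ≡ cnt X}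
      (triple λ s st → State-exec (count 25 7 (eqE (at 3 (var 7)) (lit 1))) refl st ,
         count-is 25 (eqE (at 3 (var 7)) (lit 1)) X refl refl refl (λ s v c e → inX-is c e) s
           (State.ctx st))
      (seq {Q = λ s → Counted x y (cnt W) s × s 25 0 ≡ cnt X}
        (triple λ s (st , t) → Triple.run
          (tally-triple (in₁ (var 7)) W refl (λ s v c e → in₁-is c e)) s st ,
           trans (exec-frame (tally (in₁ (var 7))) s 25 refl 0) t)
        (require-triple (λ s ((st , t) , t′) → st , lt-is {e = var 17} {var 25} t t′))))

    inside-checks : Checks testInside (cnt (λ v → W v ∧ not (X v)) ≡ᵇ 0)
    inside-checks = some
      (seq (tally-triple (andE (in₁ (var 7)) (notE (eqE (at 3 (var 7)) (lit 1)))) _ refl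
      (λ s v c i → and-is (in₁-is c i) (not-is (inX-is c i)))) none-triple)

    closed-checks : Checks testClosed (cnt (λ u → nz (cnt (λ v → (W u ∧ not (W v)) ∧ bad q u v))) ≡ᵇ 0)
    closed-checks = some (seq
      (table-triple (andE (andE (in₁ (var 8)) (in₂ (var 7))) (badE (var 8) (var 7)))
        (notE (eqE (var 17) (lit 0)))
         (λ u v → (W u ∧ not (W v)) ∧ bad q u v) _ refl
         (λ s u v c i j → and-is (and-is (in₁-is c i) (in₂-is c j))
           (bad-is {e = var 8} {var 7} (Ctx.base c) i j))
         (λ s u c i t → not-is (eq-is {e = var 17} {lit 0} t refl)))
      (seq (rows-triple _) none-triple))

    path-checks : ∀ member (M : VSet n) a b α β →
      (∀ {s e v} → Ctx s → ⟦ e ⟧ s ≡ toℕ v → Is (member e) s (M v)) →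
      (∀ {s} → Ctx s → s a 0 ≡ toℕ α) → (∀ {s} → Ctx s → s b 0 ≡ toℕ β) →
      unread 17 (endE member a) ≡ true → unread 17 (endE member b) ≡ true →
      unread 17 (degreeE member a b) ≡ true → Checks (testPath member a b) (not (pathlike M α β))
    path-checks member M a b α β member-is a-is b-is ua ub ud = some (
      seq (tally-triple (endE member a) (λ v → M v ∧ adj α v) ua
        (λ s v c i → and-is (member-is c i)
          (edge-is {e = var a} {var 7} (Base.input-ok (Ctx.base c)) (a-is c) i))) (
      seq (path-triple (λ s c → counted-is (lit 1) c refl)) (
      seq (tally-triple (endE member b) (λ v → M v ∧ adj β v) ub
        (λ s v c i → and-is (member-is c i)
          (edge-is {e = var b} {var 7} (Base.input-ok (Ctx.base c)) (b-is c) i))) (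
      seq (path-triple (λ s c → truth-is
        (and-is {e = var 26} (is (State.path (proj₁ c))) (counted-is (lit 1) c refl)))) (
      seq (table-triple (degreeE member a b)
        (truth (andE (member (var 8)) (notE (eqE (var 17) (lit 2)))))
        (λ u v → (M v ∨ (eqF v α ∨ eqF v β)) ∧ adj u v) _ ud
        (λ s u v c i j → and-is (or-is (member-is c j)
           (or-is (eq-is {e = var 7} {var a} j (a-is c)) (eq-is {e = var 7} {var b} j (b-is c))))
           (edge-is {e = var 8} {var 7} (Base.input-ok (Ctx.base c)) i j))
        (λ s u c i k → truth-is
          (and-is (member-is {e = var 8} c i) (not-is (eq-is {e = var 17} {lit 2} k refl))))) (
      seq (rows-triple _) (
      seq (path-triple (λ s c → truth-is
        (and-is {e = var 26} (is (State.path (proj₁ c))) (counted-is (lit 0) c refl))))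
      (require-triple (λ s st → st , not-is {e = var 26} (is (State.path st)))))))))))

    also : ∀ {c d x b} {P : Memory → Set} → Triple P c (λ s → ∃ λ y → State x y s) → Checks d b →
           Triple P (c ▸ d) (λ s → ∃ λ y → State (x ∧ b) y s)
    also t u = triple λ s p → let y , st = Triple.run t s p in Triple.run u _ st

    -- Commands associate to the right, whereas the conjunction in `passes` associates to the left.
    reassoc : ∀ {c d e P Q} → Triple P ((c ▸ d) ▸ e) Q → Triple P (c ▸ (d ▸ e)) Q
    reassoc t = triple (Triple.run t)

    open Search

    seeds-triple : Triple Ctx testSeeds (λ s → ∃ λ y →
      State (((W a₁ ∧ W b₁) ∧ (not (W a₂) ∧ not (W b₂))) ∧ (adj a₁ a₂ ∧ adj b₁ b₂)) y s)
    seeds-triple = triple λ s c → let open Base (Ctx.base c) in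
      _ , state (Ctx-exec testSeeds refl c)
        (Is.value (truth-is {s = s} (and-is
          (and-is (and-is (in₁-is {e = var 10} c reg-a₁) (in₁-is {e = var 11} c reg-b₁))
            (and-is (in₂-is {e = var 12} c reg-a₂) (in₂-is {e = var 13} c reg-b₂)))
          (and-is (edge-is {e = var 10} {var 12} input-ok reg-a₁ reg-a₂)
            (edge-is {e = var 11} {var 13} input-ok reg-b₁ reg-b₂)))))
        refl

    test-triple : (conn : Connected G) → Triple Ctx test (λ s → ∃ λ y → State (passes G conn q X W) y s)
    test-triple conn =
      reassoc (reassoc (reassoc (reassoc (reassoc (reassoc
        (also (also (also (also
          (also (also (also seeds-triple size₁-checks) size₂-checks) smaller-checks)
          inside-checks) closed-checks)
          (path-checks in₁ W 12 13 a₂ b₂ in₁-is (λ c → Base.reg-a₂ (Ctx.base c))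
            (λ c → Base.reg-b₂ (Ctx.base c)) refl refl refl))
          (path-checks in₂ (co W) 10 11 a₁ b₁ in₂-is (λ c → Base.reg-a₁ (Ctx.base c))
            (λ c → Base.reg-b₁ (Ctx.base c)) refl refl refl)))))))

-- For a variable depth the frame condition of the recursively defined search does not compute, so
-- induction replaces `refl`.
unwritten-search : ∀ b d → (b ≡ᵇ 5) ≡ false → (b ≡ᵇ 7) ≡ false → (b ≡ᵇ 14) ≡ false →
                   unwritten b (worklist arcE) ≡ true → unwritten b (search 0) ≡ true →
                   (∀ e → e < d → (b ≡ᵇ (30 + e)) ≡ false) → unwritten b (search d) ≡ true
unwritten-search b zero    h₅ h₇ h₁₄ w z h = z
unwritten-search b (suc d) h₅ h₇ h₁₄ w z h
  rewrite unwritten-search b d h₅ h₇ h₁₄ w z (λ e lt → h e (m≤n⇒m≤1+n lt))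
        | w | h d ≤-refl | h₅ | h₇ | h₁₄ = refl

-- A search of depth d saves only in the arrays `30 + e` with e < d, so the labels saved one level
-- above survive it.
unwritten-saved : ∀ d → unwritten (30 + d) (search d) ≡ true
unwritten-saved d = unwritten-search (30 + d) d refl refl refl refl refl
  (λ e lt → ≢⇒≡ᵇ-false (30 + d) (30 + e) λ p → <⇒≢ lt (sym (+-cancelˡ-≡ 30 d e p)))

-- Correctness of the search

module Searching {n : ℕ} (G : Graph n) (conn : Connected G) where
  open Graph G using (adj)
  open Paths G
  open Joins G
  open Rules n
  open Worklist n hiding (start; step)
  open Execution G
  open Search G conn

  keepsBase-search : ∀ d → keepsBase (search d) ≡ true
  keepsBase-search d = ∧-true⁺
    (∧-true⁺ (un 0 refl refl refl refl refl (λ _ _ → refl))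
    (un 1 refl refl refl refl refl (λ _ _ → refl)))
    (∧-true⁺ (∧-true⁺ (un 10 refl refl refl refl refl (λ _ _ → refl))
      (un 11 refl refl refl refl refl (λ _ _ → refl)))
             (∧-true⁺ (un 12 refl refl refl refl refl (λ _ _ → refl))
               (un 13 refl refl refl refl refl (λ _ _ → refl))))
    where
    un : ∀ b → _ → _ → _ → _ → _ → _ → unwritten b (search d) ≡ true
    un b = unwritten-search b d

  record Better (X X′ : VSet n) : Set where
    field
      nonPath : ∃ λ q → NonPath q X′
      smaller : cnt X′ < cnt X
      inside  : X′ ⊆ᵇ X

  Better-trans : ∀ {X X′ X″} → Better X X′ → Better X′ X″ → Better X X″
  Better-trans b c = record
    { nonPath = Better.nonPath c ; smaller = <-trans (Better.smaller c) (Better.smaller b)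
    ; inside = λ v → Better.inside b v ∘ Better.inside c v }

  record Moved (X : VSet n) (s : Memory) : Set where
    field
      {X′}    : VSet n
      sides   : Sides X′ s
      better  : Better X X′
      verdict₁ : s 2 0 ≡ 1
      flag    : s 18 0 ≡ 1

  record Kept (s s′ : Memory) : Set where
    constructor kept
    field
      sides   : ∀ (v : Fin n) → s′ 3 (toℕ v) ≡ s 3 (toℕ v)
      verdictₛ : s′ 2 0 ≡ s 2 0
      flag    : s′ 18 0 ≡ s 18 0

  Kept-trans : ∀ {s s′ s″} → Kept s s′ → Kept s′ s″ → Kept s s″
  Kept-trans (kept a b c) (kept d e f) = kept (λ v → trans (d v) (a v)) (trans e b) (trans f c)

  Kept-frame : ∀ c {s s′} → unwritten 3 c ∧ (unwritten 2 c ∧ unwritten 18 c) ≡ true → Frame c s s′ →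
    Kept s s′
  Kept-frame c k fr =
    let k₃ , k′ = ∧-true⁻ {unwritten 3 c} k; k₂ , k₁₈ = ∧-true⁻ {unwritten 2 c} k′ in
    kept (λ v → fr 3 k₃ _) (fr 2 k₂ 0) (fr 18 k₁₈ 0)

  Sides-kept : ∀ {X s s′} → Kept s s′ → Sides X s → Sides X s′
  Sides-kept k h v = trans (Kept.sides k v) (h v)

  Result : VSet n → Memory → Memory → Set → Set
  Result X s s′ F = Moved X s′ ⊎ (Kept s s′ × F)

  Result-after : ∀ {X s s₁ s₂ F} → Kept s s₁ → Result X s₁ s₂ F → Result X s s₂ F
  Result-after k (inj₁ m)        = inj₁ m
  Result-after k (inj₂ (k′ , f)) = inj₂ (Kept-trans k k′ , f)

  -- If the first part has moved X, the second runs relative to the new set, and its failure report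
  -- is dropped, the whole being a success already. The reports are combined only if both parts
  -- fail, and then they concern the same X.
  Result-then : ∀ {X s s₁ s₂ F} {F₂ : VSet n → Set} → Sides X s → Result X s s₁ F →
                (∀ X′ → Sides X′ s₁ → Result X′ s₁ s₂ (F₂ X′)) → Result X s s₂ (F × F₂ X)
  Result-then si (inj₁ m) next with next (Moved.X′ m) (Moved.sides m)
  ... | inj₁ m′ = inj₁
    (record { sides = Moved.sides m′ ; better = Better-trans (Moved.better m) (Moved.better m′)
                               ; verdict₁ = Moved.verdict₁ m′ ; flag = Moved.flag m′ })
  ... | inj₂ (k , _) = inj₁ (record { sides = Sides-kept k (Moved.sides m) ; better = Moved.better m
                                    ; verdict₁ = trans (Kept.verdictₛ k) (Moved.verdict₁ m)
                                    ; flag = trans (Kept.flag k) (Moved.flag m) })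
  Result-then si (inj₂ (k , f)) next with next _ (Sides-kept k si)
  ... | inj₁ m = inj₁ m
  ... | inj₂ (k′ , f₂) = inj₂ (Kept-trans k k′ , f , f₂)

  Result-map : ∀ {X s s′ F F′} → (F → F′) → Result X s s′ F → Result X s s′ F′
  Result-map h (inj₁ m)       = inj₁ m
  Result-map h (inj₂ (k , f)) = inj₂ (k , h f)

  -- Fixing the initial memory lets `bind` name the intermediate memories and hand on their frame
  -- conditions.
  Does : Memory → Cmd → (Memory → Set) → Set
  Does s₀ = Triple (_≡ s₀)

  bind : ∀ {s₀ c d Q R} → Does s₀ c Q → (∀ s → Frame c s₀ s → Q s → Does s d R) → Does s₀ (c ▸ d) R
  bind {c = c} (triple f) g = triple λ
    { s refl → Triple.run (g (exec c s) (exec-frame c s) (f s refl)) _ refl }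

  outcome : ∀ {s₀ c} {Q : Memory → Set} → Q (exec c s₀) → Does s₀ c Q
  outcome p = triple λ { _ refl → p }

  from : ∀ {P Q s₀ c} → Triple P c Q → P s₀ → Does s₀ c Q
  from (triple f) p = triple λ { _ refl → f _ p }

  if-does : ∀ {s₀ e c d Q} → (nz (⟦ e ⟧ s₀) ≡ false → Does s₀ c Q) →
    (nz (⟦ e ⟧ s₀) ≡ true → Does s₀ d Q) →
            Does s₀ (if e c d) Q
  if-does {s₀} {e} {c} {d} {Q} f g = triple λ { _ refl →
    if-elim e c d s₀ Q (λ z → Triple.run (f z) s₀ refl) (λ z → Triple.run (g z) s₀ refl) }

  weaken : ∀ {P Q R : Memory → Set} {c} → (∀ {s} → Q s → R s) → Triple P c Q → Triple P c R
  weaken h (triple f) = triple λ s p → h (f s p)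

  module _ (q : Quad n) where

    attempt-does : ∀ e X W s₀ → Base q s₀ → Sides X s₀ →
      (∀ s v → s 14 (toℕ v) ≡ s₀ 14 (toℕ v) → s 7 0 ≡ toℕ v → Is e s (W v)) →
      Does s₀ (attempt e) (λ s → Result X s₀ s (¬ Improves q X W))
    attempt-does e X W s₀ b si e-is =
      bind {c = fill} {Q = Ctx} (outcome {c = fill} ctx) λ s₁ fr₁ c₁ →
      bind (from (test-triple conn) c₁) λ s₂ fr₂ (_ , st) →
      if-does
        (λ z → outcome {c = nop}
          (inj₂ (Kept-trans (Kept-frame fill refl fr₁) (Kept-frame test refl fr₂) , λ im →
           true≢false (passes⁺ q X W im)
             (trans (sym (is-nz {e = var 16} {s₂} (is (State.outcome st)))) z))))
        (λ z → outcome {c = accept} (inj₁ (accepted s₂ (State.ctx st)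
           (passes⁻ q X W (trans (sym (is-nz {e = var 16} {s₂} (is (State.outcome st)))) z)))))
      where
      open Testing q X W
      fill = for 7 (set 15 (var 7) e)
      ctx : Ctx (exec fill s₀)
      ctx = record
        { base = Base-exec fill refl b
        ; sides = λ v → trans (exec-frame fill s₀ 3 refl _) (si v)
        ; bits = fill-spec 15 e s₀ _ refl (λ s v fr i → Is.value (e-is s v (fr 14 refl _) i)) }
      accepted : ∀ s → Ctx s → Improves q X W → Moved X (exec accept s)
      accepted s c im = record
        { sides = fill-spec 3 (bin monus (lit 2) (at 15 (var 7))) s _ refl (λ s′ v fr i →
            trans (cong (2 ∸_) (trans (cong (s′ 15) i) (trans (fr 15 refl _) (Ctx.bits c v))))
              (label (W v)))
        ; better = record { nonPath = q , Improves.nonPath im ; smaller = Improves.smaller im ;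
          inside = Improves.inside im }
        ; verdict₁ = refl ; flag = refl }
        where
        label : ∀ b → 2 ∸ bit b ≡ sideLabel b
        label true  = refl
        label false = refl

    attempt-any : ∀ e W s₀ → Base q s₀ →
      (∀ s v → s 14 (toℕ v) ≡ s₀ 14 (toℕ v) → s 7 0 ≡ toℕ v → Is e s (W v)) →
      Does s₀ (attempt e) (λ s → ∀ X → Sides X s₀ → Result X s₀ s (¬ Improves q X W))
    attempt-any e W s₀ b e-is = triple λ
      { _ refl X si → Triple.run (attempt-does e X W s₀ b si e-is) s₀ refl }

    Fixed : Labelling → Set
    Fixed L = ∀ x u → L x ≢ 0 → arcOf q (L x) x u ≡ true → L u ≢ 0

    record Propagated (s₀ s : Memory) : Set where
      field
        base  : Base q s
        keeps : Kept s₀ s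
        steps : Steps (arcOf q) (row 14 s₀) (row 6 s₀) (row 14 s) (row 6 s)
        fixed : Fixed (row 14 s)

    propagate-does : ∀ s₀ → Base q s₀ → Does s₀ (worklist arcE) (Propagated s₀)
    propagate-does s₀ b = outcome {c = worklist arcE} (record
      { base = Base-exec (worklist arcE) refl b
      ; keeps = Kept-frame (worklist arcE) refl (exec-frame (worklist arcE) s₀)
      ; steps = proj₁ spec ; fixed = proj₂ spec })
      where
      arc-is : ∀ s x u → Frame (worklist arcE) s₀ s → s 5 0 ≡ toℕ x → s 8 0 ≡ toℕ u →
               Is arcE s (arcOf q (row 14 s x) x u)
      arc-is s x u fr i j = or-is
        (and-is (eq-is {e = at 14 (var 5)} {lit 1} (cong (s 14) i) refl)
          (bad-is {e = var 5} {var 8} bs i j))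
        (and-is (eq-is {e = at 14 (var 5)} {lit 2} (cong (s 14) i) refl)
          (bad-is {e = var 8} {var 5} bs j i))
        where
        bs : Base q s
        bs = Base-frame (worklist arcE) refl fr b
      spec = worklist-spec arcE s₀ (Base.order b) (arcOf q) arc-is

    -- A failed search of depth d excludes only those solutions for which the d remaining branchings
    -- bring the number of decisions to three, or for which nothing is undecided.
    Dead : ℕ → VSet n → Labelling → Set
    Dead d X L = ∀ {W i j} → Improves q X W → Consistent q X W i j L → 3 ≤ i + j + d ⊎
      (∀ v → L v ≢ 0) → ⊥

    propagated-consistent : ∀ {s₀ s X W i j} → Propagated s₀ s → Improves q X W →
      Consistent q X W i j (row 14 s₀) → Consistent q X W i j (row 14 s)
    propagated-consistent p im c = Consistent-extend c (Steps-extend steps)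
      (Steps-agree (NonPath.valid (Improves.nonPath im)) steps (Consistent.agrees c))
      where open Propagated p

    propagated-progress : ∀ {s₀ s} {A : Set} → Propagated s₀ s → A ⊎ (∀ v → row 14 s₀ v ≢ 0) → A ⊎
      (∀ v → row 14 s v ≢ 0)
    propagated-progress p = Data.Sum.map₂ λ h v l → h v
      (trans (sym (Steps-extend (Propagated.steps p) v (h v))) l)

    -- The cell x is a number, not a vertex: if `find` fails, x is n and no label changes.
    Updated : Labelling → ℕ → ℕ → Labelling → Set
    Updated L x l L′ = (∀ v → toℕ v ≡ x → L′ v ≡ l) × (∀ v → toℕ v ≢ x → L′ v ≡ L v)

    unless-labelled : ∀ {A : Set} {L : Labelling} {x} → A ⊎ (∀ v → L v ≢ 0) → L x ≡ 0 → A
    unless-labelled (inj₁ a) _ = a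
    unless-labelled {x = x} (inj₂ h) lx = contradiction lx (h x)

    -- A solution W either contains the vertex x on which the search branches or avoids it.
    Dead-branch : ∀ {d X L L₁ L₂ x} → Fixed L → Found (λ v → L v ≡ᵇ 0) x →
                  Updated L x 1 L₁ → Updated L x 2 L₂ → Dead d X L₁ → Dead d X L₂ → Dead (suc d) X L
    -- No vertex is undecided, so the first recursive search starts from a complete labelling and
    -- already refutes W.
    Dead-branch {L = L} fx (inj₁ (refl , none)) (_ , off) _ dead₁ _ {W} im c _ =
      dead₁ im (Consistent-extend c (λ v _ → same v)
        (λ v → subst (Agrees W v) (sym (same v)) (Consistent.agrees c v)))
        (inj₂ λ v l → true≢false (cong (_≡ᵇ 0) (trans (sym (same v)) l)) (none v))
      where
      same : ∀ v → _
      same v = off v (<⇒≢ (toℕ<n v))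
    Dead-branch {d} {L = L} fx (inj₂ (x , refl , lx)) (on₁ , off₁) (on₂ , off₂) dead₁ dead₂ {W} {i}
      {j} im c pr with W x in wx
    ... | true  = dead₁ im
      (include im c fx (≡ᵇ-true⁻ (L x) 0 lx) (λ v v≢x → off₁ v (toℕ-≢ v≢x)) wx (on₁ x refl))
                    (inj₁ (subst (3 ≤_) (+-suc (i + j) d) (unless-labelled pr (≡ᵇ-true⁻ (L x) 0 lx))))
    ... | false = dead₂ im
      (exclude im c fx (≡ᵇ-true⁻ (L x) 0 lx) (λ v v≢x → off₂ v (toℕ-≢ v≢x)) wx (on₂ x refl))
                    (inj₁ (subst (3 ≤_) (trans (+-suc (i + j) d) (cong (_+ d) (sym (+-suc i j))))
                      (unless-labelled pr (≡ᵇ-true⁻ (L x) 0 lx))))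

    update-does : ∀ e l s₀ {x} → ⟦ e ⟧ s₀ ≡ x →
                  Does s₀ (set 14 e (lit l)) (λ s → Updated (row 14 s₀) x l (row 14 s))
    update-does e l s₀ {x} ex = triple λ { _ refl →
      (λ v p → write-at s₀ 14 (⟦ e ⟧ s₀) l (toℕ v) (trans p (sym ex))) ,
      (λ v p → write-off s₀ 14 (⟦ e ⟧ s₀) l (toℕ v) (λ z → p (trans z ex))) }

    Updated-cong : ∀ {L M x l L′} → (∀ v → M v ≡ L v) → Updated M x l L′ → Updated L x l L′
    Updated-cong h (on , off) = on , λ v p → trans (off v p) (h v)

    Searched : ℕ → Memory → Memory → Set
    Searched d s₀ s = ∀ X → Sides X s₀ → Result X s₀ s (Dead d X (row 14 s₀))

    search-does : ∀ d s₀ → Base q s₀ → Does s₀ (search d) (Searched d s₀)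
    search-does zero s₀ b =
      bind (propagate-does s₀ b) λ s₁ fr₁ p →
      bind (attempt-any e₁ (In (row 14 s₁)) s₁ (Propagated.base p)
           (λ s v l i → eq-is {e = at 14 (var 7)} {lit 1} (trans (cong (s 14) i) l) refl)) λ s₂ fr₂ r₁ →
      weaken (conclude p r₁) (attempt-any e₂ (NotOut (row 14 s₁)) s₂
           (Base-frame (attempt e₁) refl fr₂ (Propagated.base p))
           (λ s v l i → not-is (eq-is {e = at 14 (var 7)} {lit 2}
             (trans (cong (s 14) i) (trans l (fr₂ 14 refl _))) refl)))
      where
      e₁ = eqE (at 14 (var 7)) (lit 1)
      e₂ = notE (eqE (at 14 (var 7)) (lit 2))
      conclude : ∀ {s₁ s₂ s} → Propagated s₀ s₁ →
        (∀ X → Sides X s₁ → Result X s₁ s₂ (¬ Improves q X (In (row 14 s₁)))) →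
        (∀ X → Sides X s₂ → Result X s₂ s (¬ Improves q X (NotOut (row 14 s₁)))) → Searched 0 s₀ s
      conclude {s₁} {s₂} {s} p r₁ r₂ X si =
        Result-after keeps (Result-map none (Result-then si₁ (r₁ X si₁) r₂))
        where
        open Propagated p
        si₁ = Sides-kept keeps si
        none : ¬ Improves q X (In (row 14 s₁)) × ¬ Improves q X (NotOut (row 14 s₁)) → Dead 0 X
          (row 14 s₀)
        none (no₁ , no₂) {i = i} {j} im c pr =
          [ no₁ , no₂ ]′ (leaf im (propagated-consistent p im c) fixed
            (Data.Sum.map₁ (subst (3 ≤_) (+-identityʳ (i + j))) (propagated-progress p pr)))
    search-does (suc d) s₀ b =
      bind (propagate-does s₀ b) λ s₁ fr₁ p →
      bind (outcome {c = save} (fill-spec a (at 14 (var 7)) s₁ (row 14 s₁) refl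
              (λ s v fr i → trans (cong (s 14) i) (fr 14 refl _)))) λ s₂ fr₂ saved →
      bind (outcome {c = pick} (find-spec (eqE (at 14 (var 7)) (lit 0)) s₂
              (trans (fr₂ 0 refl 0) (Base.order (Propagated.base p))) (λ v → row 14 s₁ v ≡ᵇ 0)
              (λ s v fr i → eq-is {e = at 14 (var 7)} {lit 0}
                (trans (cong (s 14) i) (trans (fr 14 refl _) (fr₂ 14 refl _))) refl)))
        λ s₃ fr₃ found →
      bind (outcome {c = remember} {Q = λ s → s a n ≡ s₃ 5 0 × (∀ v → s a (toℕ v) ≡ row 14 s₁ v)}
              (remembered s₁ s₂ s₃ fr₂ fr₃ saved p)) λ s₄ fr₄ (savedx , saved₄) →
      bind (update-does (var 5) 1 s₄ (fr₄ 5 refl 0)) λ s₅ fr₅ up₁ →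
      let k₅ = Kept-trans (Propagated.keeps p) (Kept-trans (Kept-frame save refl fr₂) (Kept-trans (Kept-frame pick refl fr₃)
                 (Kept-trans (Kept-frame remember refl fr₄)
                   (Kept-frame (set 14 (var 5) (lit 1)) refl fr₅))))
          b₅ = Base-frame (set 14 (var 5) (lit 1)) refl fr₅ (Base-frame remember refl fr₄
                 (Base-frame pick refl fr₃ (Base-frame save refl fr₂ (Propagated.base p))))
      in bind (search-does d s₅ b₅) λ s₆ fr₆ r₁ →
      bind (outcome {c = restore} (fill-spec 14 (at a (var 7)) s₆ (row 14 s₁) refl
              (λ s v fr i → trans (cong (s a) i) (trans (fr a refl _)
                (trans (fr₆ a (unwritten-saved d) _) (trans (fr₅ a refl _) (saved₄ v))))))) λ s₇ fr₇
                  restored →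
      bind (update-does (at a (var 0)) 2 s₇
        (trans (fr₇ a refl _) (trans (fr₆ a (unwritten-saved d) _) (trans (fr₅ a refl _)
              (trans (cong (s₄ a) (trans (fr₇ 0 refl 0)
                (Base.order (Base-frame (search d) (keepsBase-search d) fr₆ b₅)))) savedx)))))
        λ s₈ fr₈ up₂ →
      let b₈ = Base-frame (set 14 (at a (var 0)) (lit 2)) refl fr₈ (Base-frame restore refl fr₇
                 (Base-frame (search d) (keepsBase-search d) fr₆ b₅))
          k₈ = Kept-trans (Kept-frame restore refl fr₇)
            (Kept-frame (set 14 (at a (var 0)) (lit 2)) refl fr₈)
      in weaken (conclude p found
        (Updated-cong (λ v → trans (fr₄ 14 refl _) (trans (fr₃ 14 refl _) (fr₂ 14 refl _))) up₁)
                   (Updated-cong restored up₂) k₅ r₁ k₈)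
           (search-does d s₈ b₈)
      where
      a = 30 + d
      save = for 7 (set a (var 7) (at 14 (var 7)))
      pick = find (eqE (at 14 (var 7)) (lit 0))
      remember = set a (var 0) (var 5)
      restore = for 7 (set 14 (var 7) (at a (var 7)))
      remembered : ∀ s₁ s₂ s₃ → Frame save s₁ s₂ → Frame pick s₂ s₃ →
        (∀ v → s₂ a (toℕ v) ≡ row 14 s₁ v) →
                   Propagated s₀ s₁ →
                   exec remember s₃ a n ≡ s₃ 5 0 × (∀ v → exec remember s₃ a (toℕ v) ≡ row 14 s₁ v)
      remembered s₁ s₂ s₃ fr₂ fr₃ saved p =
        write-at s₃ a (s₃ 0 0) (s₃ 5 0) n (sym order₃) ,
        λ v → trans (write-off s₃ a (s₃ 0 0) (s₃ 5 0) (toℕ v) (λ z → <⇒≢ (toℕ<n v) (trans z order₃)))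
                    (trans (fr₃ a refl _) (saved v))
        where
        order₃ : s₃ 0 0 ≡ n
        order₃ = trans (fr₃ 0 refl 0) (trans (fr₂ 0 refl 0) (Base.order (Propagated.base p)))
      conclude : ∀ {s₁ s₅ s₆ s₈ s x} → Propagated s₀ s₁ → Found (λ v → row 14 s₁ v ≡ᵇ 0) x →
                 Updated (row 14 s₁) x 1 (row 14 s₅) → Updated (row 14 s₁) x 2 (row 14 s₈) →
                 Kept s₀ s₅ → Searched d s₅ s₆ → Kept s₆ s₈ → Searched d s₈ s → Searched (suc d) s₀ s
      conclude {s₅ = s₅} {s₈ = s₈} p found up₁ up₂ k₅ r₁ k₈ r₂ X si = Result-after k₅ (Result-map dead
        (Result-then (Sides-kept k₅ si) (r₁ X (Sides-kept k₅ si))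
           (λ X′ si₆ → Result-after k₈ (r₂ X′ (Sides-kept k₈ si₆)))))
        where
        dead : Dead d X (row 14 s₅) × Dead d X (row 14 s₈) → Dead (suc d) X (row 14 s₀)
        dead (dead₁ , dead₂) im c pr = Dead-branch (Propagated.fixed p) found up₁ up₂ dead₁ dead₂ im
          (propagated-consistent p im c) (propagated-progress p pr)

-- Each side of a 2-join is separated from the other by an edge of any spanning
-- tree, so a₁a₂ may be assumed to join a vertex to its tree parent.

grow-tree : Cmd
grow-tree = set 14 (lit 0) (lit 1) ▸ worklist (edgeE (var 5) (var 8)) ▸
  -- Later propagations overwrite array 6, so the parents are moved to array 27. The last loop makes
  -- X all of V.
  for 7 (set 27 (var 7) (at 6 (var 7))) ▸ for 7 (set 3 (var 7) (lit 1))

seedLabels round : Cmd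
seedLabels =
  for 7 (set 14 (var 7) (bin times (lit 2) (notE (eqE (at 3 (var 7)) (lit 1))))) ▸
  set 14 (var 10) (lit 1) ▸ set 14 (var 11) (lit 1) ▸ set 14 (var 12) (lit 2) ▸ set 14 (var 13) (lit 2)
round = set 18 (lit 0) (lit 0) ▸ seedLabels ▸ search 3 ▸ set 23 (lit 0) (notE (var 18))

-- Repeats `c` until it fails, in the form of a loop of n rounds: after a failure cell 23 makes the
-- remaining rounds idle. Since each success removes a vertex from X, n rounds are enough.
descend : Cmd → Cmd
descend c = set 23 (lit 0) (lit 0) ▸ for 24 (if (var 23) c nop)

module Tree {n : ℕ} (G : Graph n) (conn : Connected G) where
  open Graph G using (adj)
  open Paths G
  open Rules n
  open Worklist n
  open Execution G
  open Searching G conn using (Does; bind; outcome)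

  input-Input : Input (input G)
  input-Input = record { order = refl ; matrix = cell }
    where
    cell : ∀ u v → matrixCell G (toℕ u * n + toℕ v) ≡ bit (adj u v)
    cell u v with (toℕ u * n + toℕ v) <? n * n
    ... | yes p = cong bit
      (trans (cong (λ i → uncurry adj (remQuot n i)) same) (cong (uncurry adj) (remQuot-combine u v)))
      where
      same : fromℕ< p ≡ combine u v
      same = toℕ-injective (trans (toℕ-fromℕ< p)
        (trans (cong (_+ toℕ v) (*-comm (toℕ u) n)) (sym (toℕ-combine u v))))
    ... | no ¬p = contradiction
      (≤-trans (≤-reflexive (cong suc (trans (cong (_+ toℕ v) (*-comm (toℕ u) n))
                    (sym (toℕ-combine u v))))) (toℕ<n (combine u v))) ¬p

  Crossing : (Fin n → Fin n) → VSet n → Set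
  Crossing par W = ∃ λ v → adj v (par v) ≡ true × W v ≢ W (par v)

  record Planted (par : Fin n → Fin n) (s : Memory) : Set where
    field
      input-ok  : Input s
      parents   : ∀ v → s 27 (toℕ v) ≡ toℕ (par v)
      all-in    : ∀ (v : Fin n) → s 3 (toℕ v) ≡ 1
      undecided : s 2 0 ≡ 0
      crossing  : ∀ W x y → W x ≡ true → W y ≡ false → Crossing par W

  treeArc : ℕ → Fin n → Fin n → Bool
  treeArc _ x u = adj x u

  module _ {L₀ L T : Labelling} (root : Fin n) (at-root : ∀ v → L₀ v ≢ 0 → v ≡ root)
    (L₀-root : L₀ root ≢ 0)
           (steps : Steps treeArc L₀ (λ _ → 0) L T) (closed : ∀ x u → L x ≢ 0 → adj x u ≡ true → L u ≢ 0) where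

    parent-of : ∀ {L T} → Steps treeArc L₀ (λ _ → 0) L T → ∀ v → ∃ λ p → T v ≡ toℕ {n} p
    -- Entries of array 6 are 0 at first, which names vertex 0. The root keeps this entry and is its
    -- own parent, so it never contributes a `Crossing`.
    parent-of (start _ h) v = fromℕ< 0<n , trans (h v) (sym (toℕ-fromℕ< 0<n))
      where
      0<n : 0 < n
      0<n = ≤-trans (s≤s z≤n) (toℕ<n v)
    parent-of (step x u st _ _ _ _ tu off) v with v Fin.≟ u
    ... | yes refl = x , tu
    ... | no v≢u = let p , e = parent-of st v in p , trans (proj₂ (off v v≢u)) e

    all-labelled : ∀ v → L v ≢ 0
    all-labelled v l with exit (λ u → nz (L u)) (conn root v ∈⊤ ∈⊤)
                       (nz-true⁺ (λ e → L₀-root (trans (sym (Steps-extend steps root L₀-root)) e)))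
                       (cong nz l)
    ... | x , u , lx , lu , xu = closed x u (nz-true⁻ lx) xu (nz-false⁻ lu)

    Separated : VSet n → Labelling → Labelling → Set
    Separated W L T = ∃ λ v → ∃ λ p → L v ≢ 0 × T v ≡ toℕ p × adj p v ≡ true × W v ≢ W p

    -- Induction on the trace: if a newly labelled vertex and its labeller x lie on different sides,
    -- their tree edge separates; otherwise the argument continues from x.
    separated : ∀ W {L T} → Steps treeArc L₀ (λ _ → 0) L T → ∀ v → L v ≢ 0 → W v ≡ W root ⊎
      Separated W L T
    separated W (start h _) v lv = inj₁ (cong W (at-root v (λ e → lv (trans (h v) e))))
    separated W {L′} {T′} (step {L₁} {T₁} x u st lx lu xu eu tu off) v lv = case (v Fin.≟ u)
      where
      keep : Separated W L₁ T₁ → Separated W L′ T′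
      keep (w , p , lw , tw , r) =
        w , p , (λ e → lw (trans (sym (proj₁ (off w w≢u))) e)) , trans (proj₂ (off w w≢u)) tw , r
        where
        w≢u : w ≢ u
        w≢u refl = lw lu
      case : Dec (v ≡ u) → W v ≡ W root ⊎ Separated W L′ T′
      case (no v≢u) = Data.Sum.map₂ keep (separated W st v (λ e → lv (trans (proj₁ (off v v≢u)) e)))
      case (yes refl) with W v Data.Bool.≟ W x
      ... | no differ = inj₂ (v , x , (λ e → lx (trans (sym eu) e)) , tu , xu , differ)
      ... | yes same = Data.Sum.map (trans same) keep (separated W st x lx)

    tree-crossing : ∀ W x y → W x ≡ true → W y ≡ false → Crossing (λ v → proj₁ (parent-of steps v)) W
    tree-crossing W x y wx wy =
      case (separated W steps x (all-labelled x)) (separated W steps y (all-labelled y))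
      where
      found : Separated W L T → Crossing (λ v → proj₁ (parent-of steps v)) W
      found (v , p , _ , tv , pv , differ) with toℕ-injective
        (trans (sym tv) (proj₂ (parent-of steps v)))
      ... | refl = v , adj-flip pv , differ
      case : W x ≡ W root ⊎ Separated W L T → W y ≡ W root ⊎ Separated W L T → Crossing _ W
      case (inj₂ r) _        = found r
      case (inj₁ _) (inj₂ r) = found r
      case (inj₁ p) (inj₁ q) = ⊥-elim (true≢false wx (trans p (trans (sym q) wy)))

  grow-tree-does : Does (input G) grow-tree (λ s → ∃ λ par → Planted par s)
  grow-tree-does =
    bind (outcome {c = set 14 (lit 0) (lit 1)} {Q = λ s → (∀ j → j ≢ 0 → s 14 j ≡ 0) × s 14 0 ≡ 1}
           ((λ j j≢0 → write-off (input G) 14 0 1 j j≢0) , refl)) λ s₁ fr₁ (off , on) →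
    bind (outcome {c = worklist arc}
      {Q = λ s → Steps treeArc (row 14 s₁) (row 6 s₁) (row 14 s) (row 6 s) ×
             (∀ x u → row 14 s x ≢ 0 → adj x u ≡ true → row 14 s u ≢ 0)}
               (worklist-spec arc s₁ (trans (fr₁ 0 refl 0) refl) treeArc
           (λ s x u fr i j → edge-is {e = var 5} {var 8}
              (Input-frame (worklist arc) refl fr
                (Input-frame (set 14 (lit 0) (lit 1)) refl fr₁ input-Input)) i j)))
      λ s₂ fr₂ (steps , closed) →
    bind (outcome {c = for 7 (set 27 (var 7) (at 6 (var 7)))}
      (fill-spec 27 (at 6 (var 7)) s₂ (row 6 s₂) refl
           (λ s v fr i → trans (cong (s 6) i) (fr 6 refl _)))) λ s₃ fr₃ copied →
    outcome {c = for 7 (set 3 (var 7) (lit 1))} (finish s₁ s₂ s₃ fr₁ off on fr₂ steps closed fr₃ copied)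
    where
    arc = edgeE (var 5) (var 8)
    ones = for 7 (set 3 (var 7) (lit 1))
    finish : ∀ s₁ s₂ s₃ → Frame (set 14 (lit 0) (lit 1)) (input G) s₁ → (∀ j → j ≢ 0 → s₁ 14 j ≡ 0)
      → s₁ 14 0 ≡ 1 →
      Frame (worklist arc) s₁ s₂ → Steps treeArc (row 14 s₁) (row 6 s₁) (row 14 s₂) (row 6 s₂) →
      (∀ x u → row 14 s₂ x ≢ 0 → adj x u ≡ true → row 14 s₂ u ≢ 0) →
      Frame (for 7 (set 27 (var 7) (at 6 (var 7)))) s₂ s₃ → (∀ v → s₃ 27 (toℕ v) ≡ row 6 s₂ v) →
      ∃ λ par → Planted par (exec ones s₃)
    finish s₁ s₂ s₃ fr₁ off on fr₂ steps closed fr₃ copied = par , record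
      { input-ok = Input-frame ones refl (exec-frame ones s₃)
        (Input-frame (for 7 (set 27 (var 7) (at 6 (var 7)))) refl fr₃
          (Input-frame (worklist arc) refl fr₂
            (Input-frame (set 14 (lit 0) (lit 1)) refl fr₁ input-Input)))
      ; parents = λ v → trans (exec-frame ones s₃ 27 refl _) (trans (copied v) (is-parent v))
      ; all-in = fill-spec 3 (lit 1) s₃ (λ _ → 1) refl (λ _ _ _ _ → refl)
      ; undecided = trans (exec-frame ones s₃ 2 refl 0)
        (trans (fr₃ 2 refl 0) (trans (fr₂ 2 refl 0) (fr₁ 2 refl 0)))
      ; crossing = crossing }
      where
      -- The vertex v witnesses that n is positive; without it there is no root.
      module _ (v : Fin n) where
        0<n : 0 < n
        0<n = ≤-trans (s≤s z≤n) (toℕ<n v)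
        root : Fin n
        root = fromℕ< 0<n
        root-0 : toℕ root ≡ 0
        root-0 = toℕ-fromℕ< 0<n
        at-root : ∀ u → row 14 s₁ u ≢ 0 → u ≡ root
        at-root u h with toℕ u ≟ 0
        ... | yes e = toℕ-injective (trans e (sym root-0))
        ... | no e  = contradiction (off (toℕ u) e) h
        L₀-root : row 14 s₁ root ≢ 0
        L₀-root e = 1+n≢0 (trans (sym on) (trans (cong (s₁ 14) (sym root-0)) e))
      steps₀ : Steps treeArc (row 14 s₁) (λ _ → 0) (row 14 s₂) (row 6 s₂)
      steps₀ = restart steps
        where
        restart : ∀ {L T} → Steps treeArc (row 14 s₁) (row 6 s₁) L T → Steps treeArc (row 14 s₁)
          (λ _ → 0) L T
        restart (start p q) = start p (λ v → trans (q v) (fr₁ 6 refl _))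
        restart (step x u st a b c d e f) = step x u (restart st) a b c d e f
      parent : ∀ v → ∃ λ p → row 6 s₂ v ≡ toℕ p
      parent v = parent-of (root v) (at-root v) (L₀-root v) steps₀ closed steps₀ v
      par : Fin n → Fin n
      par v = proj₁ (parent v)
      is-parent : ∀ v → row 6 s₂ v ≡ toℕ (par v)
      is-parent v = proj₂ (parent v)
      crossing : ∀ W x y → W x ≡ true → W y ≡ false → Crossing par W
      crossing W x y wx wy =
        let v , e , d = tree-crossing (root x) (at-root x) (L₀-root x) steps₀ closed W x y wx wy
            -- The parent does not depend on the vertex that witnessed the root, since both versions
            -- equal the same memory cell.
            same = toℕ-injective
              (trans (sym (proj₂ (parent-of (root x) (at-root x) (L₀-root x) steps₀ closed steps₀
              v))) (is-parent v))
        in v , subst (λ p → adj v p ≡ true) same e , subst (λ p → W v ≢ W p) same d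

-- The whole program

setQuad : Expr → Expr → Expr → Expr → Cmd
setQuad e f g h = set 10 (lit 0) e ▸ set 11 (lit 0) f ▸ set 12 (lit 0) g ▸ set 13 (lit 0) h

orient : Cmd → Expr → Expr → Expr → Expr → Cmd
orient c e f g h = setQuad e f g h ▸ descend c

parentE : Expr
parentE = at 27 (var 20)

-- The tree edge and the edge ij can each be directed in two ways, which gives four quads. The scan
-- passes over non-edges in constant time, so its n³ rounds cost O(n³) besides the searches.
orientations scan : Cmd → Cmd
orientations c =
  orient c (var 20) (var 21) parentE (var 22) ▸ orient c (var 20) (var 22) parentE (var 21) ▸
  orient c parentE (var 21) (var 20) (var 22) ▸ orient c parentE (var 22) (var 20) (var 21)
scan c = for 20 (for 21
  (for 22 (if (andE (ltE (var 21) (var 22)) (edgeE (var 21) (var 22))) nop (orientations c))))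

-- One round: seeding the labels and searching

module Rounds {n : ℕ} (G : Graph n) (conn : Connected G) where
  open Graph G using (adj)
  open Paths G
  open Joins G
  open Rules n
  open TimeBound n
  open Worklist n using (row; Labelling)
  open Execution G
  open Search G conn
  open Searching G conn

  Exhausted : Quad n → VSet n → Set
  Exhausted q X = ∀ W → ¬ Improves q X W

  Exhausted-shrink : ∀ {q X X′} → Better X X′ → Exhausted q X → Exhausted q X′
  Exhausted-shrink b ex W im = ex W (record
    { nonPath = Improves.nonPath im ; smaller = <-trans (Improves.smaller im) (Better.smaller b)
    ; inside = λ v → Better.inside b v ∘ Improves.inside im v })

  updated-agrees : ∀ {W L x l L′} → (∀ v → Agrees W v (L v)) → ∀ q → Updated q L (toℕ x) l L′ →
    Agrees W x l →
                   ∀ v → Agrees W v (L′ v)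
  updated-agrees {W} {L} {x} ag q (on , off) a v with v Fin.≟ x
  ... | yes refl = subst (Agrees W v) (sym (on v refl)) a
  ... | no v≢x   = subst (Agrees W v) (sym (off v (toℕ-≢ v≢x))) (ag v)

  updated-keeps : ∀ q {L : Labelling} {x l L′ v} → Updated q L x l L′ → L v ≡ l → L′ v ≡ l
  updated-keeps q {x = x} {v = v} (on , off) e with toℕ v ≟ x
  ... | yes p = on v p
  ... | no p  = trans (off v p) e

  updated-off : ∀ q {L : Labelling} {x l L′ v} → Updated q L (toℕ x) l L′ → v ≢ x → L′ v ≡ L v
  updated-off q {v = v} (on , off) p = off v (toℕ-≢ p)

  module _ (q : Quad n) where
    open Quad q

    -- Conditional on a solution: if a seed a₁ or b₁ coincides with a₂ or b₂ or lies outside X, the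
    -- writes conflict, but then there is no W with which the labelling would have to be consistent.
    Seeded : VSet n → Labelling → Set
    Seeded X L = ∀ W → Improves q X W → Consistent q X W 0 0 L

    seeded : ∀ {X L₀ L₁ L₂ L₃ L₄} → (∀ v → L₀ v ≡ 2 * bit (not (X v))) →
             Updated q L₀ (toℕ a₁) 1 L₁ → Updated q L₁ (toℕ b₁) 1 L₂ →
             Updated q L₂ (toℕ a₂) 2 L₃ → Updated q L₃ (toℕ b₂) 2 L₄ → Seeded X L₄
    seeded {X} {L₀} {L₁} {L₂} {L₃} {L₄} l₀ u₁ u₂ u₃ u₄ W im = record
      { agrees = updated-agrees
        (updated-agrees (updated-agrees (updated-agrees ag₀ q u₁ (inj₂ (inj₁ (refl , a₁∈))))
          q u₂ (inj₂ (inj₁ (refl , b₁∈)))) q u₃ (inj₂ (inj₂ (refl , a₂∉)))) q u₄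
            (inj₂ (inj₂ (refl , b₂∉)))
      ; seed₁ = outer a₁∈ (updated-keeps q u₂ (proj₁ u₁ a₁ refl)) , outer b₁∈ (proj₁ u₂ b₁ refl)
      ; seed₂ = updated-keeps q u₄ (proj₁ u₃ a₂ refl) , proj₁ u₄ b₂ refl
      ; avoids = λ v xv → updated-keeps q u₄ (updated-keeps q u₃
          (trans (updated-off q u₂ (differ b₁∈ xv)) (trans (updated-off q u₁ (differ a₁∈ xv))
            (trans (l₀ v) (cong (λ b → 2 * bit (not b)) xv)))))
      ; grown₁ = tt ; grown₂ = tt ; dropped = inj₁ refl }
      where
      open Improves im
      open NonPath nonPath
      open Valid valid
      ag₀ : ∀ v → Agrees W v (L₀ v)
      ag₀ v with X v in xv
      ... | true  = inj₁ (trans (l₀ v) (cong (λ b → 2 * bit (not b)) xv))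
      ... | false = inj₂ (inj₂
        (trans (l₀ v) (cong (λ b → 2 * bit (not b)) xv) , ≢true⇒false
        (λ w → true≢false (inside v w) xv)))
      outer : ∀ {v} → W v ≡ true → L₂ v ≡ 1 → L₄ v ≡ 1
      outer w e = trans (updated-off q u₄ λ { refl → true≢false w b₂∉ })
                 (trans (updated-off q u₃ λ { refl → true≢false w a₂∉ }) e)
      differ : ∀ {v x} → W x ≡ true → X v ≡ false → v ≢ x
      differ {x = x} w xv refl = true≢false (inside x w) xv

    Rounded : VSet n → Memory → Memory → Set
    Rounded X s₀ s = (Moved X s × s 23 0 ≡ 0) ⊎
      (Sides X s × s 2 0 ≡ s₀ 2 0 × Exhausted q X × s 23 0 ≡ 1)

    seedLabels-does : ∀ X s₀ → Base q s₀ → Sides X s₀ → Does s₀ seedLabels (λ s → Seeded X (row 14 s))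
    seedLabels-does X s₀ b si =
      bind (outcome {c = fill} {Q = λ s → ∀ v → row 14 s v ≡ 2 * bit (not (X v))}
        (fill-spec 14 (bin times (lit 2) (notE (eqE (at 3 (var 7)) (lit 1)))) s₀
              (λ v → 2 * bit (not (X v))) refl
                (λ s v fr i → cong (2 *_)
                (Is.value (not-is (side-is {s} {v} i (trans (fr 3 refl _) (si v)))))))) λ s₁ fr₁ l₀ →
      bind (update-does q (var 10) 1 s₁ (trans (fr₁ 10 refl 0) (Base.reg-a₁ b))) λ s₂ fr₂ u₁ →
      bind (update-does q (var 11) 1 s₂
        (trans (fr₂ 11 refl 0) (trans (fr₁ 11 refl 0) (Base.reg-b₁ b)))) λ s₃ fr₃ u₂ →
      bind (update-does q (var 12) 2 s₃
        (trans (fr₃ 12 refl 0) (trans (fr₂ 12 refl 0) (trans (fr₁ 12 refl 0) (Base.reg-a₂ b))))) λ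
        s₄ fr₄ u₃ →
      weaken (λ u₄ → seeded l₀ u₁ u₂ u₃ u₄)
        (update-does q (var 13) 2 s₄
          (trans (fr₄ 13 refl 0)
          (trans (fr₃ 13 refl 0) (trans (fr₂ 13 refl 0) (trans (fr₁ 13 refl 0) (Base.reg-b₂ b))))))
      where fill = for 7 (set 14 (var 7) (bin times (lit 2) (notE (eqE (at 3 (var 7)) (lit 1)))))

    round-does : ∀ X s₀ → Base q s₀ → Sides X s₀ → Does s₀ round (Rounded X s₀)
    round-does X s₀ b si =
      bind (outcome {c = set 18 (lit 0) (lit 0)} {Q = λ s → s 18 0 ≡ 0} refl) λ s₁ fr₁ flag →
      let b₁ = Base-frame (set 18 (lit 0) (lit 0)) refl fr₁ b
          si₁ : Sides X s₁
          si₁ = λ v → trans (fr₁ 3 refl _) (si v)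
      in bind (seedLabels-does X s₁ b₁ si₁) λ s₂ fr₂ seeds →
      bind (search-does q 3 s₂ (Base-frame seedLabels refl fr₂ b₁)) λ s₃ fr₃ searched →
      outcome {c = set 23 (lit 0) (notE (var 18))}
        (finish s₃ (searched X (λ v → trans (fr₂ 3 refl _) (si₁ v))) seeds
          (trans (fr₂ 18 refl 0) flag) (trans (fr₂ 2 refl 0) (fr₁ 2 refl 0))
            (λ v → trans (fr₂ 3 refl _) (si₁ v)))
      where
      finish : ∀ {s₂} s₃ → Result X s₂ s₃ (Dead q 3 X (row 14 s₂)) → Seeded X (row 14 s₂) → s₂ 18 0
        ≡ 0 →
               s₂ 2 0 ≡ s₀ 2 0 → Sides X s₂ → Rounded X s₀ (exec (set 23 (lit 0) (notE (var 18))) s₃)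
      finish s₃ (inj₁ m) seeds _ _ _ = inj₁
        (record { sides = Moved.sides m ; better = Moved.better m ; verdict₁ = Moved.verdict₁ m ;
          flag = Moved.flag m } ,
         cong (λ x → bit (x ≡ᵇ 0)) (Moved.flag m))
      finish s₃ (inj₂ (k , dead)) seeds flag verd si₂ = inj₂
        (Sides-kept k si₂ , trans (Kept.verdictₛ k) verd ,
          (λ W im → dead im (seeds W im) (inj₁ (s≤s (s≤s (s≤s z≤n))))) ,
         cong (λ x → bit (x ≡ᵇ 0)) (trans (Kept.flag k) flag))

  -- An interface through which the amortised analysis treats a round as an abstract command of
  -- abstract cost, without unfolding the concrete search.
  record RoundSpec (c : Cmd) (C : ℕ) : Set where
    field
      does    : ∀ q X s → Base q s → Sides X s → Rounded q X s (exec c s)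
      within  : ∀ s → time c s ≤ C
      keeps-base : keepsBase c ≡ true
      keeps-20 : unwritten 20 c ≡ true
      keeps-21 : unwritten 21 c ≡ true
      keeps-22 : unwritten 22 c ≡ true
      keeps-24 : unwritten 24 c ≡ true
      keeps-27 : unwritten 27 c ≡ true

  round-spec : ∀ {σ d} → size round ≡ σ → loopDepth round ≡ d → RoundSpec round (σ * N ^ d)
  round-spec refl refl = record
    { does = λ q X s b si → Triple.run (round-does q X s b si) s refl ; within = time≤ round
    ; keeps-base = refl ; keeps-20 = refl ; keeps-21 = refl ; keeps-22 = refl ; keeps-24 = refl ;
      keeps-27 = refl }

-- Descent for one quad and its amortised cost

module Descent {n : ℕ} (G : Graph n) (conn : Connected G) (par : Fin n → Fin n)
               (c : Cmd) (roundCost : ℕ) (spec : Rounds.RoundSpec G conn c roundCost) where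
  open Graph G using (adj)
  open Paths G
  open Joins G
  open Rules n
  open TimeBound n
  open Worklist n using (row; Labelling)
  open Execution G
  open Search G conn
  open Searching G conn
  open Rounds G conn
  open RoundSpec spec

  Status : VSet n → Memory → Set
  Status X s = (s 2 0 ≡ 0 × (∀ v → X v ≡ true)) ⊎ (s 2 0 ≡ 1 × ∃ λ q → NonPath q X)

  -- `D` collects the quads handled so far. It grows during the scan while X shrinks; by
  -- `Exhausted-shrink` the failures recorded in `dead` survive both.
  record Inv (D : Quad n → Set) (s : Memory) : Set where
    field
      input-ok : Input s
      parents  : ∀ v → s 27 (toℕ v) ≡ toℕ (par v)
      {X}      : VSet n
      sides    : Sides X s
      status   : Status X s
      dead     : ∀ q → D q → Exhausted q X

  keepsInv : Cmd → Bool
  keepsInv c = keepsInput c ∧ (unwritten 27 c ∧ (unwritten 3 c ∧ unwritten 2 c))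

  Inv-exec : ∀ c {D s} → keepsInv c ≡ true → Inv D s → Inv D (exec c s)
  Inv-exec c {s = s} k i =
    let ki , k′ = ∧-true⁻ {keepsInput c} k; kp , k″ = ∧-true⁻ {unwritten 27 c} k′; k₃ , k₂ = ∧-true⁻ {unwritten 3 c} k″ in record
    { input-ok = Input-frame c ki (exec-frame c s) input-ok
    ; parents = λ v → trans (exec-frame c s 27 kp _) (parents v)
    ; sides = λ v → trans (exec-frame c s 3 k₃ _) (sides v)
    ; status = Data.Sum.map (λ (p , r) → trans (exec-frame c s 2 k₂ 0) p , r)
      (λ (p , r) → trans (exec-frame c s 2 k₂ 0) p , r) status
    ; dead = dead }
    where open Inv i

  Inv-weaken : ∀ {D D′ s} → (∀ q → D′ q → D q) → Inv D s → Inv D′ s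
  Inv-weaken h i = record
    { input-ok = input-ok ; parents = parents ; sides = sides ; status = status ; dead = λ q d →
      dead q (h q d) }
    where open Inv i

  record Costs (Φ : Memory → ℕ) (P : Memory → Set) (c : Cmd) (Q : Memory → Set) (B : ℕ) : Set where
    constructor costs
    field run : ∀ s → P s → Q (exec c s) × time c s + Φ (exec c s) ≤ Φ s + B

  seq-costs : ∀ {Φ P Q R c d A B} → Costs Φ P c Q A → Costs Φ Q d R B → Costs Φ P (c ▸ d) R (A + B)
  seq-costs {Φ} {c = c} {d} {A} {B} (costs f) (costs g) = costs λ s p →
    let q , t = f s p; r , u = g _ q in r , (begin
      time c s + time d (exec c s) + Φ (exec d (exec c s))   ≡⟨ +-assoc (time c s) _ _ ⟩
      time c s + (time d (exec c s) + Φ (exec d (exec c s))) ≤⟨ +-monoʳ-≤ (time c s) u ⟩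
      time c s + (Φ (exec c s) + B)                          ≡⟨ +-assoc (time c s) _ _ ⟨
      time c s + Φ (exec c s) + B                            ≤⟨ +-monoˡ-≤ B t ⟩
      Φ s + A + B                                            ≡⟨ +-assoc (Φ s) A B ⟩
      Φ s + (A + B)                                          ∎)
    where open ≤-Reasoning

  loop-costs : ∀ {Φ} i c (I : ℕ → Memory → Set) b → unwritten i c ≡ true →
    (∀ s x → Φ (write s i 0 x) ≡ Φ s) →
    (∀ k s x → I k s → I k (write s i 0 x)) →
    (∀ k → Costs Φ (λ s → s i 0 ≡ toℕ k × I (toℕ k) s) c (I (suc (toℕ k))) (b (toℕ k))) →
    Costs Φ (I 0) (for i c) (I n) (9 + loopSum b 0 n)
  loop-costs {Φ} i c I b i∉c Φ-index I-index body = costs λ s p →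
    for-ind i c I s i∉c (I-index 0 s 0 p) step ,
    for-time i c I s i∉c (I-index 0 s 0 p) step Φ b Φ-index
      (λ k s st → proj₂ (Costs.run (body k) s (Rules.Step.index st , Rules.Step.inv st)))
    where
    step : ∀ {s₀} k s → Rules.Step n i c s₀ I k s → I (suc (toℕ k)) (write (exec c s) i 0 (suc (toℕ k)))
    step k s st = I-index _ _ _ (proj₁ (Costs.run (body k) s (Rules.Step.index st , Rules.Step.inv st)))

  branch-cost : ∀ e (t Φ′ Φ₀ B : ℕ) → t + Φ′ ≤ Φ₀ + B → 1 + cost e + t + Φ′ ≤ Φ₀ + (1 + cost e + B)
  branch-cost e t Φ′ Φ₀ B p = begin
    1 + cost e + t + Φ′    ≡⟨ +-assoc (1 + cost e) t Φ′ ⟩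
    1 + cost e + (t + Φ′)  ≤⟨ +-monoʳ-≤ (1 + cost e) p ⟩
    1 + cost e + (Φ₀ + B)  ≡⟨ +-assoc (1 + cost e) Φ₀ B ⟨
    1 + cost e + Φ₀ + B    ≡⟨ cong (_+ B) (+-comm (1 + cost e) Φ₀) ⟩
    Φ₀ + (1 + cost e) + B  ≡⟨ +-assoc Φ₀ (1 + cost e) B ⟩
    Φ₀ + (1 + cost e + B)  ∎
    where open ≤-Reasoning

  Spends : (Memory → ℕ) → Cmd → (Memory → Set) → ℕ → Memory → Set
  Spends Φ c Q B s = Q (exec c s) × time c s + Φ (exec c s) ≤ Φ s + B

  if-zero-spends : ∀ {Φ Q} e c d {B} s → ⟦ e ⟧ s ≡ 0 → Spends Φ c Q B s → Spends Φ (if e c d) Q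
    (1 + cost e + B) s
  if-zero-spends {Φ} e c d {B} s z (q , t) with ⟦ e ⟧ s | z
  ... | zero | _ = q , branch-cost e (time c s) (Φ (exec c s)) (Φ s) B t

  if-one-spends : ∀ {Φ Q} e c d {B} s → ⟦ e ⟧ s ≡ 1 → Spends Φ d Q B s → Spends Φ (if e c d) Q
    (1 + cost e + B) s
  if-one-spends {Φ} e c d {B} s z (q , t) with ⟦ e ⟧ s | z
  ... | suc _ | _ = q , branch-cost e (time d s) (Φ (exec d s)) (Φ s) B t

  weight : Memory → ℕ
  weight s = cnt {n} (λ v → s 3 (toℕ v) ≡ᵇ 1)

  weight-cong : ∀ {s s′} → (∀ (v : Fin n) → s′ 3 (toℕ v) ≡ s 3 (toℕ v)) → weight s′ ≡ weight s
  weight-cong h = cnt-cong (λ v → cong (_≡ᵇ 1) (h v))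

  weight-sides : ∀ {X s} → Sides X s → weight s ≡ cnt X
  weight-sides {X} h = cnt-cong (λ v → trans (cong (_≡ᵇ 1) (h v)) (sideLabel-1 (X v)))

  -- Each successful round shrinks X, so the rounds of all descents together
  -- number at most n plus one for each descent.
  Φ Ψ : Memory → ℕ
  Φ s = roundCost * weight s
  Ψ s = roundCost * (weight s + (1 ∸ s 23 0))

  simple-costs : ∀ c {P Q} → unwritten 3 c ≡ true → (∀ s → P s → Q (exec c s)) →
                 Costs Φ P c Q (size c * N ^ loopDepth c)
  simple-costs c k h = costs λ s p → h s p ,
    ≤-trans (+-mono-≤ (time≤ c s)
      (≤-reflexive (cong (roundCost *_)
      (weight-cong {s} {exec c s} (λ v → exec-frame c s 3 k (toℕ v))))))
            (≤-reflexive (+-comm _ (Φ s)))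

  record Going (q : Quad n) (D : Quad n → Set) (k : ℕ) (s : Memory) : Set where
    field
      base     : Base q s
      inv      : Inv D s
      progress : (s 23 0 ≡ 0 × cnt (Inv.X inv) + k ≤ n) ⊎ (s 23 0 ≡ 1 × Exhausted q (Inv.X inv))

  Costs-≤ : ∀ {Φ P Q c A B} → A ≤ B → Costs Φ P c Q A → Costs Φ P c Q B
  Costs-≤ {Φ} A≤B (costs f) = costs λ s p → let q , t = f s p in q , ≤-trans t (+-monoʳ-≤ (Φ s) A≤B)

  Costs-map : ∀ {Φ P P′ Q Q′ c B} → (∀ s → P′ s → P s) → (∀ s → Q s → Q′ s) → Costs Φ P c Q B →
    Costs Φ P′ c Q′ B
  Costs-map g h (costs f) = costs λ s p → let q , t = f s (g s p) in h _ q , t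

  Costs-also : ∀ {Φ P Q c B} (R : Memory → Set) → (∀ s → P s → R (exec c s)) → Costs Φ P c Q B →
    Costs Φ P c (λ s → Q s × R s) B
  Costs-also R h (costs f) = costs λ s p → let q , t = f s p in (q , h s p) , t

  module _ (q : Quad n) (D : Quad n → Set) where

    Descended : Quad n → Set
    Descended q′ = q′ ≡ q ⊎ D q′

    -- A success lowers the weight by at least one, a failure sets cell 23; either way Ψ drops by at
    -- least one `roundCost`, which pays for the round. The slack 1 matches the cost of an idle
    -- round.
    rounded : ∀ k s s′ t (g : Going q D k s) → cnt (Inv.X (Going.inv g)) + k ≤ n → s 23 0 ≡ 0 → t ≤
      roundCost →
              Frame c s s′ → Rounded q (Inv.X (Going.inv g)) s s′ → Going q D (suc k) s′ × t + Ψ s′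
                ≤ Ψ s + 1
    rounded k s s′ t g X+k≤n s23 t≤ fr r = after r , paid r
      where
      open Going g
      open Inv inv
      after : Rounded q X s s′ → Going q D (suc k) s′
      after (inj₁ (m , z)) = record
        { base = Base-frame c keeps-base fr base
        ; inv = record
          { input-ok = Input-frame c (proj₁ (∧-true⁻ {keepsInput c} keeps-base)) fr input-ok ;
            parents = λ v → trans (fr 27 keeps-27 _) (parents v)
          ; sides = Moved.sides m ; status = inj₂ (Moved.verdict₁ m , Better.nonPath (Moved.better m))
          ; dead = λ q′ d → Exhausted-shrink (Moved.better m) (dead q′ d) }
        ; progress = inj₁ (z , ≤-trans (≤-reflexive (+-suc _ k))
          (≤-trans (+-monoˡ-≤ k (Better.smaller (Moved.better m))) X+k≤n)) }
      after (inj₂ (si , v , ex , z)) = record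
        { base = Base-frame c keeps-base fr base
        ; inv = record
          { input-ok = Input-frame c (proj₁ (∧-true⁻ {keepsInput c} keeps-base)) fr input-ok ;
            parents = λ v → trans (fr 27 keeps-27 _) (parents v)
          ; sides = si
          ; status = Data.Sum.map (λ (p , r) → trans v p , r) (λ (p , r) → trans v p , r) status
          ; dead = dead }
        ; progress = inj₂ (z , ex) }
      C = roundCost
      x = cnt X
      Ψs : Ψ s ≡ C * (x + 1)
      Ψs = cong₂ (λ w z → C * (w + (1 ∸ z))) (weight-sides {X} {s} sides) s23
      spend : ∀ {y} → Ψ s′ ≡ C * y → y + 1 ≤ x + 1 → t + Ψ s′ ≤ Ψ s + 1
      spend {y} e y≤ = begin
        t + Ψ s′       ≤⟨ +-monoˡ-≤ (Ψ s′) t≤ ⟩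
        C + Ψ s′       ≡⟨ cong (C +_) e ⟩
        C + C * y      ≡⟨ *-suc C y ⟨
        C * suc y      ≡⟨ cong (C *_) (+-comm 1 y) ⟩
        C * (y + 1)    ≤⟨ *-monoʳ-≤ C y≤ ⟩
        C * (x + 1)    ≡⟨ Ψs ⟨
        Ψ s            ≤⟨ m≤m+n (Ψ s) 1 ⟩
        Ψ s + 1        ∎
        where open ≤-Reasoning
      paid : Rounded q X s s′ → t + Ψ s′ ≤ Ψ s + 1
      paid (inj₁ (m , z)) = spend
        (cong₂ (λ w z → C * (w + (1 ∸ z))) (weight-sides {_} {s′} (Moved.sides m)) z)
        (+-monoˡ-≤ 1 (≤-trans (≤-reflexive (+-comm _ 1)) (Better.smaller (Moved.better m))))
      paid (inj₂ (si , _ , _ , z)) = spend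
        (cong₂ (λ w z → C * (w + (1 ∸ z))) (weight-sides {X} {s′} si) z)
        (≤-reflexive (cong (_+ 1) (+-identityʳ x)))

    -- The budget 4 covers the test of cell 23, at cost 3, and the `nop` of an idle round; a genuine
    -- round is paid from Ψ.
    iteration : ∀ (k : Fin n) → Costs Ψ (λ s → s 24 0 ≡ toℕ k × Going q D (toℕ k) s)
      (if (var 23) c nop) (Going q D (suc (toℕ k))) 4
    iteration k = costs λ s (_ , g) → go s g (Going.progress g)
      where
      go : ∀ s (g : Going q D (toℕ k) s) → _ → Spends Ψ (if (var 23) c nop)
        (Going q D (suc (toℕ k))) 4 s
      go s g (inj₁ (z , le)) = if-zero-spends {Ψ} {Going q D (suc (toℕ k))} (var 23) c nop s z
        (rounded (toℕ k) s (exec c s) (time c s) g le z (within s) (exec-frame c s)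
          (RoundSpec.does spec q _ s (Going.base g) (Inv.sides (Going.inv g))))
      go s g (inj₂ (z , ex)) = if-one-spends {Ψ} {Going q D (suc (toℕ k))} (var 23) c nop s z
        (record { base = Going.base g ; inv = Going.inv g ; progress = inj₂ (z , ex) } , ≤-reflexive
          (+-comm 1 (Ψ s)))

    Going-index : ∀ k s x → Going q D k s → Going q D k (write s 24 0 x)
    Going-index k s x g = record
      { base = Base-exec (set 24 (lit 0) (lit x)) refl base
      ; inv = Inv-exec (set 24 (lit 0) (lit x)) refl inv ; progress = progress }
      where open Going g

    Going-done : ∀ s → Going q D n s → Inv Descended s
    Going-done s g = record
      { input-ok = input-ok ; parents = parents ; sides = sides ; status = status
      ; dead = λ { q′ (inj₁ refl) → exhausted progress ; q′ (inj₂ d) → dead q′ d } }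
      where
      open Going g
      open Inv inv
      exhausted : _ → Exhausted q X
      exhausted (inj₂ (_ , ex)) = ex
      -- After n successes X is empty, and nothing is smaller than the empty set.
      exhausted (inj₁ (_ , le)) W im =
        n≮0 (≤-trans (Improves.smaller im) (+-cancelʳ-≤ n (cnt X) 0 le))

    descendCost : ℕ
    descendCost = (3 + roundCost) + (9 + loopSum (λ _ → 4) 0 n)

    Ψ-seq : ∀ {P Q R c d A B} → (∀ s → P s → Q (exec c s) × time c s + Ψ (exec c s) ≤ Φ s + A) →
            Costs Ψ Q d R B → Costs Φ P (c ▸ d) R (A + B)
    Ψ-seq {c = c} {d} {A} {B} f (costs g) = costs λ s p →
      let q , t = f s p; r , u = g _ q in r , (begin
        time c s + time d (exec c s) + Φ
          (exec d (exec c s))   ≤⟨ +-monoʳ-≤ (time c s + time d (exec c s))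
          (*-monoʳ-≤ roundCost (m≤m+n (weight (exec d (exec c s))) (1 ∸ exec d (exec c s) 23 0))) ⟩
        time c s + time d (exec c s) + Ψ (exec d (exec c s))   ≡⟨ +-assoc (time c s) _ _ ⟩
        time c s + (time d (exec c s) + Ψ (exec d (exec c s))) ≤⟨ +-monoʳ-≤ (time c s) u ⟩
        time c s + (Ψ (exec c s) + B)                          ≡⟨ +-assoc (time c s) _ _ ⟨
        time c s + Ψ (exec c s) + B                            ≤⟨ +-monoˡ-≤ B t ⟩
        Φ s + A + B                                            ≡⟨ +-assoc (Φ s) A B ⟩
        Φ s + (A + B)                                          ∎)
      where open ≤-Reasoning

    descend-costs : Costs Φ (λ s → Base q s × Inv D s) (descend c) (Inv Descended) descendCost
    descend-costs = Ψ-seq {Q = Going q D 0} (λ s (b , i) → begin-going s b i , open-account s)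
      (Costs-map (λ _ g → g) Going-done
        (loop-costs 24 (if (var 23) c nop) (Going q D) (λ _ → 4) (∧-true⁺ keeps-24 refl)
          (λ _ _ → refl) Going-index iteration))
      where
      begin-going : ∀ s → Base q s → Inv D s → Going q D 0 (exec (set 23 (lit 0) (lit 0)) s)
      begin-going s b i = record
        { base = Base-exec (set 23 (lit 0) (lit 0)) refl b ; inv = Inv-exec (set 23 (lit 0) (lit 0))
          refl i
        ; progress = inj₁ (refl , ≤-trans (≤-reflexive (+-identityʳ _)) (cnt≤ (Inv.X i))) }
      -- The descent opens with one extra `roundCost` in Ψ, reserved for the round that fails; the 3
      -- is the assignment to cell 23.
      open-account : ∀ s → 3 + roundCost * (weight s + 1) ≤ Φ s + (3 + roundCost)
      open-account s = ≤-reflexive (begin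
        3 + roundCost * (weight s + 1)     ≡⟨ cong (λ w → 3 + roundCost * w) (+-comm (weight s) 1) ⟩
        3 + roundCost * suc (weight s)     ≡⟨ cong (3 +_) (*-suc roundCost (weight s)) ⟩
        3 + (roundCost + Φ s)              ≡⟨ +-assoc 3 roundCost (Φ s) ⟨
        3 + roundCost + Φ s                ≡⟨ +-comm (3 + roundCost) (Φ s) ⟩
        Φ s + (3 + roundCost)              ∎)
        where open ≡-Reasoning

  record At (v i j : Fin n) (D : Quad n → Set) (s : Memory) : Set where
    constructor located
    field
      at-v : s 20 0 ≡ toℕ v
      at-i : s 21 0 ≡ toℕ i
      at-j : s 22 0 ≡ toℕ j
      inv  : Inv D s

  -- Four assignments at 2 each, three variables at 2 each, and one parent lookup at 3.
  setQuadCost : ℕ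
  setQuadCost = 17

  orientCost : ℕ
  orientCost = setQuadCost + ((3 + roundCost) + (9 + loopSum (λ _ → 4) 0 n))

  module _ (v i j : Fin n) where

    At-exec : ∀ c {D s} → keepsInv c ∧ (unwritten 20 c ∧ (unwritten 21 c ∧ unwritten 22 c)) ≡ true →
              At v i j D s → At v i j D (exec c s)
    At-exec c {s = s} k (located p q r inv) =
      let ki , k′ = ∧-true⁻ {keepsInv c} k; k₁ , k″ = ∧-true⁻ {unwritten 20 c} k′; k₂ , k₃ = ∧-true⁻ {unwritten 21 c} k″ in
      located (trans (exec-frame c s 20 k₁ 0) p) (trans (exec-frame c s 21 k₂ 0) q)
        (trans (exec-frame c s 22 k₃ 0) r)
              (Inv-exec c ki inv)

    orient-costs : ∀ {D} e f g h q → size (setQuad e f g h) ≤ setQuadCost →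
      (∀ s → At v i j D s → ⟦ e ⟧ s ≡ toℕ (Quad.a₁ q)) →
        (∀ s → At v i j D s → ⟦ f ⟧ s ≡ toℕ (Quad.b₁ q)) →
      (∀ s → At v i j D s → ⟦ g ⟧ s ≡ toℕ (Quad.a₂ q)) →
        (∀ s → At v i j D s → ⟦ h ⟧ s ≡ toℕ (Quad.b₂ q)) →
      Costs Φ (At v i j D) (orient c e f g h) (At v i j (Descended q D)) orientCost
    orient-costs {D} e f g h q small pe pf pg ph = seq-costs
      (Costs-≤ (≤-trans (≤-reflexive (*-identityʳ _)) small)
        (simple-costs (setQuad e f g h) {At v i j D} {λ s → Base q s × At v i j D s} refl quadded))
      (Costs-map (λ _ p → p) (λ _ (inv , p , q , r) → located p q r inv)
        (Costs-also (λ s → s 20 0 ≡ toℕ v × s 21 0 ≡ toℕ i × s 22 0 ≡ toℕ j)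
          (λ s (_ , located p q r _) → trans (exec-frame (descend c) s 20 (∧-true⁺ keeps-20 refl) 0) p ,
             trans (exec-frame (descend c) s 21 (∧-true⁺ keeps-21 refl) 0) q , trans
               (exec-frame (descend c) s 22 (∧-true⁺ keeps-22 refl) 0) r)
          (Costs-map (λ _ (b , a) → b , At.inv a) (λ _ x → x) (descend-costs q D))))
      where
      quadded : ∀ s → At v i j D s → Base q (exec (setQuad e f g h) s) × At v i j D
        (exec (setQuad e f g h) s)
      quadded s a = record
        { input-ok = Inv.input-ok (At.inv a₄)
        ; reg-a₁ = pe s a ; reg-b₁ = pf _ a₁ ; reg-a₂ = pg _ a₂ ; reg-b₂ = ph _ a₃ } , a₄
        where
        a₁ = At-exec (set 10 (lit 0) e) refl a
        a₂ = At-exec (set 11 (lit 0) f) refl a₁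
        a₃ = At-exec (set 12 (lit 0) g) refl a₂
        a₄ = At-exec (set 13 (lit 0) h) refl a₃

    Four : Quad n → Set
    Four q = (q ≡ quad v i (par v) j ⊎ q ≡ quad v j (par v) i) ⊎
      (q ≡ quad (par v) i v j ⊎ q ≡ quad (par v) j v i)

    orientations-cost : ℕ
    orientations-cost = orientCost + (orientCost + (orientCost + orientCost))

    orientations-costs : ∀ {D} → Costs Φ (At v i j D) (orientations c)
      (At v i j (λ q → Four q ⊎ D q)) orientations-cost
    orientations-costs {D} = Costs-map (λ _ a → a)
      (λ _ (located p q r inv) → located p q r (Inv-weaken split inv)) (
      seq-costs (orient-costs (var 20) (var 21) parentE (var 22) (quad v i (par v) j) ≤-refl
        (λ _ → At.at-v) (λ _ → At.at-i) at-par (λ _ → At.at-j)) (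
      seq-costs (orient-costs (var 20) (var 22) parentE (var 21) (quad v j (par v) i) ≤-refl
        (λ _ → At.at-v) (λ _ → At.at-j) at-par (λ _ → At.at-i)) (
      seq-costs (orient-costs parentE (var 21) (var 20) (var 22) (quad (par v) i v j) ≤-refl at-par
        (λ _ → At.at-i) (λ _ → At.at-v) (λ _ → At.at-j))
                (orient-costs parentE (var 22) (var 20) (var 21) (quad (par v) j v i) ≤-refl at-par
                  (λ _ → At.at-j) (λ _ → At.at-v) (λ _ → At.at-i)))))
      where
      at-par : ∀ {D} s → At v i j D s → ⟦ parentE ⟧ s ≡ toℕ (par v)
      at-par s (located p _ _ inv) = trans (cong (s 27) p) (Inv.parents inv v)
      split : ∀ q → Four q ⊎ D q → _
      split q (inj₁ (inj₁ (inj₁ e))) = inj₂ (inj₂ (inj₂ (inj₁ e)))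
      split q (inj₁ (inj₁ (inj₂ e))) = inj₂ (inj₂ (inj₁ e))
      split q (inj₁ (inj₂ (inj₁ e))) = inj₂ (inj₁ e)
      split q (inj₁ (inj₂ (inj₂ e))) = inj₁ e
      split q (inj₂ d) = inj₂ (inj₂ (inj₂ (inj₂ d)))

-- Sums over loop rounds and the number of edges

sumF : ∀ {n} → (Fin n → ℕ) → ℕ
sumF {zero}  f = 0
sumF {suc n} f = f zero + sumF (f ∘ suc)

sumF-cong : ∀ {n} {f g : Fin n → ℕ} → (∀ v → f v ≡ g v) → sumF f ≡ sumF g
sumF-cong {zero}  h = refl
sumF-cong {suc n} h = cong₂ _+_ (h zero) (sumF-cong (h ∘ suc))

≤-sumF : ∀ {n} (f : Fin n → ℕ) v → f v ≤ sumF f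
≤-sumF f zero    = m≤m+n _ _
≤-sumF f (suc v) = ≤-trans (≤-sumF (f ∘ suc) v) (m≤n+m _ (f zero))

sumF-bit : ∀ {n} (f : Fin n → Bool) → sumF (bit ∘ f) ≡ cnt f
sumF-bit {zero}  f = refl
sumF-bit {suc n} f = cong (bit (f zero) +_) (sumF-bit (f ∘ suc))

sumFrom : (ℕ → ℕ) → ℕ → ℕ → ℕ
sumFrom e k zero    = 0
sumFrom e k (suc r) = e k + sumFrom e (suc k) r

sumFrom-sumF : ∀ e k r → sumFrom e k r ≡ sumF {r} (λ v → e (k + toℕ v))
sumFrom-sumF e k zero    = refl
sumFrom-sumF e k (suc r) = cong₂ _+_ (cong e (sym (+-identityʳ k)))
  (trans (sumFrom-sumF e (suc k) r) (sumF-cong {r} (λ v → cong e (sym (+-suc k (toℕ v))))))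

-- Separates the fixed cost of the rounds from the part weighted by `e`; with edge indicators as
-- weights, the latter sums up to m.
loopSum-affine : ∀ κ e B k r → loopSum (λ j → κ + e j * B) k r ≡ r * (κ + 12) + sumFrom e k r * B
loopSum-affine κ e B k zero    = refl
loopSum-affine κ e B k (suc r) = begin
  (κ + e k * B + 12) + loopSum (λ j → κ + e j * B) (suc k) r
    ≡⟨ cong₂ _+_ (trans (+-assoc κ _ 12) (trans (cong (κ +_) (+-comm _ 12)) (sym (+-assoc κ 12 _))))
    (loopSum-affine κ e B (suc k) r) ⟩
  (κ + 12 + e k * B) + (r * (κ + 12) + S * B) ≡⟨ interchange (κ + 12) (e k * B) (r * (κ + 12)) (S * B) ⟩
  (κ + 12 + r * (κ + 12)) + (e k * B + S * B)
    ≡⟨ cong (κ + 12 + r * (κ + 12) +_) (*-distribʳ-+ B (e k) S) ⟨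
  suc r * (κ + 12) + (e k + S) * B            ∎
  where
  open ≡-Reasoning
  S = sumFrom e (suc k) r
  interchange : ∀ a b c d → (a + b) + (c + d) ≡ (a + c) + (b + d)
  interchange a b c d = trans (+-assoc a b _) (trans (cong (a +_) (trans (sym (+-assoc b c d))
    (trans (cong (_+ d) (+-comm b c)) (+-assoc c b d)))) (sym (+-assoc a c _)))

loopSum-cong : ∀ {b b′ : ℕ → ℕ} k r → (∀ j → b j ≡ b′ j) → loopSum b k r ≡ loopSum b′ k r
loopSum-cong k zero    h = refl
loopSum-cong k (suc r) h = cong₂ _+_ (cong (_+ 12) (h k)) (loopSum-cong (suc k) r h)

loopSum-const : ∀ κ k r → loopSum (λ _ → κ) k r ≡ r * (κ + 12)
loopSum-const κ k zero    = refl
loopSum-const κ k (suc r) = cong (κ + 12 +_) (loopSum-const κ (suc k) r)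

module _ {A : Set} {P : A → Set} (P? : Decidable P) where

  length-filter-tabulate : ∀ {n} (g : Fin n → A) → length (filter P? (List.tabulate g)) ≡ cnt
    (λ v → Dec.does (P? (g v)))
  length-filter-tabulate {zero}  g = refl
  length-filter-tabulate {suc n} g with Dec.does (P? (g zero))
  ... | true  = cong suc (length-filter-tabulate (g ∘ suc))
  ... | false = length-filter-tabulate (g ∘ suc)

length-filter-product : ∀ {A : Set} {P : A × A → Set} (P? : Decidable P) {m n} (f : Fin m → A)
  (g : Fin n → A) →
  length (filter P? (cartesianProduct (List.tabulate f) (List.tabulate g))) ≡
  sumF (λ u → cnt (λ v → Dec.does (P? (f u , g v))))
length-filter-product P? {zero}  f g = refl
length-filter-product P? {suc m} f g = begin
  length (filter P? (List.map (f zero ,_) (List.tabulate g) List.++ rest))              ≡⟨ cong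
    length (filter-++ P? (List.map (f zero ,_) (List.tabulate g)) rest) ⟩
  length (filter P? (List.map (f zero ,_) (List.tabulate g)) List.++ filter P? rest)    ≡⟨ length-++
    (filter P? (List.map (f zero ,_) (List.tabulate g))) ⟩
  length (filter P? (List.map (f zero ,_) (List.tabulate g))) + length (filter P? rest) ≡⟨ cong₂ _+_
     (trans (cong (length ∘ filter P?) (map-tabulate g (f zero ,_)))
       (length-filter-tabulate P? (λ v → f zero , g v)))
     (length-filter-product P? (f ∘ suc) g) ⟩
  sumF (λ u → cnt (λ v → Dec.does (P? (f u , g v))))                                ∎
  where
  open ≡-Reasoning
  rest = cartesianProduct (List.tabulate (f ∘ suc)) (List.tabulate g)

module Edges {n : ℕ} (G : Graph n) where
  open Graph G using (adj)

  edge : Fin n → Fin n → Bool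
  edge u v = (toℕ u <ᵇ toℕ v) ∧ adj u v

  numEdges-sum : numEdges G ≡ sumF (λ u → cnt (edge u))
  numEdges-sum = length-filter-product (λ (u , v) → (u Fin.<? v) ×-dec T? (adj u v)) id id

  -- The edge indicator on plain numbers, because loop budgets are functions on ℕ rather than on
  -- vertices.
  edgeAt : ℕ → ℕ → ℕ
  edgeAt i j = bit ((i <ᵇ j) ∧ nz (matrixCell G (i * n + j)))

  edgesFrom : ℕ → ℕ
  edgesFrom i = sumFrom (edgeAt i) 0 n

  module _ (conn : Connected G) where
    open Tree G conn using (input-Input)

    edgeAt-edge : ∀ u v → edgeAt (toℕ u) (toℕ v) ≡ bit (edge u v)
    edgeAt-edge u v = cong (λ b → bit ((toℕ u <ᵇ toℕ v) ∧ b))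
      (trans (cong nz (Execution.Input.matrix input-Input u v)) (nz-bit (adj u v)))

    sum-edges : sumFrom edgesFrom 0 n ≡ numEdges G
    sum-edges = trans (sumFrom-sumF edgesFrom 0 n) (trans (sumF-cong row) (sym numEdges-sum))
      where
      row : ∀ u → edgesFrom (toℕ u) ≡ cnt (edge u)
      row u = trans (sumFrom-sumF (edgeAt (toℕ u)) 0 n)
        (trans (sumF-cong (edgeAt-edge u)) (sumF-bit (edge u)))

  open Paths G

  -- Through m ≥ 1 this lets the n³ idle rounds of the scan be absorbed into n³m.
  some-edge : Connected G → ∀ (u v : Fin n) → u ≢ v → 1 ≤ numEdges G
  some-edge conn u v u≢v with exit (eqF u) (conn u v ∈⊤ ∈⊤) (eqF-refl u) (eqF-false⁺ u≢v)
  ... | x , y , _ , _ , xy = ≤-trans (oriented (<-cmp (toℕ x) (toℕ y))) (≤-reflexive (sym numEdges-sum))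
    where
    counted : ∀ u v → toℕ u < toℕ v → adj u v ≡ true → 1 ≤ sumF (λ u → cnt (edge u))
    counted u v lt e = ≤-trans
      (≤-trans (s≤s z≤n) (≤-reflexive (sym (cnt-minus (edge u) v (∧-true⁺ (<ᵇ-true⁺ lt) e)))))
      (≤-sumF (λ u → cnt (edge u)) u)
    oriented : Tri (toℕ x < toℕ y) (toℕ x ≡ toℕ y) (toℕ y < toℕ x) → 1 ≤ sumF (λ u → cnt (edge u))
    oriented (tri< lt _ _) = counted x y lt xy
    oriented (tri≈ _ e _)  = contradiction (toℕ-injective e) (no-loop xy)
    oriented (tri> _ _ gt) = counted y x gt (adj-flip xy)

-- The scan over tree edges and edges

module Scan {n : ℕ} (G : Graph n) (conn : Connected G) (par : Fin n → Fin n)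
            (c : Cmd) (roundCost : ℕ) (spec : Rounds.RoundSpec G conn c roundCost) where
  open Graph G using (adj)
  open Rules n
  open Edges G
  open Execution G
  open Descent G conn par c roundCost spec

  edgeTest : Expr
  edgeTest = andE (ltE (var 21) (var 22)) (edgeE (var 21) (var 22))

  -- The quads handled before the loop counters reach a, b, d.
  Covered : ℕ → ℕ → ℕ → Quad n → Set
  Covered a b d q = ∃ λ v → ∃ λ i → ∃ λ j → edge i j ≡ true × Four v i j q ×
    (toℕ v < a ⊎ (toℕ v ≡ a × (toℕ i < b ⊎ (toℕ i ≡ b × toℕ j < d))))

  Covered-suc-j : ∀ v i j q → Covered (toℕ v) (toℕ i) (suc (toℕ j)) q →
                  (edge i j ≡ true × Four v i j q) ⊎ Covered (toℕ v) (toℕ i) (toℕ j) q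
  Covered-suc-j v i j q (v′ , i′ , j′ , e , f , inj₁ lt) = inj₂ (v′ , i′ , j′ , e , f , inj₁ lt)
  Covered-suc-j v i j q (v′ , i′ , j′ , e , f , inj₂ (p , inj₁ lt)) = inj₂
    (v′ , i′ , j′ , e , f , inj₂ (p , inj₁ lt))
  Covered-suc-j v i j q (v′ , i′ , j′ , e , f , inj₂ (p , inj₂ (r , lt))) with below-suc j j′ lt
  ... | inj₁ lt′ = inj₂ (v′ , i′ , j′ , e , f , inj₂ (p , inj₂ (r , lt′)))
  ... | inj₂ refl with toℕ-injective p | toℕ-injective r
  ...   | refl | refl = inj₁ (e , f)

  Covered-suc-i : ∀ a b q → Covered a (suc b) 0 q → Covered a b n q
  Covered-suc-i a b q (v , i , j , e , f , inj₁ lt) = v , i , j , e , f , inj₁ lt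
  Covered-suc-i a b q (v , i , j , e , f , inj₂ (p , inj₂ (_ , ())))
  Covered-suc-i a b q (v , i , j , e , f , inj₂ (p , inj₁ lt)) with m≤n⇒m<n∨m≡n (≤-pred lt)
  ... | inj₁ lt′ = v , i , j , e , f , inj₂ (p , inj₁ lt′)
  ... | inj₂ r   = v , i , j , e , f , inj₂ (p , inj₂ (r , toℕ<n j))

  Covered-suc-v : ∀ a q → Covered (suc a) 0 0 q → Covered a n 0 q
  Covered-suc-v a q (v , i , j , e , f , inj₂ (p , inj₁ ()))
  Covered-suc-v a q (v , i , j , e , f , inj₂ (p , inj₂ (_ , ())))
  Covered-suc-v a q (v , i , j , e , f , inj₁ lt) with m≤n⇒m<n∨m≡n (≤-pred lt)
  ... | inj₁ lt′ = v , i , j , e , f , inj₁ lt′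
  ... | inj₂ r   = v , i , j , e , f , inj₂ (r , inj₁ (toℕ<n i))

  O κ : ℕ
  O = orientCost + (orientCost + (orientCost + orientCost))
  -- One unit for the branching and one for the `nop` at a non-edge.
  κ = 2 + cost edgeTest

  I₃ : Fin n → Fin n → ℕ → Memory → Set
  I₃ v i k s = s 20 0 ≡ toℕ v × s 21 0 ≡ toℕ i × Inv (Covered (toℕ v) (toℕ i) k) s

  I₂ : Fin n → ℕ → Memory → Set
  I₂ v k s = s 20 0 ≡ toℕ v × Inv (Covered (toℕ v) k 0) s

  I₁ : ℕ → Memory → Set
  I₁ k = Inv (Covered k 0 0)

  -- Only edges pay for the four descents, and only for the part that Φ does not cover.
  b₃ : ℕ → ℕ → ℕ
  b₃ i j = κ + edgeAt i j * O

  visit-edge : ∀ v i j → Costs Φ (λ s → s 22 0 ≡ toℕ j × I₃ v i (toℕ j) s)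
               (if edgeTest nop (orientations c)) (I₃ v i (suc (toℕ j))) (b₃ (toℕ i) (toℕ j))
  visit-edge v i j = by-edge (edge i j) refl
    where
    At-j : Memory → Set
    At-j s = s 22 0 ≡ toℕ j × I₃ v i (toℕ j) s
    test-value : ∀ s → At-j s → ⟦ edgeTest ⟧ s ≡ bit (edge i j)
    test-value s (pj , pv , pi , inv) = Is.value (and-is (lt-is {e = var 21} {var 22} pi pj)
      (edge-is {e = var 21} {var 22} (Inv.input-ok inv) pi pj))
    at-j-cost : ∀ b → edge i j ≡ b → b₃ (toℕ i) (toℕ j) ≡ κ + bit b * O
    at-j-cost b e = cong (λ x → κ + x * O) (trans (edgeAt-edge conn i j) (cong bit e))
    by-edge : ∀ b → edge i j ≡ b → Costs Φ At-j (if edgeTest nop (orientations c))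
      (I₃ v i (suc (toℕ j))) (b₃ (toℕ i) (toℕ j))
    by-edge true e = Costs-≤
      (≤-trans (+-mono-≤ (n≤1+n (1 + cost edgeTest)) (≤-reflexive (sym (+-identityʳ O))))
      (≤-reflexive (sym (at-j-cost true e))))
      (costs λ s p → if-one-spends {Φ} {I₃ v i (suc (toℕ j))} edgeTest nop (orientations c) s
        (trans (test-value s p) (cong bit e))
        (Costs.run (Costs-map located′ after (orientations-costs v i j)) s p))
      where
      located′ : ∀ s → At-j s → At v i j (Covered (toℕ v) (toℕ i) (toℕ j)) s
      located′ s (pj , pv , pi , inv) = located pv pi pj inv
      after : ∀ s → At v i j (λ q → Four v i j q ⊎ Covered (toℕ v) (toℕ i) (toℕ j) q) s → I₃ v i
        (suc (toℕ j)) s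
      after s (located pv pi _ inv) = pv , pi , Inv-weaken
        (λ q d → Data.Sum.map₁ proj₂ (Covered-suc-j v i j q d)) inv
    by-edge false e = Costs-≤ (≤-reflexive (trans (sym (+-identityʳ _)) (sym (at-j-cost false e))))
      (costs λ s p → if-zero-spends {Φ} {I₃ v i (suc (toℕ j))} edgeTest nop (orientations c) {1} s
        (trans (test-value s p) (cong bit e)) (after s p , ≤-reflexive (+-comm 1 (Φ s))))
      where
      drop : ∀ q → (edge i j ≡ true × Four v i j q) ⊎ Covered (toℕ v) (toℕ i) (toℕ j) q → Covered
        (toℕ v) (toℕ i) (toℕ j) q
      drop q (inj₁ (t , _)) = ⊥-elim (true≢false t e)
      drop q (inj₂ d) = d
      after : ∀ s → At-j s → I₃ v i (suc (toℕ j)) s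
      after s (_ , pv , pi , inv) = pv , pi , Inv-weaken (λ q d → drop q (Covered-suc-j v i j q d)) inv

  Inv-index : ∀ a {D} s x → keepsInv (set a (lit 0) (lit x)) ≡ true → Inv D s → Inv D (write s a 0 x)
  Inv-index a s x k inv = Inv-exec (set a (lit 0) (lit x)) k inv

  unwritten-orientations : ∀ a → unwritten a (descend c) ≡ true → (a ≡ᵇ 10) ≡ false → (a ≡ᵇ 11) ≡
    false →
                           (a ≡ᵇ 12) ≡ false → (a ≡ᵇ 13) ≡ false → unwritten a (orientations c) ≡ true
  unwritten-orientations a d h₁₀ h₁₁ h₁₂ h₁₃ rewrite h₁₀ | h₁₁ | h₁₂ | h₁₃ | d = refl

  open Rounds.RoundSpec spec using (keeps-20; keeps-21; keeps-22)

  loop₃ : ∀ v i → Costs Φ (I₃ v i 0) (for 22 (if edgeTest nop (orientations c))) (I₃ v i n)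
    (9 + loopSum (b₃ (toℕ i)) 0 n)
  loop₃ v i = loop-costs 22 (if edgeTest nop (orientations c)) (I₃ v i) (b₃ (toℕ i))
    (unwritten-orientations 22 (∧-true⁺ keeps-22 refl) refl refl refl refl) (λ _ _ → refl)
    (λ k s x (pv , pi , inv) → pv , pi , Inv-index 22 s x refl inv) (visit-edge v i)

  b₂ : ℕ → ℕ
  b₂ i = 9 + loopSum (b₃ i) 0 n

  loop₂ : ∀ v → Costs Φ (I₂ v 0) (for 21 (for 22 (if edgeTest nop (orientations c)))) (I₂ v n)
    (9 + loopSum b₂ 0 n)
  loop₂ v = loop-costs 21 (for 22 (if edgeTest nop (orientations c))) (I₂ v) b₂
    (unwritten-orientations 21 (∧-true⁺ keeps-21 refl) refl refl refl refl) (λ _ _ → refl)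
    (λ k s x (pv , inv) → pv , Inv-index 21 s x refl inv)
    (λ i → Costs-map (λ s (pi , pv , inv) → pv , pi , inv)
       (λ s (pv , pi , inv) → pv , Inv-weaken (Covered-suc-i (toℕ v) (toℕ i)) inv) (loop₃ v i))

  b₁ : ℕ → ℕ
  b₁ _ = 9 + loopSum b₂ 0 n

  scan-costs : Costs Φ (I₁ 0) (scan c) (I₁ n) (9 + loopSum b₁ 0 n)
  scan-costs = loop-costs 20 (for 21 (for 22 (if edgeTest nop (orientations c)))) I₁ b₁
    (unwritten-orientations 20 (∧-true⁺ keeps-20 refl) refl refl refl refl) (λ _ _ → refl)
    (λ k s x inv → Inv-index 20 s x refl inv)
    (λ v → Costs-map (λ s (pv , inv) → pv , inv)
       (λ s (pv , inv) → Inv-weaken (Covered-suc-v (toℕ v)) inv) (loop₂ v))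

  scanBound : ℕ
  scanBound = 9 + n * ((9 + (n * ((9 + n * (κ + 12)) + 12) + numEdges G * O)) + 12)

  scanBound-≡ : 9 + loopSum b₁ 0 n ≡ scanBound
  scanBound-≡ = cong (9 +_) (trans (loopSum-const (9 + loopSum b₂ 0 n) 0 n)
    (cong (λ x → n * ((9 + x) + 12)) (trans (loopSum-cong 0 n row)
      (trans (loopSum-affine (9 + n * (κ + 12)) edgesFrom O 0 n)
        (cong (λ x → n * ((9 + n * (κ + 12)) + 12) + x * O) (sum-edges conn))))))
    where
    row : ∀ i → b₂ i ≡ (9 + n * (κ + 12)) + edgesFrom i * O
    row i = trans (cong (9 +_) (loopSum-affine κ (edgeAt i) O 0 n)) (sym (+-assoc 9 (n * (κ + 12)) _))

-- Correctness of the output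

module Output {n : ℕ} (G : Graph n) (conn : Connected G) (par : Fin n → Fin n)
              (c : Cmd) (roundCost : ℕ) (spec : Rounds.RoundSpec G conn c roundCost)
              (crossing : ∀ W x y → W x ≡ true → W y ≡ false → Tree.Crossing G conn par W) where
  open Graph G using (adj)
  open Paths G
  open Joins G
  open Search G conn
  open Execution G
  open Edges G
  open Rounds G conn using (Exhausted)
  open Descent G conn par c roundCost spec
  open Scan G conn par c roundCost spec

  flip-nonpath : ∀ {X₁ X₂} → IsNonPath2Join G X₁ X₂ → IsNonPath2Join G X₂ X₁
  flip-nonpath ((_ , _ , _ , _ , sp) , np) = (_ , _ , _ , _ , flip-split sp) ,
    λ (A₁ , B₁ , A₂ , B₂ , sp′ , side) → np (_ , _ , _ , _ , flip-split sp′ , Data.Sum.swap side)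

  covered : ∀ v b₁ b₂ q → adj b₁ b₂ ≡ true →
            (q ≡ quad v b₁ (par v) b₂ ⊎ q ≡ quad (par v) b₁ v b₂) → Covered n 0 0 q
  covered v b₁ b₂ q e which with <-cmp (toℕ b₁) (toℕ b₂)
  ... | tri< lt _ _ = v , b₁ , b₂ , ∧-true⁺ (<ᵇ-true⁺ lt) e , Data.Sum.map inj₁ inj₁ which , inj₁
    (toℕ<n v)
  ... | tri≈ _ p _  = contradiction (toℕ-injective p) (no-loop e)
  ... | tri> _ _ gt = v , b₂ , b₁ , ∧-true⁺ (<ᵇ-true⁺ gt) (adj-flip e) , Data.Sum.map inj₂ inj₂
    which , inj₁ (toℕ<n v)

  -- Both sides are non-empty, so some tree edge crosses between them. It can be taken as a₁a₂, and
  -- together with any edge b₁b₂ of the other kind it forms a quad that the scan has handled.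
  covered-quad : ∀ {X₁ X₂} → IsNonPath2Join G X₁ X₂ → ∃ λ q → Covered n 0 0 q × NonPath q (lookup X₁)
  covered-quad {X₁} {X₂} np@((_ , _ , _ , _ , sp) , _)
    with a , a∈ ← IsSplit.A₁-nonempty sp | b , b∈ ← IsSplit.A₂-nonempty sp
    with v , e , differ ← crossing (lookup X₁) a b (∈-lookup (IsSplit.A₁⊆X₁ sp a∈))
      (SplitFacts.∈X₂⇒ sp (IsSplit.A₂⊆X₂ sp b∈))
    = orient-crossing (lookup X₁ v) (lookup X₁ (par v)) refl refl differ
    where
    orient-crossing : ∀ x y → lookup X₁ v ≡ x → lookup X₁ (par v) ≡ y → lookup X₁ v ≢ lookup X₁
      (par v) → _
    orient-crossing true true p q d = contradiction (trans p (sym q)) d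
    orient-crossing false false p q d = contradiction (trans p (sym q)) d
    orient-crossing true false p q d =
      let b₁ , b₂ , N = nonpath⇒NonPath conn np v (par v) (lookup-∈ p) (SplitFacts.⇒∈X₂ sp q) e in
      _ , covered v b₁ b₂ _ (Valid.b₁b₂ (NonPath.valid N)) (inj₁ refl) , N
    orient-crossing false true p q d =
      let b₁ , b₂ , N = nonpath⇒NonPath conn np (par v) v (lookup-∈ q) (SplitFacts.⇒∈X₂ sp p) (adj-flip e) in
      _ , covered v b₁ b₂ _ (Valid.b₁b₂ (NonPath.valid N)) (inj₂ refl) , N

  module _ {s : Memory} (inv : Inv (Covered n 0 0) s) where
    open Inv inv

    private
      none-inside : ∀ {X₁ X₂} → IsNonPath2Join G X₁ X₂ → cnt (lookup X₁) < cnt X → lookup X₁ ⊆ᵇ X → ⊥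
      none-inside np lt ⊆X = let q , cov , N = covered-quad np in
        dead q cov _ (record { nonPath = N ; smaller = lt ; inside = ⊆X })

      side₁ : side s 1 ≡ tabulate X
      side₁ = tabulate-cong (λ v → trans (cong (_≡ᵇ 1) (sides v)) (sideLabel-1 (X v)))

      side₂ : side s 2 ≡ tabulate (co X)
      side₂ = tabulate-cong (λ v → trans (cong (_≡ᵇ 2) (sides v)) (label (X v)))
        where
        label : ∀ b → (sideLabel b ≡ᵇ 2) ≡ not b
        label true  = refl
        label false = refl

      not-inside : ∀ {X₁ X₂} → IsNonPath2Join G X₁ X₂ → ¬ X₁ ⊂ tabulate X
      not-inside {X₁} np (⊆X , x , x∈ , x∉) = none-inside np
        (cnt-mono-< sub x (≢true⇒false (x∉ ∘ lookup-∈)) (∈-tabulate⁻ x∈)) sub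
        where
        sub : lookup X₁ ⊆ᵇ X
        sub v p = ∈-tabulate⁻ (⊆X (lookup-∈ p))

      decide : Status X s → CorrectOutput G s
      -- X is still V, so any non-path 2-join would improve it: its second side is non-empty, and
      -- its first side therefore smaller than V.
      decide (inj₁ (v , all)) = inj₂ (v , λ (X₁ , X₂ , np) → none-inside np
        (let _ , _ , N = covered-quad np; u , out = cnt-suc⁻ (co (lookup X₁)) (≤-trans (s≤s z≤n) (NonPath.size₂ N)) in
         cnt-mono-< (λ w _ → all w) u (not-true⁻ out) (all u)) (λ w _ → all w))
      decide (inj₂ (v , q , N)) = inj₁
        (v , subst₂ (IsNonPath2Join G) (sym side₁) (sym side₂) (NonPath⇒nonpath conn N) ,
        -- X itself is the minimal side. A second side inside X becomes a first side when the 2-join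
        -- is flipped.
        inj₁ λ X₁ X₂ np → subst (λ S → ¬ X₁ ⊂ S) (sym side₁) (not-inside np) ,
                          subst (λ S → ¬ X₂ ⊂ S) (sym side₁) (not-inside (flip-nonpath np)))

    correct : CorrectOutput G s
    correct = decide status

-- The running time

n≤n³ : ∀ n → n ≤ n ^ 3
n≤n³ zero    = z≤n
n≤n³ (suc k) = m≤m*n (suc k) (suc k * (suc k * 1))

n²≤n³ : ∀ n → n * n ≤ n ^ 3
n²≤n³ zero    = z≤n
n²≤n³ (suc k) = *-monoʳ-≤ (suc k)
  (≤-trans (≤-reflexive (sym (*-identityʳ (suc k)))) (*-monoʳ-≤ (suc k) (s≤s z≤n)))

n³-≡ : ∀ n → n * n * n ≡ n ^ 3
n³-≡ n = trans (*-assoc n n n) (cong (λ x → n * (n * x)) (sym (*-identityʳ n)))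

-- For n ≥ 1 this is the square of n + 1 ≤ 2n; for n = 0 the factor n makes the left side vanish.
nN²≤4n³ : ∀ n → n * suc n ^ 2 ≤ 4 * n ^ 3
nN²≤4n³ zero    = z≤n
nN²≤4n³ (suc k) = ≤-trans (*-monoʳ-≤ (suc k) square) (≤-reflexive (x*[4*y] (suc k) (suc k ^ 2)))
  where
  double : 2 + k ≤ 2 * suc k
  double = ≤-trans (s≤s (m≤n+m (suc k) k)) (≤-reflexive (cong (suc k +_) (sym (+-identityʳ (suc k)))))
  x*[4*y] : ∀ x y → x * (4 * y) ≡ 4 * (x * y)
  x*[4*y] x y = trans (sym (*-assoc x 4 y)) (trans (cong (_* y) (*-comm x 4)) (*-assoc 4 x y))
  square-double : ∀ x → (2 * x) ^ 2 ≡ 4 * x ^ 2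
  square-double x = trans (cong (2 * x *_) (*-identityʳ (2 * x)))
    (trans ([m*n]*[o*p]≡[m*o]*[n*p] 2 x 2 x) (cong (λ y → 4 * (x * y)) (sym (*-identityʳ x))))
  square : (2 + k) ^ 2 ≤ 4 * suc k ^ 2
  square = ≤-trans (^-monoˡ-≤ 2 double) (≤-reflexive (square-double (suc k)))

-- Here no factor n is available, so n = 0 requires the summand 1.
N²≤4n³+1 : ∀ n → suc n ^ 2 ≤ 4 * n ^ 3 + 1
N²≤4n³+1 zero    = ≤-refl
N²≤4n³+1 (suc k) = ≤-trans (m≤n*m ((2 + k) ^ 2) (suc k)) (≤-trans (nN²≤4n³ (suc k)) (m≤m+n _ 1))

orientFactor : ℕ → ℕ → ℕ
orientFactor σ ω = ω + ((3 + 4 * σ) + (9 + 16))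

-- Mirrors the time bound summand by summand: every loop count and m become 1, and a power N²
-- becomes 5 in the term for the tree and 4 in the terms for the rounds.
totalFactor : ℕ → ℕ → ℕ → ℕ → ℕ
totalFactor γ σ κ ω = 5 * γ + (4 * σ + (9 + ((9 + ((9 + (κ + 12) + 12) + (o + (o + (o + o))))) + 12)))
  where o = orientFactor σ ω

module Arithmetic (n m : ℕ) (cube : n ^ 3 ≤ n ^ 3 * m + 1) where

  M : ℕ
  M = n ^ 3 * m + 1

  1≤M : 1 ≤ M
  1≤M = m≤n+m 1 (n ^ 3 * m)

  -- The multiplier a allows bounding products n * (x + y) summand by summand.
  record Within (a x k : ℕ) : Set where
    constructor within
    field bound : a * x ≤ k * M

  infixr 5 _⊕_

  _⊕_ : ∀ {a x y k l} → Within a x k → Within a y l → Within a (x + y) (k + l)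
  _⊕_ {a} {x} {y} {k} {l} (within p) (within q) = within (≤-trans (≤-reflexive (*-distribˡ-+ a x y))
    (≤-trans (+-mono-≤ p q) (≤-reflexive (sym (*-distribʳ-+ M k l)))))

  product-within : ∀ {a x y k} → Within (a * x) y k → Within a (x * y) k
  product-within {a} {x} {y} (within p) = within (≤-trans (≤-reflexive (sym (*-assoc a x y))) p)

  scaled-within : ∀ {a k} x y → a * y ≤ k * M → Within a (x * y) (k * x)
  scaled-within {a} {k} x y p = within (begin
    a * (x * y)   ≡⟨ cong (a *_) (*-comm x y) ⟩
    a * (y * x)   ≡⟨ *-assoc a y x ⟨
    a * y * x     ≤⟨ *-monoˡ-≤ x p ⟩
    k * M * x     ≡⟨ *-assoc k M x ⟩
    k * (M * x)   ≡⟨ cong (k *_) (*-comm M x) ⟩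
    k * (x * M)   ≡⟨ *-assoc k x M ⟨
    k * x * M     ∎)
    where open ≤-Reasoning

  const-within : ∀ {a} → a ≤ M → ∀ x → Within a x x
  const-within {a} p x = within (≤-trans (*-monoˡ-≤ x p) (≤-reflexive (*-comm M x)))

  N : ℕ
  N = suc n

  ≤M : ∀ {x} → x ≤ n ^ 3 → x ≤ M
  ≤M p = ≤-trans p cube

  *m≤M : ∀ {x} → x ≤ n ^ 3 → x * m ≤ M
  *m≤M p = ≤-trans (*-monoˡ-≤ m p) (m≤m+n _ 1)

  N²≤5M : 1 * N ^ 2 ≤ 5 * M
  N²≤5M = ≤-trans (≤-reflexive (*-identityˡ (N ^ 2))) (≤-trans (N²≤4n³+1 n) (≤-trans
    (+-mono-≤ (*-monoʳ-≤ 4 cube) 1≤M) (≤-reflexive (+-comm (4 * M) M))))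

  nmN²≤4M : n * m * N ^ 2 ≤ 4 * M
  nmN²≤4M = begin
    n * m * N ^ 2         ≡⟨ *-assoc n m (N ^ 2) ⟩
    n * (m * N ^ 2)       ≡⟨ cong (n *_) (*-comm m (N ^ 2)) ⟩
    n * (N ^ 2 * m)       ≡⟨ *-assoc n (N ^ 2) m ⟨
    n * N ^ 2 * m         ≤⟨ *-monoˡ-≤ m (nN²≤4n³ n) ⟩
    4 * n ^ 3 * m         ≡⟨ *-assoc 4 (n ^ 3) m ⟩
    4 * (n ^ 3 * m)       ≤⟨ *-monoʳ-≤ 4 (m≤m+n (n ^ 3 * m) 1) ⟩
    4 * M                 ∎
    where open ≤-Reasoning

  module _ (γ σ κ ω : ℕ) where

    R : ℕ
    R = σ * N ^ 2

    orientBound : ℕ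
    orientBound = ω + ((3 + R) + (9 + n * 16))

    edgeBound : ℕ
    edgeBound = orientBound + (orientBound + (orientBound + orientBound))

    scanTime : ℕ
    scanTime = 9 + n * ((9 + (n * ((9 + n * (κ + 12)) + 12) + m * edgeBound)) + 12)

    orient-within : Within (n * m) orientBound (orientFactor σ ω)
    orient-within = c ω ⊕ (c 3 ⊕ scaled-within {n * m} {4} σ (N ^ 2) nmN²≤4M) ⊕ c 9 ⊕
      product-within (const-within (≤-trans (≤-reflexive nmn) (*m≤M (n²≤n³ n))) 16)
      where
      c : ∀ x → Within (n * m) x x
      c = const-within (*m≤M (n≤n³ n))
      nmn : n * m * n ≡ n * n * m
      nmn = trans (*-assoc n m n) (trans (cong (n *_) (*-comm m n)) (sym (*-assoc n n m)))

    scanTime-within : Within 1 scanTime (9 + ((9 + ((9 + (κ + 12) + 12) +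
      (orientFactor σ ω + (orientFactor σ ω + (orientFactor σ ω + orientFactor σ ω))))) + 12))
    scanTime-within = const-within 1≤M 9 ⊕ unit n ((c₁ 9 ⊕
        product-within ((c₂ 9 ⊕ product-within (const-within (≤M (≤-reflexive (n³-≡ n))) (κ + 12)))
          ⊕ c₂ 12) ⊕
        product-within (orient-within ⊕ orient-within ⊕ orient-within ⊕ orient-within)) ⊕ c₁ 12)
      where
      unit : ∀ x {y k} → Within x y k → Within 1 (x * y) k
      unit x {y} (within p) = within (≤-trans (≤-reflexive (*-identityˡ (x * y))) p)
      c₁ : ∀ x → Within n x x
      c₁ = const-within (≤M (n≤n³ n))
      c₂ : ∀ x → Within (n * n) x x
      c₂ = const-within (≤M (n²≤n³ n))

    total≤ : γ * N ^ 2 + (R * n + scanTime) ≤ totalFactor γ σ κ ω * M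
    total≤ = ≤-trans (≤-reflexive (sym (*-identityˡ _))) (Within.bound
      (scaled-within {1} {5} γ (N ^ 2) N²≤5M ⊕ rounds ⊕ scanTime-within))
      where
      rounds : Within 1 (R * n) (4 * σ)
      rounds = within (≤-trans (≤-reflexive (trans (*-identityˡ (R * n)) (*-comm R n)))
        (Within.bound (scaled-within {n} {4} σ (N ^ 2) (≤-trans (nN²≤4n³ n) (*-monoʳ-≤ 4 cube)))))

program : Cmd
program = grow-tree ▸ scan round

-- For n ≥ 2 there is an edge; the summand 1 settles the graph with a single vertex.
cube≤ : ∀ {n} (G : Graph n) → Connected G → n ^ 3 ≤ n ^ 3 * numEdges G + 1
cube≤ {0} G conn = z≤n
cube≤ {1} G conn = m≤n+m 1 (1 * numEdges G)
cube≤ {suc (suc n)} G conn = ≤-trans (≤-trans (≤-reflexive (sym (*-identityʳ _)))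
  (*-monoʳ-≤ ((2 + n) ^ 3) (Edges.some-edge G conn zero (suc zero) λ ()))) (m≤m+n _ 1)

input-bounded : ∀ {n} (G : Graph n) a i → input G a i ≤ 2 + n
input-bounded {n} G 0 0       = m≤n+m n 2
input-bounded G 0 (suc i)     = z≤n
input-bounded {n} G 1 i with i <? n * n
... | yes p = ≤-trans (bit≤1 _) (s≤s z≤n)
  where
  bit≤1 : ∀ b → bit b ≤ 1
  bit≤1 true  = ≤-refl
  bit≤1 false = z≤n
... | no _  = z≤n
input-bounded G (suc (suc a)) i = z≤n

scanCost : ℕ
scanCost = 2 + cost (andE (ltE (var 21) (var 22)) (edgeE (var 21) (var 22)))

module Solution {n : ℕ} (G : Graph n) (conn : Connected G) (c : Cmd) {σ : ℕ}
                (spec : Rounds.RoundSpec G conn c (σ * suc n ^ 2)) where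
  open Rules n
  open Arithmetic n (numEdges G) (cube≤ G conn)

  scan-solves : ∀ γ {par s} → Tree.Planted G conn par s →
                CorrectOutput G (exec (scan c) s) ×
                γ * N ^ 2 + time (scan c) s ≤ totalFactor γ σ scanCost 17 * M
  scan-solves γ {par} {s} planted =
    Output.correct G conn par c (σ * N ^ 2) spec crossing (proj₁ ran) ,
    ≤-trans (+-monoʳ-≤ (γ * N ^ 2) (begin
      time (scan c) s                                    ≤⟨ m≤m+n _ (Φ (exec (scan c) s)) ⟩
      time (scan c) s + Φ (exec (scan c) s)              ≤⟨ proj₂ ran ⟩
      -- The initial potential amounts to at most n rounds, the possible successes of all descents
      -- together.
      Φ s + (9 + loopSum b₁ 0 n)                         ≤⟨ +-mono-≤
        (*-monoʳ-≤ (σ * N ^ 2) (cnt≤ (λ v → s 3 (toℕ v) ≡ᵇ 1)))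
        (≤-reflexive (trans scanBound-≡ exact)) ⟩
      σ * N ^ 2 * n + scanTime γ σ scanCost 17           ∎))
      (total≤ γ σ scanCost 17)
    where
    open ≤-Reasoning
    open Tree.Planted planted
    open Descent G conn par c (σ * N ^ 2) spec
    open Scan G conn par c (σ * N ^ 2) spec
    initial : I₁ 0 s
    initial = record
      { input-ok = input-ok ; parents = parents ; X = λ _ → true ; sides = all-in
      ; status = inj₁ (undecided , λ _ → refl)
      ; dead = λ { q (_ , _ , _ , _ , _ , inj₁ ())
                 ; q (_ , _ , _ , _ , _ , inj₂ (_ , inj₁ ()))
                 ; q (_ , _ , _ , _ , _ , inj₂ (_ , inj₂ (_ , ()))) } }
    ran : I₁ n (exec (scan c) s) × time (scan c) s + Φ (exec (scan c) s) ≤ Φ s + (9 + loopSum b₁ 0 n)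
    ran = Costs.run scan-costs s initial
    exact : scanBound ≡ scanTime γ σ scanCost 17
    exact = cong (λ o → 9 + n *
      ((9 + (n * ((9 + n * (scanCost + 12)) + 12) + numEdges G * (o + (o + (o + o))))) + 12))
      (cong (λ x → 17 + ((3 + σ * N ^ 2) + (9 + x))) (loopSum-const 4 0 n))

-- Size and loop depth enter through equations, so that the surrounding proofs handle variables in
-- place of large computed numerals.
time-bounded : ∀ n c {γ d} → size c ≡ γ → loopDepth c ≡ d → ∀ s → Semantics.time n c s ≤ γ * suc n ^ d
time-bounded n c refl refl = TimeBound.time≤ n c

module _ {n : ℕ} (G : Graph n) (conn : Connected G) where
  open Rules n
  open Execution G using (Triple)

  solved-after : ∀ c d {γ σ} → Rounds.RoundSpec G conn d (σ * suc n ^ 2) →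
    (∀ s → time c s ≤ γ * suc n ^ 2) →
    Triple (_≡ input G) c (λ s → ∃ λ par → Tree.Planted G conn par s) →
    CorrectOutput G (exec (c ▸ scan d) (input G)) ×
    time (c ▸ scan d) (input G) ≤ totalFactor γ σ scanCost 17 * (n ^ 3 * numEdges G + 1)
  solved-after c d {γ} {σ} spec within grown =
    let par , planted = Execution.Triple.run grown (input G) refl
        correct , t = Solution.scan-solves G conn d {σ} spec γ planted
    in correct , ≤-trans (+-monoˡ-≤ _ (within (input G))) t

solves : ∀ {γ σ} → size grow-tree ≡ γ → size round ≡ σ → ∀ n (G : Graph n) → Connected G →
         Solves (compile program) 9 G (totalFactor γ σ scanCost 17 * (n ^ 3 * numEdges G + 1))
solves {γ} {σ} γ-size σ-size n G conn w wide =
  _ , _ , proj₁ (Compile.compile⇓ n w wide program refl (input-bounded G , refl)) , proj₂ solved ,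
    proj₁ solved
  where
  solved = solved-after G conn grow-tree round {γ} {σ} (Rounds.round-spec G conn σ-size refl)
    (time-bounded n grow-tree γ-size refl) (Tree.grow-tree-does G conn)

theorem5p2 : ∃[ P ] ∃[ k ] ∃[ c ]
    (∀ (n : ℕ) (G : Graph n) → Connected G → ¬ HasStarCutset G →
    Solves P k G (c * (n ^ 3 * numEdges G + 1)))
theorem5p2 = compile program , 9 , totalFactor (size grow-tree) (size round) scanCost 17 ,
  λ n G conn _ → solves refl refl n G conn
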